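{- Let $\alpha \geq 1$ be a real number and let $S$ be an infinite set of positive integers of polynomial density $\alpha$. Let $P(S)$ be the set of primes dividing at least one element of $S$, and let $\pi_S(n) = \operatorname{card}\{p \in P(S) : p \leq n\}$. Then: (a) The set $P(S)$ is infinite. (b) Let $r > 1$ be a real number. Then for every integer $k \geq 1$ there are infinitely many positive integers $n$ with $\log_k n > 0$ such that $$\pi_S(n) \geq \frac{n^{1/\alpha}}{\left(\prod_{j=1}^{k-1} \log_j n\right) (\log_k n)^r}.$$ In particular, $\pi_S(n) \geq n^{1/\alpha}/(\log n)^r$ for infinitely many $n$ (the case $k=1$), and $\pi_S(n) \geq n^{1/\alpha}/\bigl(\log n\,(\log\log n)^r\bigr)$ for infinitely many $n$ (the case $k=2$).
   Context: For real $\alpha \geq 1$ (not necessarily an integer), an infinite set $S$ of positive integers is said to have polynomial density $\alpha$ if $S$ is the range of a strictly increasing sequence $(s_n)_{n=1}^\infty$ of positive integers such that $s_n = O(n^\alpha)$, i.e. there is a constant $C > 0$ with $s_n \leq C n^\alpha$ for all $n \geq 1$. (Only this upper bound is required.) The set of prime factors of elements of $S$ is $$P(S) = \{p : p \text{ is prime and } p \mid s \text{ for at least one } s \in S\}.$$ Here $\log$ is the natural logarithm and $\log_j$ denotes the $j$-fold iterated natural logarithm: $\log_1 n = \log n$ and $\log_{j+1} n = \log(\log_j n)$, defined whenever $\log_j n > 0$. An empty product equals $1$. If $\log_k n$ is defined and positive, then $\log_j n$ is positive for all $1 \leq j \leq k$. -}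

module Defs where

open import Data.Fin.Base as Fin using (Fin)
open import Data.Fin.Properties using (injective⇒≤; inject≤-injective)
open import Data.Integer.Base as ℤ using (+_)
open import Data.Nat.Base as ℕ using (ℕ; zero; suc; _!)
import Data.Nat.Properties as ℕₚ
open import Data.Nat.Divisibility using (_∣_)
open import Data.Nat.Primality using (Prime)
open import Data.Product using (Σ; ∃; ∃-syntax; _×_; _,_; proj₁; proj₂)
open import Data.Rational.Base
  using (ℚ; 0ℚ; 1ℚ; ½; _+_; _*_; _-_; -_; _≤_; _<_; ∣_∣; 1/_; _/_
        ; positive; Positive; NonZero)
import Data.Rational.Properties as ℚₚ
open import Data.Rational.Solver using (module +-*-Solver)
open import Function.Bundles using (_⇔_; mk⇔)
open import Function.Definitions using (Injective)
open import Level using (Level)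
open import Relation.Unary using (Pred; _∈_)
open import Relation.Binary.PropositionalEquality
  using (_≡_; refl; sym; trans; cong; cong₂; subst)

private variable
  ℓ : Level

-- Real numbers, as Cauchy sequences of rationals.  Equal reals are those
-- related by _≃ℝ_; propositional equality of ℝ plays no role.

IsCauchy : (ℕ → ℚ) → Set
IsCauchy x = ∀ ε → 0ℚ < ε →
  ∃[ N ] ∀ m n → N ℕ.≤ m → N ℕ.≤ n → ∣ x m - x n ∣ ≤ ε

record ℝ : Set where
  constructor mkℝ
  field
    seq    : ℕ → ℚ
    cauchy : IsCauchy seq

open ℝ public

infix  4 _≤ℝ_ _<ℝ_ _≃ℝ_
infixl 6 _+ℝ_
infixl 7 _*ℝ_
infixr 8 _^ℝ_

_≤ℝ_ : ℝ → ℝ → Set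
x ≤ℝ y = ∀ ε → 0ℚ < ε → ∃[ N ] ∀ n → N ℕ.≤ n → seq x n ≤ seq y n + ε

_<ℝ_ : ℝ → ℝ → Set
x <ℝ y = ∃[ ε ] 0ℚ < ε × ∃[ N ] ∀ n → N ℕ.≤ n → seq x n + ε ≤ seq y n

_≃ℝ_ : ℝ → ℝ → Set
x ≃ℝ y = x ≤ℝ y × y ≤ℝ x

fromℚ : ℚ → ℝ
fromℚ q = mkℝ (λ _ → q) λ ε 0<ε →
  0 , λ _ _ _ _ → subst (_≤ ε) (sym (cong ∣_∣ (ℚₚ.+-inverseʳ q))) (ℚₚ.<⇒≤ 0<ε)

fromℕ : ℕ → ℝ
fromℕ n = fromℚ (+ n / 1)

0ℝ 1ℝ : ℝ
0ℝ = fromℚ 0ℚ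
1ℝ = fromℚ 1ℚ

private
  open ℚₚ.≤-Reasoning

  halve : ∀ {ε} → 0ℚ < ε → 0ℚ < ½ * ε
  halve {ε} 0<ε =
    ℚₚ.positive⁻¹ (½ * ε) {{ℚₚ.pos*pos⇒pos ½ ε {{positive 0<ε}}}}

  halves : ∀ ε → ½ * ε + ½ * ε ≡ ε
  halves ε = trans (sym (ℚₚ.*-distribʳ-+ ε ½ ½)) (ℚₚ.*-identityˡ ε)

  abstract
    +-cauchy : ∀ {x y} → IsCauchy x → IsCauchy y → IsCauchy (λ n → x n + y n)
    +-cauchy {x} {y} cx cy ε 0<ε
      with cx (½ * ε) (halve 0<ε) | cy (½ * ε) (halve 0<ε)
    ... | M , hx | N , hy = M ℕ.⊔ N , λ m n le le′ → begin
      ∣ (x m + y m) - (x n + y n) ∣       ≡⟨ cong ∣_∣ (lem (x m) (y m) (x n) (y n)) ⟩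
      ∣ (x m - x n) + (y m - y n) ∣       ≤⟨ ℚₚ.∣p+q∣≤∣p∣+∣q∣ (x m - x n) (y m - y n) ⟩
      ∣ x m - x n ∣ + ∣ y m - y n ∣       ≤⟨ ℚₚ.+-mono-≤
        (hx m n (ℕₚ.m⊔n≤o⇒m≤o M N le) (ℕₚ.m⊔n≤o⇒m≤o M N le′))
        (hy m n (ℕₚ.m⊔n≤o⇒n≤o M N le) (ℕₚ.m⊔n≤o⇒n≤o M N le′)) ⟩
      ½ * ε + ½ * ε                       ≡⟨ halves ε ⟩
      ε                                   ∎
      where
      open +-*-Solver
      lem : ∀ a b c d → (a + b) - (c + d) ≡ (a - c) + (b - d)
      lem = solve 4 (λ a b c d → (a :+ b) :- (c :+ d) := (a :- c) :+ (b :- d)) refl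

  bounded : ∀ {x} → IsCauchy x →
    ∃[ B ] Positive B × ∃[ N ] ∀ n → N ℕ.≤ n → ∣ x n ∣ ≤ B
  bounded {x} cx with cx 1ℚ (ℚₚ.positive⁻¹ 1ℚ)
  ... | N , h = 1ℚ + ∣ x N ∣
    , ℚₚ.pos+nonNeg⇒pos 1ℚ ∣ x N ∣ {{ℚₚ.∣-∣-nonNeg (x N)}}
    , N , λ n le → begin
    ∣ x n ∣                    ≡⟨ cong ∣_∣ (lem (x n) (x N)) ⟩
    ∣ (x n - x N) + x N ∣      ≤⟨ ℚₚ.∣p+q∣≤∣p∣+∣q∣ (x n - x N) (x N) ⟩
    ∣ x n - x N ∣ + ∣ x N ∣    ≤⟨ ℚₚ.+-monoˡ-≤ ∣ x N ∣ (h n N le ℕₚ.≤-refl) ⟩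
    1ℚ + ∣ x N ∣               ∎
    where
    open +-*-Solver
    lem : ∀ a b → a ≡ (a - b) + b
    lem = solve 2 (λ a b → a := (a :- b) :+ b) refl

  -- A Cauchy sequence varies eventually by at most ε / B.
  scaled : ∀ {x} → IsCauchy x → ∀ B → Positive B → ∀ ε → 0ℚ < ε →
    ∃[ N ] ∀ m n → N ℕ.≤ m → N ℕ.≤ n → B * ∣ x m - x n ∣ ≤ ε
  scaled {x} cx B B>0 ε 0<ε =
    proj₁ c , λ m n le le′ → begin
      B * ∣ x m - x n ∣    ≤⟨ ℚₚ.*-monoˡ-≤-nonNeg B {{ℚₚ.pos⇒nonNeg B}} (proj₂ c m n le le′) ⟩
      B * (1/ B * ε)       ≡⟨ sym (ℚₚ.*-assoc B (1/ B) ε) ⟩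
      B * 1/ B * ε         ≡⟨ cong (_* ε) (ℚₚ.*-inverseʳ B) ⟩
      1ℚ * ε               ≡⟨ ℚₚ.*-identityˡ ε ⟩
      ε                    ∎
    where
    instance
      pB : Positive B
      pB = B>0
      nzB : NonZero B
      nzB = ℚₚ.pos⇒nonZero B
    c = cx (1/ B * ε) (ℚₚ.positive⁻¹ (1/ B * ε)
          {{ℚₚ.pos*pos⇒pos (1/ B) {{ℚₚ.1/pos⇒pos B}} ε {{positive 0<ε}}}})

  product-bound : ∀ {a b c d A B ε} → ∣ a ∣ ≤ A → ∣ d ∣ ≤ B →
    A * ∣ b - d ∣ ≤ ½ * ε → B * ∣ a - c ∣ ≤ ½ * ε → ∣ a * b - c * d ∣ ≤ ε
  product-bound {a} {b} {c} {d} {A} {B} {ε} ha hd hb hc = begin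
    ∣ a * b - c * d ∣                            ≡⟨ cong ∣_∣ (lem a b c d) ⟩
    ∣ a * (b - d) + d * (a - c) ∣                ≤⟨ ℚₚ.∣p+q∣≤∣p∣+∣q∣ (a * (b - d)) (d * (a - c)) ⟩
    ∣ a * (b - d) ∣ + ∣ d * (a - c) ∣            ≡⟨ cong₂ _+_ (ℚₚ.∣p*q∣≡∣p∣*∣q∣ a (b - d)) (ℚₚ.∣p*q∣≡∣p∣*∣q∣ d (a - c)) ⟩
    ∣ a ∣ * ∣ b - d ∣ + ∣ d ∣ * ∣ a - c ∣        ≤⟨ ℚₚ.+-mono-≤ (scale ∣ a ∣ A (b - d) ha) (scale ∣ d ∣ B (a - c) hd) ⟩
    A * ∣ b - d ∣ + B * ∣ a - c ∣                ≤⟨ ℚₚ.+-mono-≤ hb hc ⟩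
    ½ * ε + ½ * ε                                ≡⟨ halves ε ⟩
    ε                                            ∎
    where
    open +-*-Solver
    distrib : ∀ a b c → a * (b - c) ≡ a * b - a * c
    distrib a b c = trans (ℚₚ.*-distribˡ-+ a b (- c))
      (cong (λ t → a * b + t) (sym (ℚₚ.neg-distribʳ-* a c)))
    telescope : ∀ u v w → u - w ≡ (u - v) + (v - w)
    telescope = solve 3 (λ u v w → u :- w := (u :- v) :+ (v :- w)) refl
    lem : ∀ a b c d → a * b - c * d ≡ a * (b - d) + d * (a - c)
    lem a b c d = trans (telescope (a * b) (a * d) (c * d))
      (cong₂ _+_ (sym (distrib a b d))
        (trans (cong₂ _-_ (ℚₚ.*-comm a d) (ℚₚ.*-comm c d)) (sym (distrib d a c))))
    scale : ∀ p q r → p ≤ q → p * ∣ r ∣ ≤ q * ∣ r ∣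
    scale p q r = ℚₚ.*-monoʳ-≤-nonNeg ∣ r ∣ {{ℚₚ.∣-∣-nonNeg r}} {p} {q}

  abstract
    *-cauchy : ∀ {x y} → IsCauchy x → IsCauchy y → IsCauchy (λ n → x n * y n)
    *-cauchy {x} {y} cx cy ε 0<ε =
      let A , A>0 , N₁ , hA = bounded {x} cx
          B , B>0 , N₂ , hB = bounded {y} cy
          N₃ , hy = scaled {y} cy A A>0 (½ * ε) (halve 0<ε)
          N₄ , hx = scaled {x} cx B B>0 (½ * ε) (halve 0<ε)
      in (N₁ ℕ.⊔ N₂) ℕ.⊔ (N₃ ℕ.⊔ N₄) , λ m n le le′ →
        let l  = ℕₚ.m⊔n≤o⇒m≤o (N₁ ℕ.⊔ N₂) (N₃ ℕ.⊔ N₄) le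
            l′ = ℕₚ.m⊔n≤o⇒m≤o (N₁ ℕ.⊔ N₂) (N₃ ℕ.⊔ N₄) le′
            r  = ℕₚ.m⊔n≤o⇒n≤o (N₁ ℕ.⊔ N₂) (N₃ ℕ.⊔ N₄) le
            r′ = ℕₚ.m⊔n≤o⇒n≤o (N₁ ℕ.⊔ N₂) (N₃ ℕ.⊔ N₄) le′
        in product-bound {x m} {y m} {x n} {y n} {A} {B} {ε}
          (hA m (ℕₚ.m⊔n≤o⇒m≤o N₁ N₂ l))
          (hB n (ℕₚ.m⊔n≤o⇒n≤o N₁ N₂ l′))
          (hy m n (ℕₚ.m⊔n≤o⇒m≤o N₃ N₄ r) (ℕₚ.m⊔n≤o⇒m≤o N₃ N₄ r′))
          (hx m n (ℕₚ.m⊔n≤o⇒n≤o N₃ N₄ r) (ℕₚ.m⊔n≤o⇒n≤o N₃ N₄ r′))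

_+ℝ_ : ℝ → ℝ → ℝ
x +ℝ y = mkℝ (λ n → seq x n + seq y n) (+-cauchy {seq x} {seq y} (cauchy x) (cauchy y))

_*ℝ_ : ℝ → ℝ → ℝ
x *ℝ y = mkℝ (λ n → seq x n * seq y n) (*-cauchy {seq x} {seq y} (cauchy x) (cauchy y))

_^ℝ_ : ℝ → ℕ → ℝ
x ^ℝ zero  = 1ℝ
x ^ℝ suc n = x ^ℝ n *ℝ x

-- ∏ L m = L 1 * ... * L m
∏ : (ℕ → ℝ) → ℕ → ℝ
∏ L zero    = 1ℝ
∏ L (suc m) = ∏ L m *ℝ L (suc m)

-- Division, exp, log and real powers are given by their graphs: the last
-- argument is the value, determined up to _≃ℝ_ by the others.

-- q = x / y, for a positive divisor y
Quotient : (x y q : ℝ) → Set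
Quotient x y q = 0ℝ <ℝ y × q *ℝ y ≃ℝ x

Converges : (ℕ → ℝ) → ℝ → Set
Converges u y = ∀ ε → 0ℚ < ε → ∃[ N ] ∀ n → N ℕ.≤ n →
  u n ≤ℝ y +ℝ fromℚ ε × y ≤ℝ u n +ℝ fromℚ ε

-- expSum x n is the sum of x ^ i / i! over i ≤ n
expSum : ℝ → ℕ → ℝ
expSum x zero    = 1ℝ
expSum x (suc n) =
  expSum x n +ℝ fromℚ ((+ 1 / (suc n !)) {{suc n ℕₚ.!≢0}}) *ℝ x ^ℝ suc n

Exp : (x y : ℝ) → Set
Exp x y = Converges (expSum x) y

Log : (x y : ℝ) → Set
Log x y = Exp y x

-- y = x ^ a = exp (a log x), for x positive
Power : (x a y : ℝ) → Set
Power x a y = ∃[ l ] Log x l × Exp (a *ℝ l) y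

-- IteratedLog x j y says that log_j x is defined and equal to y (j ≥ 1)
data IteratedLog (x : ℝ) : ℕ → ℝ → Set where
  first : ∀ {y} → Log x y → IteratedLog x 1 y
  next  : ∀ {j y z} → IteratedLog x j y → 0ℝ <ℝ y → Log y z →
          IteratedLog x (suc j) z

-- y = x ^ (1 / α), for α positive
Root : (x α y : ℝ) → Set
Root x α y = ∃[ β ] Quotient 1ℝ α β × Power x β y

InfinitelyMany : Pred ℕ ℓ → Set ℓ
InfinitelyMany A = ∀ N → ∃[ n ] N ℕ.< n × n ∈ A

-- "card A ≥ m".  Constructively the cardinality of a finite set such as
-- {p ∈ P(S) : p ≤ n} need not be computable, so it is compared with
-- numbers through injections; atLeast⇔≤ shows that nothing else changes.
AtLeast : Pred ℕ ℓ → ℕ → Set ℓ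
AtLeast A m = Σ (Fin m → ℕ) λ f → Injective _≡_ _≡_ f × ∀ i → f i ∈ A

HasCard : Pred ℕ ℓ → ℕ → Set ℓ
HasCard A c = Σ (Fin c → ℕ) λ f →
  Injective _≡_ _≡_ f × (∀ i → f i ∈ A) × (∀ {a} → a ∈ A → ∃[ i ] f i ≡ a)

atLeast⇔≤ : {A : Pred ℕ ℓ} {c m : ℕ} → HasCard A c → AtLeast A m ⇔ m ℕ.≤ c
atLeast⇔≤ {A = A} {c} {m} (f , f-inj , f∈A , f-onto) = mk⇔ to from
  where
  to : AtLeast A m → m ℕ.≤ c
  to (g , g-inj , g∈A) = injective⇒≤ {f = λ i → proj₁ (f-onto (g∈A i))} λ {i} {j} eq →
    g-inj (trans (sym (proj₂ (f-onto (g∈A i))))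
                 (trans (cong f eq) (proj₂ (f-onto (g∈A j)))))
  from : m ℕ.≤ c → AtLeast A m
  from m≤c = (λ i → f (Fin.inject≤ i m≤c))
    , (λ eq → inject≤-injective m≤c m≤c _ _ (f-inj eq)) , λ i → f∈A _

-- "card A ≥ x" for real x
AtLeastℝ : Pred ℕ ℓ → ℝ → Set ℓ
AtLeastℝ A x = ∃[ m ] AtLeast A m × x ≤ℝ fromℕ m

-- The terms of s are indexed from 0: s i is the (i+1)-st.
BigOPower : (α : ℝ) → (ℕ → ℕ) → Set
BigOPower α s = ∃[ C ] 0ℝ <ℝ C ×
  (∀ i → ∃[ y ] Power (fromℕ (suc i)) α y × fromℕ (s i) ≤ℝ C *ℝ y)

-- S is the range of s; that S is infinite and consists of positive integers
-- follows from the first two conjuncts.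
PolynomialDensity : (α : ℝ) → Pred ℕ ℓ → Set ℓ
PolynomialDensity α S = Σ (ℕ → ℕ) λ s →
  (∀ i → 0 ℕ.< s i) ×
  (∀ i → s i ℕ.< s (suc i)) ×
  (∀ n → n ∈ S ⇔ (∃[ i ] s i ≡ n)) ×
  BigOPower α s

P : Pred ℕ ℓ → Pred ℕ ℓ
P S p = Prime p × ∃[ n ] n ∈ S × p ∣ n

P≤ : Pred ℕ ℓ → ℕ → Pred ℕ ℓ
P≤ S n p = p ∈ P S × p ℕ.≤ n

infix 4 π_⟨_⟩≥_
π_⟨_⟩≥_ : Pred ℕ ℓ → ℕ → ℝ → Set ℓ
π S ⟨ n ⟩≥ x = AtLeastℝ (P≤ S n) x

-- v = n^(1/α) / ((∏_{1≤j<k} log_j n) (log_k n)^r), where log_k n > 0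
Bound : (α r : ℝ) (k n : ℕ) (v : ℝ) → Set
Bound α r k n v =
  ∃[ L ] (∀ j → 1 ℕ.≤ j → j ℕ.≤ k → IteratedLog (fromℕ n) j (L j)) × 0ℝ <ℝ L k ×
  ∃[ a ] Root (fromℕ n) α a ×
  ∃[ b ] Power (L k) r b ×
  Quotient a (∏ L (k ℕ.∸ 1) *ℝ b) v

-- v = n^(1/α) / (log n)^r, where log n > 0
Bound₁ : (α r : ℝ) (n : ℕ) (v : ℝ) → Set
Bound₁ α r n v =
  ∃[ l ] Log (fromℕ n) l × 0ℝ <ℝ l ×
  ∃[ a ] Root (fromℕ n) α a ×
  ∃[ b ] Power l r b ×
  Quotient a b v

-- v = n^(1/α) / (log n (log log n)^r), where log log n > 0
Bound₂ : (α r : ℝ) (n : ℕ) (v : ℝ) → Set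
Bound₂ α r n v =
  ∃[ l ] Log (fromℕ n) l × 0ℝ <ℝ l ×
  ∃[ ll ] Log l ll × 0ℝ <ℝ ll ×
  ∃[ a ] Root (fromℕ n) α a ×
  ∃[ b ] Power ll r b ×
  Quotient a (l *ℝ b) v

{-# OPTIONS --safe #-}

-- Give m the weight m ^ (- 1 / α).  Since s i = O (i ^ α), the terms of the
-- sequence have infinite total weight.  On the other hand, fix a bound Y.  Each
-- term is bounded (in terms of Y and b), or divisible by the b-th power of some
-- y ≤ Y, or by a prime above Y in P(S).  If the weights of these divisors add up
-- to at most 1/2, then the numbers composed from them have bounded total weight,
-- as in a geometric series.  So the sum of p ^ (- 1 / α) over the large primes in
-- P(S) is not small, and as the Bertrand series
-- Σ 1 / D i with D i = i log i ... (log^(k-1) i)^r converges, for infinitely many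
-- i the set P(S) has more than a constant times 2 ^ (i / α) / D i elements in
-- [2 ^ i , 2 ^ (i + 1)).  This gives both parts, with n = 2 ^ (i + 1) in (b).
--
-- For constructivity only finitely many terms are used, their number T being
-- fixed in advance, and 1 / α is replaced by a rational approximation that
-- depends on T.  Weights are then powers of 2, and sums of weights are replaced
-- by sums of integer parts, so that the argument takes place in ℕ.

module Submission where

-- The order of the choices matters. `Summable` yields a start `i₀` that serves all weights at once,
-- so `i₀`, the power `b`, the cofactor bound `Π`, the number `T` and the range `I` can all be fixed
-- before the exponent function `φ`, which depends on `I`. Only the constants `A` and `c` of
-- `Admissible` must be the same for every `I`.
--
-- The small divisors are powers of every `y` in a range, prime or not: there are `2 ^ i₀` of them,
-- and `b` is chosen so that each weighs at most `2 ^ (- (i₀ + 2))`.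
--
-- The real exponent `r` never meets the sieve. The series for `bertrand (2 + k)` ends in
-- `x * (log x) ^ 2`, up to constants, and is the same for every `r`. The number `r` enters only at
-- the end, because `x * (log x) ^ 2 = O (x ^ r)`.
--
-- Membership in P(S) need not be decidable. Therefore only primes that divide one of finitely many
-- terms are listed, and a finite search decides between a large block and the contradiction.

-- The sieve argument in natural numbers.

module Sieve where

  open import Data.Empty using (⊥; ⊥-elim)
  open import Data.Fin.Base as Fin using (Fin)
  open import Data.List.Base
    using (List; []; _∷_; _++_; map; concat; filter; length; lookup; applyUpTo; cartesianProductWith)
  open import Data.List.Properties using (map-++; map-applyUpTo; map-∘)
  open import Data.List.Membership.Propositional using (_∈_; lose; find)
  open import Data.List.Membership.Propositional.Properties
    using (∈-++⁺ˡ; ∈-++⁺ʳ; ∈-++⁻; ∈-concat⁺′; ∈-concat⁻′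
          ; ∈-filter⁺; ∈-filter⁻; ∈-applyUpTo⁺; ∈-applyUpTo⁻; ∈-∃++; ∈-lookup; ∈-cartesianProductWith⁺; ∈-cartesianProductWith⁻)
  open import Data.List.Relation.Unary.All as All using (All; []; _∷_)
  open import Data.List.Relation.Unary.AllPairs using ([]; _∷_)
  open import Data.List.Relation.Unary.Any using (here; there; any?)
  open import Data.List.Relation.Unary.Unique.Propositional using (Unique)
  open import Data.List.Relation.Unary.Unique.Propositional.Properties using (applyUpTo⁺₁; filter⁺)
  open import Data.List.Relation.Binary.Permutation.Propositional.Properties using (shift; map⁺)
  open import Data.Nat.Base
  open import Data.Nat.Divisibility
  open import Data.Nat.Induction using (<-rec)
  open import Data.Nat.ListAction using (sum; product)
  open import Data.Nat.ListAction.Properties using (sum-++; sum-↭)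
  open import Data.Nat.Logarithm
  open import Data.Nat.Primality
  open import Data.Nat.Primality.Factorisation using (factorise)
  open import Data.Nat.Properties
  open import Data.Nat.Solver using (module +-*-Solver)
  open import Data.Product.Base using (∃-syntax; _×_; _,_; proj₁; proj₂)
  open import Data.Sum.Base using (_⊎_; inj₁; inj₂)
  open import Function.Base using (_∘_)
  open import Relation.Nullary using (Dec; yes; no; contradiction)
  open import Relation.Nullary.Decidable using (_×-dec_)
  open import Relation.Unary using (Pred; Decidable)
  open import Relation.Binary.PropositionalEquality

  open ≤-Reasoning

  -- Binary logarithms.

  n<2^n : ∀ n → n < 2 ^ n
  n<2^n zero    = s≤s z≤n
  n<2^n (suc n) = begin
    suc (suc n)       ≡⟨ +-comm 1 (suc n) ⟩
    suc n + 1         ≤⟨ +-mono-≤ (n<2^n n) (m^n>0 2 n) ⟩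
    2 ^ n + 2 ^ n     ≡⟨ cong (2 ^ n +_) (sym (+-identityʳ (2 ^ n))) ⟩
    2 ^ suc n         ∎

  lg : ℕ → ℕ
  lg n = ⌊log₂ n ⌋

  2^≤⇒≤lg : ∀ {e n} → 2 ^ e ≤ n → e ≤ lg n
  2^≤⇒≤lg {e} le = subst (_≤ _) (⌊log₂[2^n]⌋≡n e) (⌊log₂⌋-mono-≤ le)

  n<2^[1+lg] : ∀ n → n < 2 ^ suc (lg n)
  n<2^[1+lg] n with 2 ^ suc (lg n) ≤? n
  ... | yes le = contradiction (2^≤⇒≤lg le) 1+n≰n
  ... | no  ≰n = ≰⇒> ≰n

  2^lg≤ : ∀ n → 1 ≤ n → 2 ^ lg n ≤ n
  2^lg≤ = <-rec _ step
    where
    step : ∀ n → (∀ {m} → m < n → 1 ≤ m → 2 ^ lg m ≤ m) → 1 ≤ n → 2 ^ lg n ≤ n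
    step 1                _   _ = ≤-refl
    step (suc n₀@(suc n)) rec _ = begin
      2 ^ lg m                    ≡⟨ cong (2 ^_) lg≡ ⟩
      2 * 2 ^ lg ⌊ m /2⌋          ≤⟨ *-monoʳ-≤ 2 (rec (⌊n/2⌋<n n₀) (s≤s z≤n)) ⟩
      2 * ⌊ m /2⌋                 ≡⟨ cong (⌊ m /2⌋ +_) (+-identityʳ _) ⟩
      ⌊ m /2⌋ + ⌊ m /2⌋           ≤⟨ +-monoʳ-≤ ⌊ m /2⌋ (⌊n/2⌋≤⌈n/2⌉ m) ⟩
      ⌊ m /2⌋ + ⌈ m /2⌉           ≡⟨ ⌊n/2⌋+⌈n/2⌉≡n m ⟩
      m                           ∎
      where
      m = suc (suc n)
      lg≡ : lg m ≡ suc (lg ⌊ m /2⌋)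
      lg≡ = trans (sym (m+[n∸m]≡n (2^≤⇒≤lg {1} {m} (s≤s (s≤s z≤n)))))
                  (cong suc (sym (⌊log₂⌊n/2⌋⌋≡⌊log₂n⌋∸1 m)))

  <2^⇒lg≤ : ∀ {e n} → n < 2 ^ suc e → lg n ≤ e
  <2^⇒lg≤ {e} {zero}  _  = z≤n
  <2^⇒lg≤ {e} {suc n} lt with lg (suc n) ≤? e
  ... | yes le = le
  ... | no  ≰e = contradiction lt
        (≤⇒≯ (≤-trans (^-monoʳ-≤ 2 (≰⇒> ≰e)) (2^lg≤ (suc n) (s≤s z≤n))))

  lg-superadditive : ∀ a b → 1 ≤ a → 1 ≤ b → lg a + lg b ≤ lg (a * b)
  lg-superadditive a b 1≤a 1≤b = 2^≤⇒≤lg (begin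
    2 ^ (lg a + lg b)     ≡⟨ ^-distribˡ-+-* 2 (lg a) (lg b) ⟩
    2 ^ lg a * 2 ^ lg b   ≤⟨ *-mono-≤ (2^lg≤ a 1≤a) (2^lg≤ b 1≤b) ⟩
    a * b                 ∎)

  -- Finite sums

  Σ< : (ℕ → ℕ) → ℕ → ℕ
  Σ< f n = sum (applyUpTo f n)

  Σ<-mono : ∀ {f g} n → (∀ i → i < n → f i ≤ g i) → Σ< f n ≤ Σ< g n
  Σ<-mono zero    _   = z≤n
  Σ<-mono (suc n) f≤g = +-mono-≤ (f≤g 0 (s≤s z≤n)) (Σ<-mono n (λ i i<n → f≤g (suc i) (s≤s i<n)))

  Σ<-+ : ∀ f m n → Σ< f (m + n) ≡ Σ< f m + Σ< (f ∘ (m +_)) n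
  Σ<-+ f zero    n = refl
  Σ<-+ f (suc m) n = trans (cong (f 0 +_) (Σ<-+ (f ∘ suc) m n)) (sym (+-assoc (f 0) _ _))

  Σ<-monoʳ : ∀ f {m n} → m ≤ n → Σ< f m ≤ Σ< f n
  Σ<-monoʳ f {m} {n} m≤n = begin
    Σ< f m                                 ≤⟨ m≤m+n _ _ ⟩
    Σ< f m + Σ< (f ∘ (m +_)) (n ∸ m)       ≡⟨ Σ<-+ f m (n ∸ m) ⟨
    Σ< f (m + (n ∸ m))                     ≡⟨ cong (Σ< f) (m+[n∸m]≡n m≤n) ⟩
    Σ< f n                                 ∎

  Σ<-cong : ∀ {f g} n → (∀ i → f i ≡ g i) → Σ< f n ≡ Σ< g n
  Σ<-cong zero    _   = refl
  Σ<-cong (suc n) f≡g = cong₂ _+_ (f≡g 0) (Σ<-cong n (f≡g ∘ suc))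

  Σ<-const : ∀ c n → Σ< (λ _ → c) n ≡ n * c
  Σ<-const c zero    = refl
  Σ<-const c (suc n) = cong (c +_) (Σ<-const c n)

  Σ<-*ˡ : ∀ c f n → Σ< (λ i → c * f i) n ≡ c * Σ< f n
  Σ<-*ˡ c f zero    = sym (*-zeroʳ c)
  Σ<-*ˡ c f (suc n) = trans (cong (c * f 0 +_) (Σ<-*ˡ c (f ∘ suc) n)) (sym (*-distribˡ-+ c (f 0) _))

  Σ[_] : (ℕ → ℕ) → List ℕ → ℕ
  Σ[ f ] xs = sum (map f xs)

  Σ-mono : ∀ {f g} xs → (∀ x → x ∈ xs → f x ≤ g x) → Σ[ f ] xs ≤ Σ[ g ] xs
  Σ-mono []       _   = z≤n
  Σ-mono (x ∷ xs) f≤g = +-mono-≤ (f≤g x (here refl)) (Σ-mono xs (λ y y∈ → f≤g y (there y∈)))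

  Σ-++ : ∀ f xs ys → Σ[ f ] (xs ++ ys) ≡ Σ[ f ] xs + Σ[ f ] ys
  Σ-++ f xs ys = trans (cong sum (map-++ f xs ys)) (sum-++ (map f xs) (map f ys))

  Σ-*ˡ : ∀ c f xs → Σ[ (λ x → c * f x) ] xs ≡ c * Σ[ f ] xs
  Σ-*ˡ c f []       = sym (*-zeroʳ c)
  Σ-*ˡ c f (x ∷ xs) = trans (cong (c * f x +_) (Σ-*ˡ c f xs)) (sym (*-distribˡ-+ c (f x) _))

  Σ-applyUpTo : ∀ f g n → Σ[ f ] (applyUpTo g n) ≡ Σ< (f ∘ g) n
  Σ-applyUpTo f g n = cong sum (map-applyUpTo g f n)

  Σ-≤-const : ∀ {f c} xs → (∀ x → x ∈ xs → f x ≤ c) → Σ[ f ] xs ≤ length xs * c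
  Σ-≤-const []       _   = z≤n
  Σ-≤-const (x ∷ xs) f≤c = +-mono-≤ (f≤c x (here refl)) (Σ-≤-const xs (λ y y∈ → f≤c y (there y∈)))

  Σ-concat : ∀ f (xss : ℕ → List ℕ) n →
    Σ[ f ] (concat (applyUpTo xss n)) ≡ Σ< (λ i → Σ[ f ] (xss i)) n
  Σ-concat f xss zero    = refl
  Σ-concat f xss (suc n) = trans (Σ-++ f (xss 0) _) (cong (Σ[ f ] (xss 0) +_) (Σ-concat f (xss ∘ suc) n))

  -- Removing from `ys` one occurrence of the head of `xs` leaves a list that still contains the
  -- tail, by uniqueness. Repetitions in `ys` are harmless, so `generated` may list a number many
  -- times.
  Unique-Σ-≤ : ∀ f {xs} ys → Unique xs → (∀ {x} → x ∈ xs → x ∈ ys) → Σ[ f ] xs ≤ Σ[ f ] ys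
  Unique-Σ-≤ f {[]}     ys _             _   = z≤n
  Unique-Σ-≤ f {x ∷ xs} ys (x∉ ∷ unique) sub with ∈-∃++ (sub (here refl))
  ... | us , vs , refl = begin
    f x + Σ[ f ] xs             ≤⟨ +-monoʳ-≤ (f x) (Unique-Σ-≤ f (us ++ vs) unique sub′) ⟩
    f x + Σ[ f ] (us ++ vs)     ≡⟨ sum-↭ (map⁺ f (shift x us vs)) ⟨
    Σ[ f ] (us ++ x ∷ vs)       ∎
    where
    sub′ : ∀ {y} → y ∈ xs → y ∈ us ++ vs
    sub′ y∈ with ∈-++⁻ us (sub (there y∈))
    ... | inj₁ y∈us         = ∈-++⁺ˡ y∈us
    ... | inj₂ (here refl)  = contradiction refl (All.lookup x∉ y∈)
    ... | inj₂ (there y∈vs) = ∈-++⁺ʳ us y∈vs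

  -- X ⇣ k is the integer part of X / 2 ^ k.

  infixl 8 _⇣_
  _⇣_ : ℕ → ℕ → ℕ
  X ⇣ zero  = X
  X ⇣ suc k = ⌊ X /2⌋ ⇣ k

  ⇣-+ : ∀ X a b → X ⇣ (a + b) ≡ X ⇣ a ⇣ b
  ⇣-+ X zero    b = refl
  ⇣-+ X (suc a) b = ⇣-+ ⌊ X /2⌋ a b

  ⇣-≤ : ∀ X k → X ⇣ k ≤ X
  ⇣-≤ X zero    = ≤-refl
  ⇣-≤ X (suc k) = ≤-trans (⇣-≤ ⌊ X /2⌋ k) (⌊n/2⌋≤n X)

  ⇣-antitone : ∀ X {a b} → a ≤ b → X ⇣ b ≤ X ⇣ a
  ⇣-antitone X {a} {b} a≤b = begin
    X ⇣ b              ≡⟨ cong (X ⇣_) (m+[n∸m]≡n a≤b) ⟨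
    X ⇣ (a + (b ∸ a))  ≡⟨ ⇣-+ X a (b ∸ a) ⟩
    X ⇣ a ⇣ (b ∸ a)    ≤⟨ ⇣-≤ (X ⇣ a) (b ∸ a) ⟩
    X ⇣ a              ∎

  2*⌊n/2⌋≤n : ∀ n → 2 * ⌊ n /2⌋ ≤ n
  2*⌊n/2⌋≤n n = begin
    2 * ⌊ n /2⌋           ≡⟨ cong (⌊ n /2⌋ +_) (+-identityʳ _) ⟩
    ⌊ n /2⌋ + ⌊ n /2⌋     ≤⟨ +-monoʳ-≤ ⌊ n /2⌋ (⌊n/2⌋≤⌈n/2⌉ n) ⟩
    ⌊ n /2⌋ + ⌈ n /2⌉     ≡⟨ ⌊n/2⌋+⌈n/2⌉≡n n ⟩
    n                     ∎

  2^*⇣≤ : ∀ X k → 2 ^ k * X ⇣ k ≤ X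
  2^*⇣≤ X zero    = ≤-reflexive (*-identityˡ X)
  2^*⇣≤ X (suc k) = begin
    2 * 2 ^ k * ⌊ X /2⌋ ⇣ k     ≡⟨ *-assoc 2 (2 ^ k) _ ⟩
    2 * (2 ^ k * ⌊ X /2⌋ ⇣ k)   ≤⟨ *-monoʳ-≤ 2 (2^*⇣≤ ⌊ X /2⌋ k) ⟩
    2 * ⌊ X /2⌋                 ≤⟨ 2*⌊n/2⌋≤n X ⟩
    X                           ∎

  2^⇣ : ∀ a b → (2 ^ (a + b)) ⇣ a ≡ 2 ^ b
  2^⇣ zero    b = refl
  2^⇣ (suc a) b = trans (cong (_⇣ a) half) (2^⇣ a b)
    where
    half : ⌊ 2 ^ suc (a + b) /2⌋ ≡ 2 ^ (a + b)
    half = trans (cong (λ t → ⌊ 2 ^ (a + b) + t /2⌋) (+-identityʳ _)) (sym (n≡⌊n+n/2⌋ _))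

  -- Convergence of the series Σ 1 / G i: the tails of Σ ⌊ X / G i ⌋ are at most
  -- X / J, for every X.

  Summable : (ℕ → ℕ) → Set
  Summable G = ∀ J N → ∃[ i₀ ] N ≤ i₀ × (∀ f X → (∀ i → i₀ ≤ i → f i * G i ≤ X) →
    ∀ n → J * Σ< (f ∘ (i₀ +_)) n ≤ X)

  -- A geometric series, scaled by `2 ^ i₀`: the first term contributes at most `X`, and twice the
  -- rest is the same sum started at `i₀ + 1`, at most `2 * X` by induction.
  2^-tail : ∀ i₀ f X → (∀ i → i₀ ≤ i → f i * 2 ^ i ≤ X) → ∀ n →
    2 ^ i₀ * Σ< (f ∘ (i₀ +_)) n ≤ 2 * X
  2^-tail i₀ f X hf zero    = ≤-trans (≤-reflexive (*-zeroʳ (2 ^ i₀))) z≤n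
  2^-tail i₀ f X hf (suc n) = begin
    2 ^ i₀ * (f (i₀ + 0) + rest)             ≡⟨ *-distribˡ-+ (2 ^ i₀) _ _ ⟩
    2 ^ i₀ * f (i₀ + 0) + 2 ^ i₀ * rest      ≤⟨ +-mono-≤ head tail ⟩
    X + X                                    ≡⟨ cong (X +_) (+-identityʳ X) ⟨
    2 * X                                    ∎
    where
    rest = Σ< (f ∘ (i₀ +_) ∘ suc) n
    head : 2 ^ i₀ * f (i₀ + 0) ≤ X
    head = begin
      2 ^ i₀ * f (i₀ + 0)   ≡⟨ cong (λ t → 2 ^ i₀ * f t) (+-identityʳ i₀) ⟩
      2 ^ i₀ * f i₀         ≡⟨ *-comm (2 ^ i₀) (f i₀) ⟩
      f i₀ * 2 ^ i₀         ≤⟨ hf i₀ ≤-refl ⟩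
      X                     ∎
    tail : 2 ^ i₀ * rest ≤ X
    tail = *-cancelˡ-≤ 2 (begin
      2 * (2 ^ i₀ * rest)                         ≡⟨ *-assoc 2 (2 ^ i₀) rest ⟨
      2 ^ suc i₀ * rest                           ≡⟨ cong (2 ^ suc i₀ *_) (Σ<-cong n (λ i → cong f (+-suc i₀ i))) ⟩
      2 ^ suc i₀ * Σ< (f ∘ (suc i₀ +_)) n         ≤⟨ 2^-tail (suc i₀) f X (λ i le → hf i (<⇒≤ le)) n ⟩
      2 * X                                       ∎)

  2^-summable : Summable (2 ^_)
  2^-summable J N = i₀ , m≤n+m N (2 * J) , λ f X hf n → *-cancelˡ-≤ 2 (begin
    2 * (J * Σ< (f ∘ (i₀ +_)) n)     ≡⟨ *-assoc 2 J _ ⟨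
    2 * J * Σ< (f ∘ (i₀ +_)) n       ≤⟨ *-monoˡ-≤ _ (≤-trans (m≤m+n (2 * J) N) (<⇒≤ (n<2^n i₀))) ⟩
    2 ^ i₀ * Σ< (f ∘ (i₀ +_)) n      ≤⟨ 2^-tail i₀ f X hf n ⟩
    2 * X                            ∎)
    -- This makes `2 ^ i₀` exceed `2 * J`: `J` is the required smallness, 2 the sum of the geometric
    -- series.
    where i₀ = 2 * J + N

  dyadicBlock : (ℕ → ℕ) → ℕ → ℕ
  dyadicBlock f m = Σ< (f ∘ (2 ^ m +_)) (2 ^ m)

  -- A dyadic block has at least one index, so the `n` blocks from `m` on cover the `n` indices from
  -- `2 ^ m` on.
  Σ<-dyadic : ∀ f m n → Σ< (f ∘ (2 ^ m +_)) n ≤ Σ< (dyadicBlock f ∘ (m +_)) n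
  Σ<-dyadic f m zero    = z≤n
  Σ<-dyadic f m (suc n) = begin
    Σ< (f ∘ (2 ^ m +_)) (suc n)                     ≤⟨ Σ<-monoʳ (f ∘ (2 ^ m +_)) (+-monoˡ-≤ n (m^n>0 2 m)) ⟩
    Σ< (f ∘ (2 ^ m +_)) (2 ^ m + n)                 ≡⟨ Σ<-+ (f ∘ (2 ^ m +_)) (2 ^ m) n ⟩
    dyadicBlock f m + Σ< (f ∘ (2 ^ m +_) ∘ (2 ^ m +_)) n
      ≡⟨ cong (dyadicBlock f m +_) (Σ<-cong n (λ i → cong f (reindex i))) ⟩
    dyadicBlock f m + Σ< (f ∘ (2 ^ suc m +_)) n     ≤⟨ +-monoʳ-≤ _ (Σ<-dyadic f (suc m) n) ⟩
    dyadicBlock f m + Σ< (dyadicBlock f ∘ (suc m +_)) n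
      ≡⟨ cong₂ (λ a b → dyadicBlock f a + b) (sym (+-identityʳ m))
           (Σ<-cong n (λ i → cong (dyadicBlock f) (sym (+-suc m i)))) ⟩
    Σ< (dyadicBlock f ∘ (m +_)) (suc n)             ∎
    where
    reindex : ∀ i → 2 ^ m + (2 ^ m + i) ≡ 2 ^ suc m + i
    reindex i = trans (sym (+-assoc (2 ^ m) (2 ^ m) i))
      (cong (λ t → 2 ^ m + t + i) (sym (+-identityʳ (2 ^ m))))

  -- Cauchy condensation: block `m` consists of `2 ^ m` indices `i ≥ 2 ^ m` with `lg i = m`, so
  -- `f i` is at most `X / (2 ^ m * H m)` there and the block sum at most `X / H m`. The tail bound
  -- for `H` then applies to the block sums.
  condensation : ∀ {H} → Summable H → Summable (λ i → i * H (lg i))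
  condensation {H} sumH J N with sumH J N
  ... | m₀ , N≤m₀ , tail = 2 ^ m₀ , ≤-trans N≤m₀ (<⇒≤ (n<2^n m₀)) , λ f X hf n → begin
    J * Σ< (f ∘ (2 ^ m₀ +_)) n                ≤⟨ *-monoʳ-≤ J (Σ<-dyadic f m₀ n) ⟩
    J * Σ< (dyadicBlock f ∘ (m₀ +_)) n        ≤⟨ tail (dyadicBlock f) X (block f X hf) n ⟩
    X                                         ∎
    where
    block : ∀ f X → (∀ i → 2 ^ m₀ ≤ i → f i * (i * H (lg i)) ≤ X) →
      ∀ m → m₀ ≤ m → dyadicBlock f m * H m ≤ X
    block f X hf m m₀≤m = *-cancelˡ-≤ (2 ^ m) {{m^n≢0 2 m}} (begin
      2 ^ m * (dyadicBlock f m * H m)                       ≡⟨ rearrange (2 ^ m) (dyadicBlock f m) (H m) ⟩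
      2 ^ m * H m * dyadicBlock f m                         ≡⟨ Σ<-*ˡ (2 ^ m * H m) (f ∘ (2 ^ m +_)) (2 ^ m) ⟨
      Σ< (λ j → 2 ^ m * H m * f (2 ^ m + j)) (2 ^ m)        ≤⟨ Σ<-mono (2 ^ m) term ⟩
      Σ< (λ _ → X) (2 ^ m)                                  ≡⟨ Σ<-const X (2 ^ m) ⟩
      2 ^ m * X                                             ∎)
      where
      rearrange : ∀ a b c → a * (b * c) ≡ a * c * b
      rearrange = solve 3 (λ a b c → a :* (b :* c) := a :* c :* b) refl
        where open +-*-Solver
      term : ∀ j → j < 2 ^ m → 2 ^ m * H m * f (2 ^ m + j) ≤ X
      term j j<2^m = begin
        2 ^ m * H m * f i             ≡⟨ *-comm (2 ^ m * H m) (f i) ⟩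
        f i * (2 ^ m * H m)           ≤⟨ *-monoʳ-≤ (f i) (*-monoˡ-≤ (H m) (m≤m+n (2 ^ m) j)) ⟩
        f i * (i * H m)               ≡⟨ cong (λ t → f i * (i * H t)) lg≡ ⟨
        f i * (i * H (lg i))          ≤⟨ hf i (≤-trans (^-monoʳ-≤ 2 m₀≤m) (m≤m+n (2 ^ m) j)) ⟩
        X                             ∎
        where
        i = 2 ^ m + j
        lg≡ : lg i ≡ m
        lg≡ = ≤-antisym
          (<2^⇒lg≤ (≤-trans (+-monoʳ-< (2 ^ m) j<2^m) (≤-reflexive (cong (2 ^ m +_) (sym (+-identityʳ _))))))
          (2^≤⇒≤lg (m≤m+n (2 ^ m) j))

  -- bertrand k i = i * lg i * ... * lg^(k-1) i * 2 ^ lg^k i, with iterates of lg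
  bertrand : ℕ → ℕ → ℕ
  bertrand zero    i = 2 ^ i
  bertrand (suc k) i = i * bertrand k (lg i)

  bertrand-summable : ∀ k → Summable (bertrand k)
  bertrand-summable zero    = 2^-summable
  bertrand-summable (suc k) = condensation (bertrand-summable k)

  -- Let m have weight 2 ^ (- ψ m).  A list of divisors of total weight at most
  -- 1/2 generates, from cofactors up to Π, numbers of total weight at most 2 * Π.
  -- Weights are multiplied by X and rounded down.

  interval : ℕ → List ℕ
  interval n = applyUpTo suc n

  generated : List ℕ → ℕ → ℕ → List ℕ
  generated ds Π zero    = interval Π
  generated ds Π (suc n) = interval Π ++ cartesianProductWith _*_ ds (generated ds Π n)

  generated≥1 : ∀ {ds Π} → (∀ d → d ∈ ds → 1 ≤ d) → ∀ n {m} → m ∈ generated ds Π n → 1 ≤ m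
  generated≥1 {ds} {Π} ds≥1 n m∈ = go n m∈
    where
    interval≥1 : ∀ {m} → m ∈ interval Π → 1 ≤ m
    interval≥1 m∈ with ∈-applyUpTo⁻ suc m∈
    ... | _ , _ , refl = s≤s z≤n
    go : ∀ n {m} → m ∈ generated ds Π n → 1 ≤ m
    go zero    m∈ = interval≥1 m∈
    go (suc n) m∈ with ∈-++⁻ (interval Π) m∈
    ... | inj₁ m∈′ = interval≥1 m∈′
    ... | inj₂ m∈′ with ∈-cartesianProductWith⁻ _*_ ds (generated ds Π n) m∈′
    ... | d , m′ , d∈ , m′∈ , refl = *-mono-≤ (ds≥1 d d∈) (go n m′∈)

  Σ-cartesianProductWith : ∀ f g xs ys →
    Σ[ f ] (cartesianProductWith g xs ys) ≡ Σ[ (λ x → Σ[ (λ y → f (g x y)) ] ys) ] xs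
  Σ-cartesianProductWith f g []       ys = refl
  Σ-cartesianProductWith f g (x ∷ xs) ys = trans (Σ-++ f (map (g x) ys) _)
    (cong₂ _+_ (cong sum (sym (map-∘ ys))) (Σ-cartesianProductWith f g xs ys))

  module _ {ψ : ℕ → ℕ} (ψ-superadditive : ∀ a b → 1 ≤ a → 1 ≤ b → ψ a + ψ b ≤ ψ (a * b))
           {ds : List ℕ} (ds≥1 : ∀ d → d ∈ ds → 1 ≤ d)
           (light : ∀ X → 2 * Σ[ (λ d → X ⇣ ψ d) ] ds ≤ X) (Π : ℕ) where

    -- The bound reproduces itself: the bare cofactors weigh at most `Π`, and the products at most
    -- half of the `2 * Π` of the previous depth. The scale `X` varies in the induction, because a
    -- divisor `d` turns it into `X ⇣ ψ d`; by `⇣-+`, rounding in two stages is the same as rounding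
    -- once.
    generated-weight : ∀ n X → Σ[ (λ m → X ⇣ ψ m) ] (generated ds Π n) ≤ 2 * (Π * X)
    generated-weight n X = go n X
      where
      interval-weight : ∀ X → Σ[ (λ m → X ⇣ ψ m) ] (interval Π) ≤ Π * X
      interval-weight X = begin
        Σ[ (λ m → X ⇣ ψ m) ] (interval Π)   ≡⟨ Σ-applyUpTo (λ m → X ⇣ ψ m) suc Π ⟩
        Σ< (λ i → X ⇣ ψ (suc i)) Π          ≤⟨ Σ<-mono Π (λ i _ → ⇣-≤ X (ψ (suc i))) ⟩
        Σ< (λ _ → X) Π                      ≡⟨ Σ<-const X Π ⟩
        Π * X                               ∎
      go : ∀ n X → Σ[ (λ m → X ⇣ ψ m) ] (generated ds Π n) ≤ 2 * (Π * X)
      go zero    X = ≤-trans (interval-weight X) (m≤n*m (Π * X) 2)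
      go (suc n) X = begin
        Σ[ w X ] (interval Π ++ products)                     ≡⟨ Σ-++ (w X) (interval Π) products ⟩
        Σ[ w X ] (interval Π) + Σ[ w X ] products             ≤⟨ +-mono-≤ (interval-weight X) products-weight ⟩
        Π * X + Π * X                                         ≡⟨ cong (Π * X +_) (+-identityʳ _) ⟨
        2 * (Π * X)                                           ∎
        where
        w : ℕ → ℕ → ℕ
        w X m = X ⇣ ψ m
        gen = generated ds Π n
        products = cartesianProductWith _*_ ds gen
        cofactors : ∀ d → d ∈ ds → Σ[ (λ m → w X (d * m)) ] gen ≤ 2 * Π * w X d
        cofactors d d∈ = begin
          Σ[ (λ m → w X (d * m)) ] gen       ≤⟨ Σ-mono gen (λ m m∈ → ≤-trans
            (⇣-antitone X (ψ-superadditive d m (ds≥1 d d∈) (generated≥1 ds≥1 n m∈)))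
            (≤-reflexive (⇣-+ X (ψ d) (ψ m)))) ⟩
          Σ[ w (w X d) ] gen                 ≤⟨ go n (w X d) ⟩
          2 * (Π * w X d)                    ≡⟨ *-assoc 2 Π _ ⟨
          2 * Π * w X d                      ∎
        products-weight : Σ[ w X ] products ≤ Π * X
        products-weight = begin
          Σ[ w X ] products                                    ≡⟨ Σ-cartesianProductWith (w X) _*_ ds gen ⟩
          Σ[ (λ d → Σ[ (λ m → w X (d * m)) ] gen) ] ds         ≤⟨ Σ-mono ds cofactors ⟩
          Σ[ (λ d → 2 * Π * w X d) ] ds                        ≡⟨ Σ-*ˡ (2 * Π) (w X) ds ⟩
          2 * Π * Σ[ w X ] ds                                  ≡⟨ cong (_* Σ[ w X ] ds) (*-comm 2 Π) ⟩
          Π * 2 * Σ[ w X ] ds                                  ≡⟨ *-assoc Π 2 _ ⟩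
          Π * (2 * Σ[ w X ] ds)                                ≤⟨ *-monoʳ-≤ Π (light X) ⟩
          Π * X                                                ∎

  module _ {ℓ} {Good : Pred ℕ ℓ} {ds : List ℕ} {Π : ℕ}
           (good≥1 : ∀ {m} → Good m → 1 ≤ m)
           (split : ∀ {m} → Good m → m ≤ Π ⊎ (∃[ d ] ∃[ m′ ] d ∈ ds × m ≡ d * m′ × Good m′))
           (ds≥2 : ∀ d → d ∈ ds → 2 ≤ d) where

    -- The number itself bounds the depth: divisors are at least 2, so splitting one off leaves a
    -- strictly smaller number.
    ∈-generated : ∀ n {m} → m ≤ n → Good m → m ∈ generated ds Π n
    ∈-generated zero    m≤n good = contradiction (≤-trans (good≥1 good) m≤n) λ ()
    ∈-generated (suc n) m≤n good with split good
    ... | inj₁ m≤Π = ∈-++⁺ˡ (∈-interval (good≥1 good) m≤Π)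
      where
      ∈-interval : ∀ {m} → 1 ≤ m → m ≤ Π → m ∈ interval Π
      ∈-interval {suc m} _ m<Π = ∈-applyUpTo⁺ suc m<Π
    ... | inj₂ (d , m′ , d∈ , refl , good′) =
      ∈-++⁺ʳ (interval Π) (∈-cartesianProductWith⁺ _*_ d∈ (∈-generated n (s≤s⁻¹ (begin
        suc m′     ≤⟨ +-monoˡ-≤ m′ (good≥1 good′) ⟩
        m′ + m′    ≡⟨ cong (m′ +_) (+-identityʳ m′) ⟨
        2 * m′     ≤⟨ *-monoˡ-≤ m′ (ds≥2 d d∈) ⟩
        d * m′     ≤⟨ m≤n ⟩
        suc n      ∎)) good′))

  lookup-injective : ∀ {xs : List ℕ} → Unique xs → ∀ {i j} → lookup xs i ≡ lookup xs j → i ≡ j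
  lookup-injective (_ ∷ _)       {Fin.zero}  {Fin.zero}  _  = refl
  lookup-injective (x∉ ∷ _)      {Fin.zero}  {Fin.suc j} eq = contradiction eq (All.lookup x∉ (∈-lookup j))
  lookup-injective (x∉ ∷ _)      {Fin.suc i} {Fin.zero}  eq = contradiction (sym eq) (All.lookup x∉ (∈-lookup i))
  lookup-injective (_ ∷ unique)  {Fin.suc i} {Fin.suc j} eq = cong Fin.suc (lookup-injective unique eq)

  -- Divisibility

  ^-monoʳ-∣ : ∀ y {m n} → m ≤ n → y ^ m ∣ y ^ n
  ^-monoʳ-∣ y {m} {n} m≤n = divides (y ^ (n ∸ m)) (trans (cong (y ^_) (sym (m∸n+n≡m m≤n)))
    (^-distribˡ-+-* y (n ∸ m) m))

  primeDivisor : ∀ n → 2 ≤ n → ∃[ p ] Prime p × p ∣ n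
  primeDivisor n@(suc _) 2≤n with factorise n
  ... | record { factors = [] ; isFactorisation = refl } = contradiction 2≤n λ { (s≤s ()) }
  ... | record { factors = p ∷ ps ; isFactorisation = eq ; factorsPrime = p-prime ∷ _ } =
    p , p-prime , subst (p ∣_) (sym eq) (m∣m*n (product ps))

  valuation : ∀ y → 2 ≤ y → ∀ m → 1 ≤ m → ∃[ j ] ∃[ m′ ] m ≡ y ^ j * m′ × y ∤ m′
  valuation y 2≤y = <-rec _ step
    where
    step : ∀ m → (∀ {k} → k < m → 1 ≤ k → ∃[ j ] ∃[ m′ ] k ≡ y ^ j * m′ × y ∤ m′) →
      1 ≤ m → ∃[ j ] ∃[ m′ ] m ≡ y ^ j * m′ × y ∤ m′
    step m rec 1≤m with y ∣? m
    ... | no  y∤m = 0 , m , sym (+-identityʳ m) , y∤m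
    ... | yes (divides (suc q) refl) with rec {suc q} (m<m*n (suc q) y 2≤y) (s≤s z≤n)
    ... | j , m′ , eq , y∤m′ = suc j , m′ ,
      trans (cong (_* y) eq) (trans (*-comm (y ^ j * m′) y) (sym (*-assoc y (y ^ j) m′))) , y∤m′

  smooth-powerfree-bound : ℕ → ℕ → ℕ
  smooth-powerfree-bound b zero    = 1
  smooth-powerfree-bound b (suc Y) = (2 + Y) ^ b * smooth-powerfree-bound b Y

  -- Dividing out the full power of `2 + Y` costs at most `b` factors, since its `b`-th power does
  -- not divide `m`, and leaves a cofactor that `2 + Y` does not divide. Whether or not `2 + Y` is
  -- prime, the prime divisors of the cofactor are then smaller than it. In the base case no prime
  -- is left, so the number is 1.
  smooth-powerfree≤ : ∀ b Y m → 1 ≤ m → (∀ p → Prime p → p ∣ m → p < 2 + Y) →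
    (∀ y → y < Y → (2 + y) ^ b ∤ m) → m ≤ smooth-powerfree-bound b Y
  smooth-powerfree≤ b zero    m 1≤m smooth _ with m ≤? 1
  ... | yes m≤1 = m≤1
  ... | no  m≰1 with primeDivisor m (≰⇒> m≰1)
  ... | p , p-prime , p∣m =
    contradiction (smooth p p-prime p∣m) (≤⇒≯ (nonTrivial⇒n>1 p {{prime⇒nonTrivial p-prime}}))
  smooth-powerfree≤ b (suc Y) m 1≤m smooth free with valuation (2 + Y) (s≤s (s≤s z≤n)) m 1≤m
  ... | j , m′ , refl , y∤m′ = *-mono-≤ (^-monoʳ-≤ (2 + Y) j≤b)
    (smooth-powerfree≤ b Y m′ 1≤m′ smooth′ λ y y<Y y^b∣m′ →
      free y (m<n⇒m<1+n y<Y) (∣n⇒∣m*n ((2 + Y) ^ j) y^b∣m′))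
    where
    j≤b : j ≤ b
    j≤b with j ≤? b
    ... | yes j≤b = j≤b
    ... | no  j≰b = contradiction
      (∣m⇒∣m*n m′ (^-monoʳ-∣ (2 + Y) (<⇒≤ (≰⇒> j≰b)))) (free Y ≤-refl)
    1≤m′ : 1 ≤ m′
    1≤m′ = n≢0⇒n>0 λ { refl → y∤m′ ((2 + Y) ∣0) }
    smooth′ : ∀ p → Prime p → p ∣ m′ → p < 2 + Y
    smooth′ p p-prime p∣m′ with m≤n⇒m<n∨m≡n (s≤s⁻¹ (smooth p p-prime (∣n⇒∣m*n ((2 + Y) ^ j) p∣m′)))
    ... | inj₁ p<  = p<
    ... | inj₂ refl = contradiction p∣m′ y∤m′

  -- Primes dividing terms of a sequence

  module PrimeBlocks (s : ℕ → ℕ) where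

    -- Membership in `P S` involves an unbounded search; the bound `M` on the index makes it
    -- decidable, so that blocks can be formed as lists.
    DividesBefore : ℕ → Pred ℕ _
    DividesBefore M p = Prime p × ∃[ j ] j < M × p ∣ s j

    dividesBefore? : ∀ M → Decidable (DividesBefore M)
    dividesBefore? M p = prime? p ×-dec anyUpTo? (λ j → p ∣? s j) M

    block : ℕ → ℕ → List ℕ
    block M i = filter (dividesBefore? M) (applyUpTo (2 ^ i +_) (2 ^ i))

    block-unique : ∀ M i → Unique (block M i)
    block-unique M i = filter⁺ (dividesBefore? M) (applyUpTo⁺₁ (2 ^ i +_) (2 ^ i)
      λ j<k _ eq → <⇒≢ j<k (+-cancelˡ-≡ (2 ^ i) _ _ eq))

    ∈-block⁻ : ∀ M i {p} → p ∈ block M i → 2 ^ i ≤ p × p < 2 ^ suc i × DividesBefore M p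
    ∈-block⁻ M i p∈ with ∈-filter⁻ (dividesBefore? M) {xs = applyUpTo (2 ^ i +_) (2 ^ i)} p∈
    ... | p∈′ , p-div with ∈-applyUpTo⁻ (2 ^ i +_) {n = 2 ^ i} p∈′
    ... | j , j< , refl = m≤m+n (2 ^ i) j
      , ≤-trans (+-monoʳ-< (2 ^ i) j<) (≤-reflexive (cong (2 ^ i +_) (sym (+-identityʳ _))))
      , p-div

    ∈-block⁺ : ∀ {M p} → DividesBefore M p → p ∈ block M (lg p)
    ∈-block⁺ {M} {p} p-div@(p-prime , _) = ∈-filter⁺ (dividesBefore? M)
      (subst (_∈ applyUpTo (2 ^ lg p +_) (2 ^ lg p)) (m+[n∸m]≡n 2^lg≤p)
        (∈-applyUpTo⁺ (2 ^ lg p +_) (+-cancelˡ-< (2 ^ lg p) _ _ (begin-strict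
          2 ^ lg p + (p ∸ 2 ^ lg p)   ≡⟨ m+[n∸m]≡n 2^lg≤p ⟩
          p                           <⟨ n<2^[1+lg] p ⟩
          2 ^ suc (lg p)              ≡⟨ cong (2 ^ lg p +_) (+-identityʳ _) ⟩
          2 ^ lg p + 2 ^ lg p         ∎)))) p-div
      where
      2^lg≤p = 2^lg≤ p (>-nonZero⁻¹ p {{prime⇒nonZero p-prime}})

    -- 2 ^ (- φ (lg m)) is meant to approximate m ^ (- 1 / α); for s t = O(t ^ α)
    -- the last condition then says that the weight of s t is not far below 1 / t.
    record Admissible (A c I : ℕ) (φ : ℕ → ℕ) : Set where
      field
        superadditive : ∀ a b → φ a + φ b ≤ φ (a + b)
        lower         : ∀ e → e ≤ I → e ≤ A * (φ e + 3)
        upper         : ∀ t i → i < 2 ^ suc t → φ (lg (s i)) ≤ t + c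

      monotone : ∀ {a b} → a ≤ b → φ a ≤ φ b
      monotone {a} {b} a≤b = begin
        φ a                ≤⟨ m≤m+n _ _ ⟩
        φ a + φ (b ∸ a)    ≤⟨ superadditive a (b ∸ a) ⟩
        φ (a + (b ∸ a))    ≡⟨ cong φ (m+[n∸m]≡n a≤b) ⟩
        φ b                ∎

    -- The harmonic series in dyadic blocks: each of the `2 ^ n` indices `i` in
    -- `[2 ^ n, 2 ^ (n + 1))` has `φ (lg (s i)) ≤ n + c`. Scaled by `2 ^ (T + c)` it weighs at least
    -- `2 ^ (T - n)`, and the whole block at least `2 ^ T`.
    weight-lower : ∀ {A c I φ} → Admissible A c I φ → ∀ T n → n ≤ T →
      n * 2 ^ T ≤ Σ< (λ i → (2 ^ (T + c)) ⇣ φ (lg (s i))) (2 ^ n)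
    weight-lower _ T zero    _   = z≤n
    weight-lower {c = c} {φ = φ} adm T (suc n) n<T = begin
      2 ^ T + n * 2 ^ T                              ≡⟨ +-comm (2 ^ T) _ ⟩
      n * 2 ^ T + 2 ^ T                              ≤⟨ +-mono-≤ (weight-lower adm T n (<⇒≤ n<T)) next ⟩
      Σ< w (2 ^ n) + Σ< (w ∘ (2 ^ n +_)) (2 ^ n)     ≡⟨ Σ<-+ w (2 ^ n) (2 ^ n) ⟨
      Σ< w (2 ^ n + 2 ^ n)                           ≡⟨ cong (Σ< w) (cong (2 ^ n +_) (sym (+-identityʳ _))) ⟩
      Σ< w (2 ^ suc n)                               ∎
      where
      X = 2 ^ (T + c)
      w : ℕ → ℕ
      w i = X ⇣ φ (lg (s i))
      term : ∀ j → j < 2 ^ n → 2 ^ (T ∸ n) ≤ w (2 ^ n + j)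
      term j j< = begin
        2 ^ (T ∸ n)                                ≡⟨ 2^⇣ (n + c) (T ∸ n) ⟨
        (2 ^ (n + c + (T ∸ n))) ⇣ (n + c)            ≡⟨ cong (λ e → (2 ^ e) ⇣ (n + c)) exponent ⟩
        X ⇣ (n + c)                                ≤⟨ ⇣-antitone X (Admissible.upper adm n (2 ^ n + j)
          (≤-trans (+-monoʳ-< (2 ^ n) j<) (≤-reflexive (cong (2 ^ n +_) (sym (+-identityʳ _)))))) ⟩
        w (2 ^ n + j)                              ∎
        where
        exponent : n + c + (T ∸ n) ≡ T + c
        exponent = trans (+-assoc n c _) (trans (cong (n +_) (+-comm c (T ∸ n)))
          (trans (sym (+-assoc n (T ∸ n) c)) (cong (_+ c) (m+[n∸m]≡n (<⇒≤ n<T)))))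
      next : 2 ^ T ≤ Σ< (w ∘ (2 ^ n +_)) (2 ^ n)
      next = begin
        2 ^ T                              ≡⟨ cong (2 ^_) (m+[n∸m]≡n (<⇒≤ n<T)) ⟨
        2 ^ (n + (T ∸ n))                  ≡⟨ ^-distribˡ-+-* 2 n (T ∸ n) ⟩
        2 ^ n * 2 ^ (T ∸ n)                ≡⟨ Σ<-const (2 ^ (T ∸ n)) (2 ^ n) ⟨
        Σ< (λ _ → 2 ^ (T ∸ n)) (2 ^ n)     ≤⟨ Σ<-mono (2 ^ n) term ⟩
        Σ< (w ∘ (2 ^ n +_)) (2 ^ n)        ∎

    module _ (s≥1 : ∀ i → 1 ≤ s i) (s-increasing : ∀ i → s i < s (suc i)) where

      s-mono-< : ∀ {i j} → i < j → s i < s j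
      s-mono-< {i} {suc j} i<1+j with m≤n⇒m<n∨m≡n (s≤s⁻¹ i<1+j)
      ... | inj₁ i<j  = <-trans (s-mono-< i<j) (s-increasing j)
      ... | inj₂ refl = s-increasing i

      -- The approximation is requested only when `I` is known, while `A` and `c` are common to all
      -- `I`. `Good` carries out of the lemma whatever else the caller knows about the `φ` obtained.
      manyPrimes : ∀ {A c K G} → 1 ≤ A → 1 ≤ K → Summable G →
        {Good : ℕ → (ℕ → ℕ) → Set} → (∀ I → ∃[ φ ] Good I φ × Admissible A c I φ) →
        ∀ N → ∃[ I ] ∃[ φ ] Good I φ × ∃[ i ] N ≤ i × i ≤ I ×
          ∃[ M ] K * 2 ^ φ i < length (block M i) * G i
      manyPrimes {A} {c} {K} {G} 1≤A 1≤K sumG {Good} approx N with sumG (4 * K) N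
      -- Why `4 * K`: if every block has `length * G i ≤ K * 2 ^ φ i`, then its weight is at most
      -- `K / G i`, and the blocks together weigh at most 1/4.
      ... | i₀ , N≤i₀ , tail = result
        where
        Y = 2 ^ i₀
        -- By `lower` this gives `φ b ≥ i₀ + 2`, so the `2 ^ i₀` many `b`-th powers weigh at most
        -- 1/4 together.
        b = A * (i₀ + 2 + 3)
        Π = smooth-powerfree-bound b Y
        -- Each of `T` dyadic blocks of indices adds 1 to the weight of the terms scaled by `2 ^ c`,
        -- which is at most `2 * Π * 2 ^ c`: one block too many.
        T = suc (2 * Π * 2 ^ c)
        M = 2 ^ T
        -- `s M` exceeds every prime dividing one of the first `M` terms, hence also the index of
        -- its block. The summand `b` ensures `b ≤ I`, where `lower` is applied to `b`.
        n = b + s M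
        I = i₀ + n
        φ = proj₁ (approx I)
        good = proj₁ (proj₂ (approx I))
        adm = proj₂ (proj₂ (approx I))
        open Admissible adm
        instance
          A≢0 : NonZero A
          A≢0 = >-nonZero 1≤A
          K≢0 : NonZero K
          K≢0 = >-nonZero 1≤K
        enough? : Dec (∃[ i ] i < n × K * 2 ^ φ (i₀ + i) < length (block M (i₀ + i)) * G (i₀ + i))
        enough? = anyUpTo? (λ i → K * 2 ^ φ (i₀ + i) <? length (block M (i₀ + i)) * G (i₀ + i)) n

        module Few (few : ∀ i → i < n → length (block M (i₀ + i)) * G (i₀ + i) ≤ K * 2 ^ φ (i₀ + i)) where
          small large ds : List ℕ
          small = applyUpTo (λ y → (2 + y) ^ b) Y
          large = concat (applyUpTo (λ i → block M (i₀ + i)) n)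
          ds = small ++ large

          ψ : ℕ → ℕ
          ψ = φ ∘ lg
          ψ-superadditive : ∀ a b → 1 ≤ a → 1 ≤ b → ψ a + ψ b ≤ ψ (a * b)
          ψ-superadditive a b 1≤a 1≤b =
            ≤-trans (superadditive (lg a) (lg b)) (monotone (lg-superadditive a b 1≤a 1≤b))

          ∈-large⁻ : ∀ {p} → p ∈ large → DividesBefore M p
          ∈-large⁻ p∈ with ∈-concat⁻′ (applyUpTo (λ i → block M (i₀ + i)) n) p∈
          ... | _ , p∈block , block∈ with ∈-applyUpTo⁻ (λ i → block M (i₀ + i)) block∈
          ... | i , _ , refl = proj₂ (proj₂ (∈-block⁻ M (i₀ + i) p∈block))

          1≤b : 1 ≤ b
          1≤b = *-mono-≤ 1≤A (≤-trans (s≤s z≤n) (m≤n+m 3 (i₀ + 2)))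

          ds≥2 : ∀ d → d ∈ ds → 2 ≤ d
          ds≥2 d d∈ with ∈-++⁻ small d∈
          ... | inj₂ d∈large = nonTrivial⇒n>1 d {{prime⇒nonTrivial (proj₁ (∈-large⁻ d∈large))}}
          ... | inj₁ d∈small with ∈-applyUpTo⁻ (λ y → (2 + y) ^ b) d∈small
          ... | y , _ , refl = begin
            2             ≤⟨ ^-monoʳ-≤ 2 1≤b ⟩
            2 ^ b         ≤⟨ ^-monoˡ-≤ b (m≤m+n 2 y) ⟩
            (2 + y) ^ b   ∎

          small-light : ∀ X → 4 * Σ[ (λ d → X ⇣ ψ d) ] small ≤ X
          small-light X = begin
            4 * Σ[ (λ d → X ⇣ ψ d) ] small         ≡⟨ cong (4 *_) (Σ-applyUpTo (λ d → X ⇣ ψ d) (λ y → (2 + y) ^ b) Y) ⟩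
            4 * Σ< (λ y → X ⇣ ψ ((2 + y) ^ b)) Y   ≤⟨ *-monoʳ-≤ 4 (Σ<-mono Y (λ y _ → ⇣-antitone X (i₀+2≤ψ y))) ⟩
            4 * Σ< (λ _ → X ⇣ (i₀ + 2)) Y          ≡⟨ cong (4 *_) (Σ<-const (X ⇣ (i₀ + 2)) Y) ⟩
            4 * (Y * X ⇣ (i₀ + 2))                 ≡⟨ *-assoc 4 Y _ ⟨
            4 * Y * X ⇣ (i₀ + 2)                   ≡⟨ cong (_* X ⇣ (i₀ + 2)) (trans (*-comm 4 Y) (sym (^-distribˡ-+-* 2 i₀ 2))) ⟩
            2 ^ (i₀ + 2) * X ⇣ (i₀ + 2)            ≤⟨ 2^*⇣≤ X (i₀ + 2) ⟩
            X                                      ∎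
            where
            i₀+2≤ψ : ∀ y → i₀ + 2 ≤ ψ ((2 + y) ^ b)
            i₀+2≤ψ y = begin
              i₀ + 2              ≤⟨ +-cancelʳ-≤ 3 _ _ (*-cancelˡ-≤ A (lower b (≤-trans (m≤m+n b (s M)) (m≤n+m n i₀)))) ⟩
              φ b                 ≤⟨ monotone (2^≤⇒≤lg (^-monoˡ-≤ b (m≤m+n 2 y))) ⟩
              ψ ((2 + y) ^ b)     ∎

          large-light : ∀ X → 4 * Σ[ (λ d → X ⇣ ψ d) ] large ≤ X
          large-light X = *-cancelˡ-≤ K (begin
            K * (4 * Σ[ (λ d → X ⇣ ψ d) ] large)     ≡⟨ trans (sym (*-assoc K 4 _)) (cong (_* Σ[ (λ d → X ⇣ ψ d) ] large) (*-comm K 4)) ⟩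
            4 * K * Σ[ (λ d → X ⇣ ψ d) ] large       ≡⟨ cong (4 * K *_) (Σ-concat _ (λ i → block M (i₀ + i)) n) ⟩
            4 * K * Σ< (λ i → Σ[ (λ d → X ⇣ ψ d) ] (block M (i₀ + i))) n
              ≤⟨ *-monoʳ-≤ (4 * K) (Σ<-mono n block-weight) ⟩
            4 * K * Σ< (f ∘ (i₀ +_)) n               ≤⟨ tail f (K * X) f-bound n ⟩
            K * X                                    ∎)
            where
            f : ℕ → ℕ
            -- `few` speaks only of indices below `i₀ + n`, while `tail` wants a bound for all
            -- `i ≥ i₀`; beyond the range `f` is 0.
            f i with i <? i₀ + n
            ... | yes _ = length (block M i) * X ⇣ φ i
            ... | no  _ = 0
            block-weight : ∀ i → i < n → Σ[ (λ d → X ⇣ ψ d) ] (block M (i₀ + i)) ≤ f (i₀ + i)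
            block-weight i i<n with i₀ + i <? i₀ + n
            ... | no  ≮ = contradiction (+-monoʳ-< i₀ i<n) ≮
            ... | yes _ = Σ-≤-const (block M (i₀ + i)) λ p p∈ →
              ⇣-antitone X (monotone (2^≤⇒≤lg (proj₁ (∈-block⁻ M (i₀ + i) p∈))))
            f-bound : ∀ i → i₀ ≤ i → f i * G i ≤ K * X
            f-bound i i₀≤i with i <? i₀ + n
            ... | no  _ = z≤n
            ... | yes i< = begin
              length (block M i) * X ⇣ φ i * G i       ≡⟨ rearrange (length (block M i)) (X ⇣ φ i) (G i) ⟩
              length (block M i) * G i * X ⇣ φ i       ≤⟨ *-monoˡ-≤ (X ⇣ φ i) few′ ⟩
              K * 2 ^ φ i * X ⇣ φ i                    ≡⟨ *-assoc K (2 ^ φ i) _ ⟩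
              K * (2 ^ φ i * X ⇣ φ i)                  ≤⟨ *-monoʳ-≤ K (2^*⇣≤ X (φ i)) ⟩
              K * X                                    ∎
              where
              rearrange : ∀ a b c → a * b * c ≡ a * c * b
              rearrange = solve 3 (λ a b c → a :* b :* c := a :* c :* b) refl
                where open +-*-Solver
              few′ : length (block M i) * G i ≤ K * 2 ^ φ i
              few′ = subst (λ i → length (block M i) * G i ≤ K * 2 ^ φ i) (m+[n∸m]≡n i₀≤i)
                (few (i ∸ i₀) (+-cancelˡ-< i₀ _ _ (subst (_< i₀ + n) (sym (m+[n∸m]≡n i₀≤i)) i<)))

          light : ∀ X → 2 * Σ[ (λ d → X ⇣ ψ d) ] ds ≤ X
          light X = *-cancelˡ-≤ 2 (begin
            2 * (2 * Σ[ w ] ds)                     ≡⟨ *-assoc 2 2 (Σ[ w ] ds) ⟨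
            4 * Σ[ w ] ds                           ≡⟨ cong (4 *_) (Σ-++ w small large) ⟩
            4 * (Σ[ w ] small + Σ[ w ] large)       ≡⟨ *-distribˡ-+ 4 (Σ[ w ] small) _ ⟩
            4 * Σ[ w ] small + 4 * Σ[ w ] large     ≤⟨ +-mono-≤ (small-light X) (large-light X) ⟩
            X + X                                   ≡⟨ cong (X +_) (+-identityʳ X) ⟨
            2 * X                                   ∎)
            where
            w : ℕ → ℕ
            w d = X ⇣ ψ d

          -- The condition passes to positive divisors, so splitting can go on with the cofactor.
          Composed : ℕ → Set
          Composed m = 1 ≤ m × (∀ p → Prime p → p ∣ m → p < 2 + Y ⊎ p ∈ large)

          -- If no entry of `ds` divides `m`, then no prime of `large` does, which leaves only
          -- primes below `2 + Y`, and no power of `small` does either; so `smooth-powerfree≤`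
          -- applies.
          split : ∀ {m} → Composed m → m ≤ Π ⊎ (∃[ d ] ∃[ m′ ] d ∈ ds × m ≡ d * m′ × Composed m′)
          split {m} (1≤m , factors) with any? (_∣? m) ds
          ... | yes some with find some
          ... | d , d∈ , divides q refl = inj₂ (d , q , d∈ , *-comm q d
            , n≢0⇒n>0 (λ { refl → contradiction 1≤m λ () })
            , λ p p-prime p∣q → factors p p-prime (∣m⇒∣m*n d p∣q))
          split {m} (1≤m , factors) | no none = inj₁ (smooth-powerfree≤ b Y m 1≤m smooth free)
            where
            smooth : ∀ p → Prime p → p ∣ m → p < 2 + Y
            smooth p p-prime p∣m with factors p p-prime p∣m
            ... | inj₁ p<      = p<
            ... | inj₂ p∈large = contradiction (lose (∈-++⁺ʳ small p∈large) p∣m) none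
            free : ∀ y → y < Y → (2 + y) ^ b ∤ m
            free y y<Y y^b∣m =
              none (lose (∈-++⁺ˡ (∈-applyUpTo⁺ (λ y → (2 + y) ^ b) y<Y)) y^b∣m)

          s-composed : ∀ j → j < M → Composed (s j)
          s-composed j j<M = s≥1 j , factors
            where
            factors : ∀ p → Prime p → p ∣ s j → p < 2 + Y ⊎ p ∈ large
            factors p p-prime p∣sj with p <? 2 + Y
            ... | yes p<  = inj₁ p<
            ... | no  p≮ = inj₂ (∈-concat⁺′ (∈-block⁺ (p-prime , j , j<M , p∣sj))
              (subst (λ i → block M i ∈ applyUpTo (λ i → block M (i₀ + i)) n) (m+[n∸m]≡n i₀≤lg)
                (∈-applyUpTo⁺ (λ i → block M (i₀ + i)) lg<n)))
              where
              i₀≤lg : i₀ ≤ lg p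
              i₀≤lg = 2^≤⇒≤lg (≤-trans (m≤n+m Y 2) (≮⇒≥ p≮))
              lg<n : lg p ∸ i₀ < n
              lg<n = begin-strict
                lg p ∸ i₀   ≤⟨ m∸n≤m (lg p) i₀ ⟩
                lg p        <⟨ n<2^n (lg p) ⟩
                2 ^ lg p    ≤⟨ 2^lg≤ p (≤-trans (s≤s z≤n) (≮⇒≥ p≮)) ⟩
                p           ≤⟨ ∣⇒≤ {{>-nonZero (s≥1 j)}} p∣sj ⟩
                s j         ≤⟨ <⇒≤ (s-mono-< j<M) ⟩
                s M         ≤⟨ m≤n+m (s M) b ⟩
                n           ∎

          s-generated : ∀ {m} → m ∈ applyUpTo s M → m ∈ generated ds Π (s M)
          s-generated m∈ with ∈-applyUpTo⁻ s m∈
          ... | j , j<M , refl = ∈-generated proj₁ split ds≥2 (s M) (<⇒≤ (s-mono-< j<M)) (s-composed j j<M)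

          -- In units of `M`, the first `M` terms weigh at least `T`. Being distinct and all
          -- generated, they weigh at most `2 * Π * 2 ^ c`, which is `T - 1`.
          absurd : ⊥
          absurd = 1+n≰n (*-cancelʳ-≤ T (2 * Π * 2 ^ c) M {{m^n≢0 2 T}} (begin
            T * M                                     ≤⟨ weight-lower adm T T ≤-refl ⟩
            Σ< (λ i → X ⇣ ψ (s i)) M                  ≡⟨ Σ-applyUpTo (λ m → X ⇣ ψ m) s M ⟨
            Σ[ (λ m → X ⇣ ψ m) ] (applyUpTo s M)
              ≤⟨ Unique-Σ-≤ (λ m → X ⇣ ψ m) (generated ds Π (s M)) unique s-generated ⟩
            Σ[ (λ m → X ⇣ ψ m) ] (generated ds Π (s M))
              ≤⟨ generated-weight {ψ} ψ-superadditive (λ d d∈ → <⇒≤ (ds≥2 d d∈)) light Π (s M) X ⟩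
            2 * (Π * X)                               ≡⟨ cong (λ t → 2 * (Π * t)) (^-distribˡ-+-* 2 T c) ⟩
            2 * (Π * (M * 2 ^ c))                     ≡⟨ rearrange Π M (2 ^ c) ⟩
            2 * Π * 2 ^ c * M                         ∎))
            where
            X = 2 ^ (T + c)
            unique : Unique (applyUpTo s M)
            unique = applyUpTo⁺₁ s M λ i<j _ eq → <⇒≢ (s-mono-< i<j) eq
            rearrange : ∀ a b c → 2 * (a * (b * c)) ≡ 2 * a * c * b
            rearrange = solve 3 (λ a b c → con 2 :* (a :* (b :* c)) := con 2 :* a :* c :* b) refl
              where open +-*-Solver

        result : ∃[ I ] ∃[ φ ] Good I φ × ∃[ i ] N ≤ i × i ≤ I ×
          ∃[ M ] K * 2 ^ φ i < length (block M i) * G i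
        result with enough?
        ... | yes (i , i<n , many) = I , φ , good , i₀ + i , ≤-trans N≤i₀ (m≤m+n i₀ i)
          , +-monoʳ-≤ i₀ (<⇒≤ i<n) , M , many
        ... | no none = ⊥-elim (Few.absurd λ i i<n → ≮⇒≥ λ many → none (i , i<n , many))

-- Rational inequalities and uniform estimates for the partial sums of exp.

module Rationals where

  open import Data.Integer.Base as ℤ using (+_)
  import Data.Integer.Properties as ℤₚ
  open import Data.Nat.Base as ℕ using (ℕ; zero; suc; _!)
  import Data.Nat.Properties as ℕₚ
  open import Data.Product.Base using (∃-syntax; _×_; _,_; proj₁; proj₂)
  open import Data.Sum.Base using (_⊎_; inj₁; inj₂)
  open import Data.Rational.Base
    using (ℚ; 0ℚ; 1ℚ; ½; _+_; _*_; _-_; -_; _≤_; _<_; ∣_∣; 1/_; _/_; toℚᵘ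
          ; positive; nonNegative; NonZero; ↥_)
  import Data.Rational.Properties as ℚₚ
  open import Data.Rational.Solver using (module +-*-Solver)
  open import Data.Rational.Unnormalised.Base as ℚᵘ using (mkℚᵘ; *≡*; *≤*)
  import Data.Rational.Unnormalised.Properties as ℚᵘₚ
  open import Function.Base using (_∘_)
  open import Relation.Binary.PropositionalEquality

  open ℚₚ.≤-Reasoning

  abstract
    ι : ℕ → ℚ
    ι n = + n / 1

    ι≡ : ∀ n → ι n ≡ + n / 1
    ι≡ n = refl

    ι-0 : ι 0 ≡ 0ℚ
    ι-0 = refl

    ι-1 : ι 1 ≡ 1ℚ
    ι-1 = refl

    toℚᵘ-ι : ∀ n → toℚᵘ (ι n) ℚᵘ.≃ mkℚᵘ (+ n) 0
    toℚᵘ-ι n = ℚₚ.toℚᵘ-fromℚᵘ (mkℚᵘ (+ n) 0)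

    ι-+ : ∀ m n → ι (m ℕ.+ n) ≡ ι m + ι n
    ι-+ m n = ℚₚ.toℚᵘ-injective (ℚᵘₚ.≃-trans (toℚᵘ-ι (m ℕ.+ n)) (ℚᵘₚ.≃-sym
      (ℚᵘₚ.≃-trans (ℚₚ.toℚᵘ-homo-+ (ι m) (ι n))
      (ℚᵘₚ.≃-trans (ℚᵘₚ.+-cong (toℚᵘ-ι m) (toℚᵘ-ι n))
        (*≡* (cong (ℤ._* + 1) (cong₂ ℤ._+_ (ℤₚ.*-identityʳ (+ m)) (ℤₚ.*-identityʳ (+ n)))))))))

    ι-* : ∀ m n → ι (m ℕ.* n) ≡ ι m * ι n
    ι-* m n = ℚₚ.toℚᵘ-injective (ℚᵘₚ.≃-trans (toℚᵘ-ι (m ℕ.* n)) (ℚᵘₚ.≃-sym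
      (ℚᵘₚ.≃-trans (ℚₚ.toℚᵘ-homo-* (ι m) (ι n))
      (ℚᵘₚ.≃-trans (ℚᵘₚ.*-cong (toℚᵘ-ι m) (toℚᵘ-ι n))
        (*≡* (cong (ℤ._* + 1) (sym (ℤₚ.pos-* m n))))))))

    ι-mono : ∀ {m n} → m ℕ.≤ n → ι m ≤ ι n
    ι-mono {m} {n} m≤n = ℚₚ.toℚᵘ-cancel-≤ (ℚᵘₚ.≤-respˡ-≃ (ℚᵘₚ.≃-sym (toℚᵘ-ι m))
      (ℚᵘₚ.≤-respʳ-≃ (ℚᵘₚ.≃-sym (toℚᵘ-ι n)) (*≤* (ℤₚ.*-monoʳ-≤-nonNeg (+ 1) (ℤ.+≤+ m≤n)))))

    ι-cancel : ∀ {m n} → ι m ≤ ι n → m ℕ.≤ n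
    ι-cancel {m} {n} le with ℚᵘₚ.≤-respˡ-≃ (toℚᵘ-ι m) (ℚᵘₚ.≤-respʳ-≃ (toℚᵘ-ι n) (ℚₚ.toℚᵘ-mono-≤ le))
    ... | *≤* p with ℤₚ.*-cancelʳ-≤-pos (+ m) (+ n) (+ 1) p
    ... | ℤ.+≤+ m≤n = m≤n

    ι*1/ : ∀ n .{{_ : ℕ.NonZero n}} → ι n * (+ 1 / n) ≡ 1ℚ
    ι*1/ n@(suc k) = ℚₚ.toℚᵘ-injective (ℚᵘₚ.≃-trans (ℚₚ.toℚᵘ-homo-* (ι n) (+ 1 / n))
      (ℚᵘₚ.≃-trans (ℚᵘₚ.*-cong (toℚᵘ-ι n) (ℚₚ.toℚᵘ-fromℚᵘ (mkℚᵘ (+ 1) k)))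
        (*≡* (trans (ℤₚ.*-identityʳ _) (trans (ℤₚ.*-identityʳ (+ n))
          (sym (trans (ℤₚ.*-identityˡ _) (cong +_ (ℕₚ.*-identityˡ n)))))))))

    archimedean : ∀ q → ∃[ n ] q ≤ ι n
    archimedean q@record{} = ℤ.∣ ↥ q ∣ , ℚₚ.toℚᵘ-cancel-≤ (ℚᵘₚ.≤-respʳ-≃ (ℚᵘₚ.≃-sym (toℚᵘ-ι ℤ.∣ ↥ q ∣))
      (*≤* (ℤₚ.≤-trans (ℤₚ.≤-reflexive (ℤₚ.*-identityʳ (↥ q))) (helper (↥ q) (ℚ.denominator-1 q)))))
      where
      helper : ∀ i d → i ℤ.≤ + ℤ.∣ i ∣ ℤ.* + suc d
      helper (+ n)        d = ℤₚ.≤-trans (ℤ.+≤+ (ℕₚ.m≤m*n n (suc d))) (ℤₚ.≤-reflexive (ℤₚ.pos-* n (suc d)))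
      helper (ℤ.-[1+ n ]) d = ℤ.-≤+

  ι2* : ∀ q → ι 2 * q ≡ q + q
  ι2* q = trans (cong (_* q) (trans (ι-+ 1 1) (cong₂ _+_ ι-1 ι-1)))
    (trans (ℚₚ.*-distribʳ-+ q 1ℚ 1ℚ) (cong₂ _+_ (ℚₚ.*-identityˡ q) (ℚₚ.*-identityˡ q)))

  0≤ι : ∀ n → 0ℚ ≤ ι n
  0≤ι n = subst (_≤ ι n) ι-0 (ι-mono ℕ.z≤n)

  1≤ι : ∀ n → 1ℚ ≤ ι (suc n)
  1≤ι n = subst (_≤ ι (suc n)) ι-1 (ι-mono (ℕ.s≤s ℕ.z≤n))

  0<ι : ∀ n → 0ℚ < ι (suc n)
  0<ι n = ℚₚ.<-≤-trans (ℚₚ.positive⁻¹ 1ℚ) (1≤ι n)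

  *-monoˡ : ∀ {p q} r → 0ℚ ≤ r → p ≤ q → r * p ≤ r * q
  *-monoˡ r 0≤r = ℚₚ.*-monoˡ-≤-nonNeg r {{nonNegative 0≤r}}

  *-monoʳ : ∀ {p q} r → 0ℚ ≤ r → p ≤ q → p * r ≤ q * r
  *-monoʳ r 0≤r = ℚₚ.*-monoʳ-≤-nonNeg r {{nonNegative 0≤r}}

  *-mono : ∀ {p q r s} → 0ℚ ≤ r → 0ℚ ≤ q → p ≤ q → r ≤ s → p * r ≤ q * s
  *-mono {p} {q} {r} 0≤r 0≤q p≤q r≤s = ℚₚ.≤-trans (*-monoʳ r 0≤r p≤q) (*-monoˡ q 0≤q r≤s)

  0≤* : ∀ {p q} → 0ℚ ≤ p → 0ℚ ≤ q → 0ℚ ≤ p * q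
  0≤* {p} {q} 0≤p 0≤q = ℚₚ.≤-trans (ℚₚ.≤-reflexive (sym (ℚₚ.*-zeroʳ p))) (*-monoˡ p 0≤p 0≤q)

  0<* : ∀ {p q} → 0ℚ < p → 0ℚ < q → 0ℚ < p * q
  0<* {p} {q} 0<p 0<q = ℚₚ.positive⁻¹ (p * q) {{ℚₚ.pos*pos⇒pos p {{positive 0<p}} q {{positive 0<q}}}}

  0≤+ : ∀ {p q} → 0ℚ ≤ p → 0ℚ ≤ q → 0ℚ ≤ p + q
  0≤+ = ℚₚ.+-mono-≤

  *-cancel : ∀ {p q} r → 0ℚ < r → r * p ≤ r * q → p ≤ q
  *-cancel r 0<r = ℚₚ.*-cancelˡ-≤-pos r {{positive 0<r}}

  0<½* : ∀ {ε} → 0ℚ < ε → 0ℚ < ½ * ε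
  0<½* = 0<* (ℚₚ.positive⁻¹ ½)

  ½*+½* : ∀ ε → ½ * ε + ½ * ε ≡ ε
  ½*+½* ε = trans (sym (ℚₚ.*-distribʳ-+ ε ½ ½)) (ℚₚ.*-identityˡ ε)

  p≤p+q : ∀ p {q} → 0ℚ ≤ q → p ≤ p + q
  p≤p+q p 0≤q = ℚₚ.≤-trans (ℚₚ.≤-reflexive (sym (ℚₚ.+-identityʳ p))) (ℚₚ.+-monoʳ-≤ p 0≤q)

  p-q≤r : ∀ {p q r} → p ≤ q + r → p - q ≤ r
  p-q≤r {p} {q} {r} le = ℚₚ.≤-trans (ℚₚ.+-monoˡ-≤ (- q) le) (ℚₚ.≤-reflexive (lem q r))
    where
    open +-*-Solver
    lem : ∀ q r → q + r - q ≡ r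
    lem = solve 2 (λ q r → q :+ r :- q := r) refl

  p≤q+r : ∀ {p q r} → p - q ≤ r → p ≤ q + r
  p≤q+r {p} {q} {r} le = ℚₚ.≤-trans (ℚₚ.≤-reflexive (lem p q)) (ℚₚ.+-monoʳ-≤ q le)
    where
    open +-*-Solver
    lem : ∀ p q → p ≡ q + (p - q)
    lem = solve 2 (λ p q → p := q :+ (p :- q)) refl

  p≤∣p∣ : ∀ p → p ≤ ∣ p ∣
  p≤∣p∣ p with ℚₚ.≤-total 0ℚ p
  ... | inj₁ 0≤p = ℚₚ.≤-reflexive (sym (ℚₚ.0≤p⇒∣p∣≡p 0≤p))
  ... | inj₂ p≤0 = ℚₚ.≤-trans p≤0 (ℚₚ.0≤∣p∣ p)

  ∣-∣≤ : ∀ {p q} → p ≤ q → - p ≤ q → ∣ p ∣ ≤ q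
  ∣-∣≤ {p} p≤q -p≤q with ℚₚ.∣p∣≡p∨∣p∣≡-p p
  ... | inj₁ eq = ℚₚ.≤-trans (ℚₚ.≤-reflexive eq) p≤q
  ... | inj₂ eq = ℚₚ.≤-trans (ℚₚ.≤-reflexive eq) -p≤q

  ∣p-q∣≡∣q-p∣ : ∀ p q → ∣ p - q ∣ ≡ ∣ q - p ∣
  ∣p-q∣≡∣q-p∣ p q = trans (sym (ℚₚ.∣-p∣≡∣p∣ (p - q))) (cong ∣_∣ (lem p q))
    where
    open +-*-Solver
    lem : ∀ p q → - (p - q) ≡ q - p
    lem = solve 2 (λ p q → :- (p :- q) := q :- p) refl

  ∣-∣≤⇒≤ : ∀ {p q ε} → ∣ p - q ∣ ≤ ε → p ≤ q + ε
  ∣-∣≤⇒≤ {p} {q} le = p≤q+r (ℚₚ.≤-trans (p≤∣p∣ (p - q)) le)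

  ≤⇒∣-∣≤ : ∀ {p q ε} → p ≤ q + ε → q ≤ p + ε → ∣ p - q ∣ ≤ ε
  ≤⇒∣-∣≤ {p} {q} le ge = ∣-∣≤ (p-q≤r le) (ℚₚ.≤-trans (ℚₚ.≤-reflexive (lem p q)) (p-q≤r ge))
    where
    open +-*-Solver
    lem : ∀ p q → - (p - q) ≡ q - p
    lem = solve 2 (λ p q → :- (p :- q) := q :- p) refl

  ∣-∣-triangle : ∀ p q r → ∣ p - r ∣ ≤ ∣ p - q ∣ + ∣ q - r ∣
  ∣-∣-triangle p q r = ℚₚ.≤-trans (ℚₚ.≤-reflexive (cong ∣_∣ (lem p q r))) (ℚₚ.∣p+q∣≤∣p∣+∣q∣ (p - q) (q - r))
    where
    open +-*-Solver
    lem : ∀ p q r → p - r ≡ (p - q) + (q - r)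
    lem = solve 3 (λ p q r → p :- r := (p :- q) :+ (q :- r)) refl

  ∣*∣≤ : ∀ {p q P Q} → ∣ p ∣ ≤ P → ∣ q ∣ ≤ Q → ∣ p * q ∣ ≤ P * Q
  ∣*∣≤ {p} {q} {P} hp hq = ℚₚ.≤-trans (ℚₚ.≤-reflexive (ℚₚ.∣p*q∣≡∣p∣*∣q∣ p q))
    (*-mono (ℚₚ.0≤∣p∣ q) (ℚₚ.≤-trans (ℚₚ.0≤∣p∣ p) hp) hp hq)

  ∣+∣≤ : ∀ {p q P Q} → ∣ p ∣ ≤ P → ∣ q ∣ ≤ Q → ∣ p + q ∣ ≤ P + Q
  ∣+∣≤ {p} {q} hp hq = ℚₚ.≤-trans (ℚₚ.∣p+q∣≤∣p∣+∣q∣ p q) (ℚₚ.+-mono-≤ hp hq)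

  abstract
    recip : ℕ → ℚ
    recip n = + 1 / suc n

    recip-0 : recip 0 ≡ 1ℚ
    recip-0 = refl

    ι*recip : ∀ n → ι (suc n) * recip n ≡ 1ℚ
    ι*recip n = ι*1/ (suc n)

    0<recip : ∀ n → 0ℚ < recip n
    0<recip n = ℚₚ.positive⁻¹ (recip n) {{ℚₚ.normalize-pos 1 (suc n)}}

  recip≤1 : ∀ n → recip n ≤ 1ℚ
  recip≤1 n = *-cancel (ι (suc n)) (0<ι n) (begin
    ι (suc n) * recip n  ≡⟨ ι*recip n ⟩
    1ℚ                   ≤⟨ 1≤ι n ⟩
    ι (suc n)            ≡⟨ ℚₚ.*-identityʳ (ι (suc n)) ⟨
    ι (suc n) * 1ℚ       ∎)

  -- The divisor is `c + 1` rather than `c`, to cover `c = 0`.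
  shrink : ℕ → ℚ → ℚ
  shrink c ε = recip c * ε

  0<shrink : ∀ c {ε} → 0ℚ < ε → 0ℚ < shrink c ε
  0<shrink c = 0<* (0<recip c)

  ι*shrink≤ : ∀ c {ε} → 0ℚ < ε → ι c * shrink c ε ≤ ε
  ι*shrink≤ c {ε} 0<ε = begin
    ι c * (recip c * ε)         ≤⟨ *-monoʳ (recip c * ε) (ℚₚ.<⇒≤ (0<shrink c 0<ε)) (ι-mono (ℕₚ.n≤1+n c)) ⟩
    ι (suc c) * (recip c * ε)   ≡⟨ ℚₚ.*-assoc (ι (suc c)) (recip c) ε ⟨
    ι (suc c) * recip c * ε     ≡⟨ cong (_* ε) (ι*recip c) ⟩
    1ℚ * ε                      ≡⟨ ℚₚ.*-identityˡ ε ⟩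
    ε                           ∎

  archimedean′ : ∀ c {ε} → 0ℚ < ε → ∃[ n ] ι c ≤ ι (suc n) * ε
  archimedean′ c {ε} 0<ε = n , (begin
    ι c                  ≡⟨ ℚₚ.*-identityʳ (ι c) ⟨
    ι c * 1ℚ             ≡⟨ cong (ι c *_) (ℚₚ.*-inverseˡ ε) ⟨
    ι c * (1/ ε * ε)     ≡⟨ ℚₚ.*-assoc (ι c) (1/ ε) ε ⟨
    ι c * 1/ ε * ε       ≤⟨ *-monoʳ ε (ℚₚ.<⇒≤ 0<ε) (ℚₚ.≤-trans (proj₂ bound) (ι-mono (ℕₚ.n≤1+n n))) ⟩
    ι (suc n) * ε        ∎)
    where
    instance
      ε≢0 : NonZero ε
      ε≢0 = ℚₚ.pos⇒nonZero ε {{positive 0<ε}}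
    bound = archimedean (ι c * 1/ ε)
    n = proj₁ bound

  open Sieve using (n<2^n)

  -- Partial sums of the exponential series

  pow : ℚ → ℕ → ℚ
  pow q zero    = 1ℚ
  pow q (suc n) = pow q n * q

  abstract
    1/! : ℕ → ℚ
    1/! n = (+ 1 / (n !)) {{n ℕₚ.!≢0}}

    term : ℚ → ℕ → ℚ
    term q n = 1/! n * pow q n

    term≡ : ∀ q n → term q n ≡ (+ 1 / (n !)) {{n ℕₚ.!≢0}} * pow q n
    term≡ q n = refl

    term-zero : ∀ q → term q 0 ≡ 1ℚ
    term-zero q = ℚₚ.*-identityʳ 1ℚ

    1/!-suc : ∀ n → 1/! (suc n) ≡ recip n * 1/! n
    1/!-suc n = begin-equality
      1/! (suc n)                                    ≡⟨ ℚₚ.*-identityˡ _ ⟨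
      1ℚ * 1/! (suc n)                               ≡⟨ cong₂ (λ a b → a * b * 1/! (suc n)) (ι*recip n) (ι*1/ (n !) {{n ℕₚ.!≢0}}) ⟨
      ι (suc n) * recip n * (ι (n !) * 1/! n) * 1/! (suc n)
        ≡⟨ lem (ι (suc n)) (recip n) (ι (n !)) (1/! n) (1/! (suc n)) ⟩
      recip n * 1/! n * (ι (suc n) * ι (n !) * 1/! (suc n))
        ≡⟨ cong (λ t → recip n * 1/! n * (t * 1/! (suc n))) (ι-* (suc n) (n !)) ⟨
      recip n * 1/! n * (ι (suc n !) * 1/! (suc n))  ≡⟨ cong (recip n * 1/! n *_) (ι*1/ (suc n !) {{suc n ℕₚ.!≢0}}) ⟩
      recip n * 1/! n * 1ℚ                           ≡⟨ ℚₚ.*-identityʳ _ ⟩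
      recip n * 1/! n                                ∎
      where
      open +-*-Solver
      lem : ∀ a b c d e → a * b * (c * d) * e ≡ b * d * (a * c * e)
      lem = solve 5 (λ a b c d e → a :* b :* (c :* d) :* e := b :* d :* (a :* c :* e)) refl

    term-suc : ∀ q n → term q (suc n) ≡ recip n * q * term q n
    term-suc q n = trans (cong (_* (pow q n * q)) (1/!-suc n)) (lem (recip n) (1/! n) (pow q n) q)
      where
      open +-*-Solver
      lem : ∀ r f p q → r * f * (p * q) ≡ r * q * (f * p)
      lem = solve 4 (λ r f p q → r :* f :* (p :* q) := r :* q :* (f :* p)) refl

  expTo : ℚ → ℕ → ℚ
  expTo q zero    = 1ℚ
  expTo q (suc n) = expTo q n + term q (suc n)

  ι*term-suc : ∀ q n → ι (suc n) * term q (suc n) ≡ q * term q n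
  ι*term-suc q n = begin-equality
    ι (suc n) * term q (suc n)             ≡⟨ cong (ι (suc n) *_) (term-suc q n) ⟩
    ι (suc n) * (recip n * q * term q n)   ≡⟨ lem (ι (suc n)) (recip n) q (term q n) ⟩
    ι (suc n) * recip n * (q * term q n)   ≡⟨ cong (_* (q * term q n)) (ι*recip n) ⟩
    1ℚ * (q * term q n)                    ≡⟨ ℚₚ.*-identityˡ _ ⟩
    q * term q n                           ∎
    where
    open +-*-Solver
    lem : ∀ i r q t → i * (r * q * t) ≡ i * r * (q * t)
    lem = solve 4 (λ i r q t → i :* (r :* q :* t) := i :* r :* (q :* t)) refl

  0≤term : ∀ {q} → 0ℚ ≤ q → ∀ n → 0ℚ ≤ term q n
  0≤term {q} 0≤q zero    = ℚₚ.≤-trans (ℚₚ.nonNegative⁻¹ 1ℚ) (ℚₚ.≤-reflexive (sym (term-zero q)))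
  0≤term {q} 0≤q (suc n) = ℚₚ.≤-trans
    (0≤* (0≤* (ℚₚ.<⇒≤ (0<recip n)) 0≤q) (0≤term 0≤q n)) (ℚₚ.≤-reflexive (sym (term-suc q n)))

  term-mono : ∀ {p q} → 0ℚ ≤ p → p ≤ q → ∀ n → term p n ≤ term q n
  term-mono {p} {q} 0≤p p≤q zero    = ℚₚ.≤-reflexive (trans (term-zero p) (sym (term-zero q)))
  term-mono {p} {q} 0≤p p≤q (suc n) = begin
    term p (suc n)             ≡⟨ term-suc p n ⟩
    recip n * p * term p n     ≤⟨ *-mono (0≤term 0≤p n) (0≤* 0≤r (ℚₚ.≤-trans 0≤p p≤q))
                                    (*-monoˡ (recip n) 0≤r p≤q) (term-mono 0≤p p≤q n) ⟩
    recip n * q * term q n     ≡⟨ term-suc q n ⟨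
    term q (suc n)             ∎
    where
    0≤r : 0ℚ ≤ recip n
    0≤r = ℚₚ.<⇒≤ (0<recip n)

  ∣term∣ : ∀ q n → (∣ term q n ∣) ≡ term (∣ q ∣) n
  ∣term∣ q zero    = trans (cong ∣_∣ (term-zero q)) (sym (term-zero (∣ q ∣)))
  ∣term∣ q (suc n) = begin-equality
    ∣ term q (suc n) ∣                    ≡⟨ cong ∣_∣ (term-suc q n) ⟩
    ∣ recip n * q * term q n ∣            ≡⟨ ℚₚ.∣p*q∣≡∣p∣*∣q∣ (recip n * q) (term q n) ⟩
    ∣ recip n * q ∣ * (∣ term q n ∣)        ≡⟨ cong₂ _*_ (ℚₚ.∣p*q∣≡∣p∣*∣q∣ (recip n) q) (∣term∣ q n) ⟩
    ∣ recip n ∣ * (∣ q ∣) * term (∣ q ∣) n    ≡⟨ cong (λ r → r * (∣ q ∣) * term (∣ q ∣) n) (ℚₚ.0≤p⇒∣p∣≡p (ℚₚ.<⇒≤ (0<recip n))) ⟩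
    recip n * (∣ q ∣) * term (∣ q ∣) n        ≡⟨ term-suc (∣ q ∣) n ⟨
    term (∣ q ∣) (suc n)                    ∎

  expTo-mono-≤ : ∀ {q} → 0ℚ ≤ q → ∀ m k → expTo q m ≤ expTo q (m ℕ.+ k)
  expTo-mono-≤ {q} 0≤q m zero    = ℚₚ.≤-reflexive (cong (expTo q) (sym (ℕₚ.+-identityʳ m)))
  expTo-mono-≤ {q} 0≤q m (suc k) = begin
    expTo q m                      ≤⟨ expTo-mono-≤ 0≤q m k ⟩
    expTo q (m ℕ.+ k)              ≤⟨ p≤p+q _ (0≤term 0≤q (suc (m ℕ.+ k))) ⟩
    expTo q (suc (m ℕ.+ k))        ≡⟨ cong (expTo q) (ℕₚ.+-suc m k) ⟨
    expTo q (m ℕ.+ suc k)          ∎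

  expTo-monoˡ : ∀ {p q} → 0ℚ ≤ p → p ≤ q → ∀ n → expTo p n ≤ expTo q n
  expTo-monoˡ 0≤p p≤q zero    = ℚₚ.≤-refl
  expTo-monoˡ 0≤p p≤q (suc n) = ℚₚ.+-mono-≤ (expTo-monoˡ 0≤p p≤q n) (term-mono 0≤p p≤q (suc n))

  0≤expTo : ∀ {q} → 0ℚ ≤ q → ∀ n → 0ℚ ≤ expTo q n
  0≤expTo 0≤q n = ℚₚ.≤-trans (ℚₚ.nonNegative⁻¹ 1ℚ) (expTo-mono-≤ 0≤q 0 n)

  -- Majorant principle: `∣ term q i ∣ ≤ term Q i` for each `i`. It reduces signed arguments to
  -- nonnegative ones, whose partial sums increase.
  ∣expTo-expTo∣ : ∀ {q Q} → ∣ q ∣ ≤ Q → ∀ m k →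
    ∣ expTo q (m ℕ.+ k) - expTo q m ∣ ≤ expTo Q (m ℕ.+ k) - expTo Q m
  ∣expTo-expTo∣ {q} {Q} ∣q∣≤Q m zero    = ℚₚ.≤-reflexive (trans
    (cong (λ t → ∣ expTo q t - expTo q m ∣) (ℕₚ.+-identityʳ m))
    (trans (cong ∣_∣ (ℚₚ.+-inverseʳ (expTo q m)))
    (trans (sym (ℚₚ.+-inverseʳ (expTo Q m))) (cong (λ t → expTo Q t - expTo Q m) (sym (ℕₚ.+-identityʳ m))))))
  ∣expTo-expTo∣ {q} {Q} ∣q∣≤Q m (suc k) = begin
    ∣ expTo q (m ℕ.+ suc k) - expTo q m ∣       ≡⟨ cong (λ t → ∣ expTo q t - expTo q m ∣) (ℕₚ.+-suc m k) ⟩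
    ∣ expTo q n + term q (suc n) - expTo q m ∣  ≡⟨ cong ∣_∣ (lem (expTo q n) (term q (suc n)) (expTo q m)) ⟩
    ∣ (expTo q n - expTo q m) + term q (suc n) ∣
      ≤⟨ ∣+∣≤ {expTo q n - expTo q m} (∣expTo-expTo∣ ∣q∣≤Q m k) (ℚₚ.≤-trans (ℚₚ.≤-reflexive (∣term∣ q (suc n)))
                                      (term-mono (ℚₚ.0≤∣p∣ q) ∣q∣≤Q (suc n))) ⟩
    expTo Q n - expTo Q m + term Q (suc n)      ≡⟨ lem (expTo Q n) (term Q (suc n)) (expTo Q m) ⟨
    expTo Q (suc n) - expTo Q m                 ≡⟨ cong (λ t → expTo Q t - expTo Q m) (ℕₚ.+-suc m k) ⟨
    expTo Q (m ℕ.+ suc k) - expTo Q m           ∎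
    where
    n = m ℕ.+ k
    open +-*-Solver
    lem : ∀ a b c → a + b - c ≡ (a - c) + b
    lem = solve 3 (λ a b c → a :+ b :- c := (a :- c) :+ b) refl

  -- From index 2 * B on, the terms at B at least halve from each to the next.

  module _ (B : ℕ) where

    private
      b = ι B
      K = 2 ℕ.* B
      0≤b = 0≤ι B

    2*term-suc≤ : ∀ j → ι 2 * term b (suc (K ℕ.+ j)) ≤ term b (K ℕ.+ j)
    2*term-suc≤ j = *-cancel (ι (suc n)) (0<ι n) (begin
      ι (suc n) * (ι 2 * term b (suc n))    ≡⟨ lem (ι (suc n)) (ι 2) (term b (suc n)) ⟩
      ι 2 * (ι (suc n) * term b (suc n))    ≡⟨ cong (ι 2 *_) (ι*term-suc b n) ⟩
      ι 2 * (b * term b n)                  ≡⟨ ℚₚ.*-assoc (ι 2) b (term b n) ⟨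
      ι 2 * b * term b n                    ≡⟨ cong (_* term b n) (ι-* 2 B) ⟨
      ι K * term b n                        ≤⟨ *-monoʳ _ (0≤term 0≤b n) (ι-mono (ℕₚ.≤-trans (ℕₚ.m≤m+n K j) (ℕₚ.n≤1+n n))) ⟩
      ι (suc n) * term b n                  ∎)
      where
      n = K ℕ.+ j
      open +-*-Solver
      lem : ∀ i t x → i * (t * x) ≡ t * (i * x)
      lem = solve 3 (λ i t x → i :* (t :* x) := t :* (i :* x)) refl

    2^*term≤ : ∀ j → ι (2 ℕ.^ j) * term b (K ℕ.+ j) ≤ term b K
    2^*term≤ zero    = ℚₚ.≤-reflexive (trans (cong (_* term b (K ℕ.+ 0)) ι-1)
      (trans (ℚₚ.*-identityˡ _) (cong (term b) (ℕₚ.+-identityʳ K))))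
    2^*term≤ (suc j) = begin
      ι (2 ℕ.* 2 ℕ.^ j) * term b (K ℕ.+ suc j)    ≡⟨ cong₂ (λ p n → p * term b n) (trans (ι-* 2 (2 ℕ.^ j)) (ℚₚ.*-comm (ι 2) (ι (2 ℕ.^ j)))) (ℕₚ.+-suc K j) ⟩
      ι (2 ℕ.^ j) * ι 2 * term b (suc (K ℕ.+ j))  ≡⟨ ℚₚ.*-assoc (ι (2 ℕ.^ j)) (ι 2) _ ⟩
      ι (2 ℕ.^ j) * (ι 2 * term b (suc (K ℕ.+ j))) ≤⟨ *-monoˡ (ι (2 ℕ.^ j)) (0≤ι (2 ℕ.^ j)) (2*term-suc≤ j) ⟩
      ι (2 ℕ.^ j) * term b (K ℕ.+ j)              ≤⟨ 2^*term≤ j ⟩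
      term b K                                    ∎

    -- Each term is at most half of the one before, so adding the last term once more to a partial
    -- sum overestimates everything still to come. This gives decreasing upper bounds for the
    -- series.
    expTo+term-antitone : ∀ j k →
      expTo b (K ℕ.+ j ℕ.+ k) + term b (K ℕ.+ j ℕ.+ k) ≤ expTo b (K ℕ.+ j) + term b (K ℕ.+ j)
    expTo+term-antitone j zero    = ℚₚ.≤-reflexive (cong (λ n → expTo b n + term b n) (ℕₚ.+-identityʳ (K ℕ.+ j)))
    expTo+term-antitone j (suc k) = begin
      expTo b (n ℕ.+ suc k) + term b (n ℕ.+ suc k)     ≡⟨ cong (λ n → expTo b n + term b n) (ℕₚ.+-suc n k) ⟩
      expTo b m + term b (suc m) + term b (suc m)      ≡⟨ lem (expTo b m) (term b (suc m)) ⟩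
      expTo b m + ι 2 * term b (suc m)
        ≤⟨ ℚₚ.+-monoʳ-≤ (expTo b m) (subst (λ i → ι 2 * term b (suc i) ≤ term b i) (sym (ℕₚ.+-assoc K j k)) (2*term-suc≤ (j ℕ.+ k))) ⟩
      expTo b m + term b m                             ≤⟨ expTo+term-antitone j k ⟩
      expTo b n + term b n                             ∎
      where
      n = K ℕ.+ j
      m = n ℕ.+ k
      lem : ∀ e t → e + t + t ≡ e + ι 2 * t
      lem e t = trans (ℚₚ.+-assoc e t t) (cong (λ s → e + s) (sym (ι2* t)))

    expTo-bounded : ∃[ C ] ∀ q n → 0ℚ ≤ q → q ≤ b → expTo q n ≤ ι C
    expTo-bounded with archimedean (expTo b (K ℕ.+ 0) + term b (K ℕ.+ 0))
    ... | C , le = C , λ q n 0≤q q≤b → begin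
      expTo q n                                          ≤⟨ expTo-monoˡ 0≤q q≤b n ⟩
      expTo b n                                          ≤⟨ expTo-mono-≤ 0≤b n (K ℕ.+ 0) ⟩
      expTo b (n ℕ.+ (K ℕ.+ 0))                          ≡⟨ cong (expTo b) (ℕₚ.+-comm n (K ℕ.+ 0)) ⟩
      expTo b (K ℕ.+ 0 ℕ.+ n)                            ≤⟨ p≤p+q _ (0≤term 0≤b (K ℕ.+ 0 ℕ.+ n)) ⟩
      expTo b (K ℕ.+ 0 ℕ.+ n) + term b (K ℕ.+ 0 ℕ.+ n)   ≤⟨ expTo+term-antitone 0 n ⟩
      expTo b (K ℕ.+ 0) + term b (K ℕ.+ 0)               ≤⟨ le ⟩
      ι C                                                ∎

    term-small : ∀ {ε} → 0ℚ < ε → ∃[ j ] term b (K ℕ.+ j) ≤ ε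
    term-small {ε} 0<ε = suc j , *-cancel (ι (suc j)) (0<ι j) (begin
      ι (suc j) * term b (K ℕ.+ suc j)           ≤⟨ *-monoʳ _ (0≤term 0≤b (K ℕ.+ suc j)) (ι-mono (ℕₚ.<⇒≤ (n<2^n (suc j)))) ⟩
      ι (2 ℕ.^ suc j) * term b (K ℕ.+ suc j)     ≤⟨ 2^*term≤ (suc j) ⟩
      term b K                                   ≤⟨ proj₂ C ⟩
      ι (proj₁ C)                                ≤⟨ proj₂ (archimedean′ (proj₁ C) 0<ε) ⟩
      ι (suc j) * ε                              ∎)
      where
      C = archimedean (term b K)
      j = proj₁ (archimedean′ (proj₁ C) 0<ε)

    expTo-tail-at : ∀ {ε} j → term b (K ℕ.+ j) ≤ ε → ∀ n k →
      expTo b (K ℕ.+ j ℕ.+ k ℕ.+ n) ≤ expTo b (K ℕ.+ j ℕ.+ k) + ε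
    expTo-tail-at {ε} j small n k = begin
      expTo b (N ℕ.+ k ℕ.+ n)                                ≡⟨ cong (expTo b) (ℕₚ.+-assoc N k n) ⟩
      expTo b (N ℕ.+ (k ℕ.+ n))                              ≤⟨ p≤p+q _ (0≤term 0≤b (N ℕ.+ (k ℕ.+ n))) ⟩
      expTo b (N ℕ.+ (k ℕ.+ n)) + term b (N ℕ.+ (k ℕ.+ n))   ≤⟨ expTo+term-antitone j (k ℕ.+ n) ⟩
      expTo b N + term b N                                   ≤⟨ ℚₚ.+-mono-≤ (expTo-mono-≤ 0≤b N k) small ⟩
      expTo b (N ℕ.+ k) + ε                                  ∎
      where N = K ℕ.+ j

    expTo-tail : ∀ {ε} → 0ℚ < ε → ∃[ N ] ∀ q m n → 0ℚ ≤ q → q ≤ b → N ℕ.≤ m →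
      expTo q (m ℕ.+ n) - expTo q m ≤ ε
    expTo-tail {ε} 0<ε = K ℕ.+ j , λ q m n 0≤q q≤b N≤m → begin
      expTo q (m ℕ.+ n) - expTo q m              ≤⟨ p≤∣p∣ _ ⟩
      ∣ expTo q (m ℕ.+ n) - expTo q m ∣          ≤⟨ ∣expTo-expTo∣ (ℚₚ.≤-trans (ℚₚ.≤-reflexive (ℚₚ.0≤p⇒∣p∣≡p 0≤q)) q≤b) m n ⟩
      expTo b (m ℕ.+ n) - expTo b m              ≤⟨ p-q≤r (subst (λ i → expTo b (i ℕ.+ n) ≤ expTo b i + ε)
        (ℕₚ.m+[n∸m]≡n N≤m) (expTo-tail-at j (proj₂ (term-small 0<ε)) n (m ℕ.∸ (K ℕ.+ j)))) ⟩
      ε                                          ∎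
      where
      j = proj₁ (term-small 0<ε)

  -- The majorant at `B` yields one `N` for all `q` in `[- B, B]`.
  expTo-tail-∣∣ : ∀ B {ε} → 0ℚ < ε → ∃[ N ] ∀ q m n → ∣ q ∣ ≤ ι B → N ℕ.≤ m → N ℕ.≤ n →
    ∣ expTo q m - expTo q n ∣ ≤ ε
  expTo-tail-∣∣ B {ε} 0<ε = N , λ q m n q≤ N≤m N≤n → both q q≤ m n N≤m N≤n
    where
    N = proj₁ (expTo-tail B 0<ε)
    forward : ∀ q → ∣ q ∣ ≤ ι B → ∀ m k → N ℕ.≤ m → ∣ expTo q (m ℕ.+ k) - expTo q m ∣ ≤ ε
    forward q q≤ m k N≤m = ℚₚ.≤-trans (∣expTo-expTo∣ {q} ℚₚ.≤-refl m k)
      (proj₂ (expTo-tail B 0<ε) (∣ q ∣) m k (ℚₚ.0≤∣p∣ q) q≤ N≤m)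
    both : ∀ q → ∣ q ∣ ≤ ι B → ∀ m n → N ℕ.≤ m → N ℕ.≤ n → ∣ expTo q m - expTo q n ∣ ≤ ε
    both q q≤ m n N≤m N≤n with ℕₚ.≤-total n m
    ... | inj₁ n≤m = subst (λ i → ∣ expTo q i - expTo q n ∣ ≤ ε) (ℕₚ.m+[n∸m]≡n n≤m) (forward q q≤ n (m ℕ.∸ n) N≤n)
    ... | inj₂ m≤n = ℚₚ.≤-trans (ℚₚ.≤-reflexive (∣p-q∣≡∣q-p∣ (expTo q m) (expTo q n)))
      (subst (λ i → ∣ expTo q i - expTo q m ∣ ≤ ε) (ℕₚ.m+[n∸m]≡n m≤n) (forward q q≤ m (n ℕ.∸ m) N≤m))

  ∣expTo∣≤ : ∀ {q Q} → ∣ q ∣ ≤ Q → ∀ n → ∣ expTo q n ∣ ≤ expTo Q n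
  ∣expTo∣≤ ∣q∣≤Q zero    = ℚₚ.≤-refl
  ∣expTo∣≤ {q} ∣q∣≤Q (suc n) = ∣+∣≤ {expTo q n} (∣expTo∣≤ ∣q∣≤Q n)
    (ℚₚ.≤-trans (ℚₚ.≤-reflexive (∣term∣ q (suc n))) (term-mono (ℚₚ.0≤∣p∣ q) ∣q∣≤Q (suc n)))

  -- Termwise, `term q (i + 1) = q / (i + 1) * term q i ≤ q * term q i`.
  expTo-1≤ : ∀ {q} → 0ℚ ≤ q → ∀ n → expTo q (suc n) - 1ℚ ≤ q * expTo q n
  expTo-1≤ {q} 0≤q zero    = ℚₚ.≤-reflexive (trans (lem 1ℚ (term q 1)) (trans (trans (term-suc q 0)
    (cong₂ _*_ (trans (cong (_* q) recip-0) (ℚₚ.*-identityˡ q)) (term-zero q))) refl))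
    where
    open +-*-Solver
    lem : ∀ a t → a + t - a ≡ t
    lem = solve 2 (λ a t → a :+ t :- a := t) refl
  expTo-1≤ {q} 0≤q (suc n) = begin
    expTo q (suc n) + term q (suc (suc n)) - 1ℚ     ≡⟨ lem (expTo q (suc n)) (term q (suc (suc n))) 1ℚ ⟩
    (expTo q (suc n) - 1ℚ) + term q (suc (suc n))   ≤⟨ ℚₚ.+-mono-≤ (expTo-1≤ 0≤q n) (ℚₚ.≤-reflexive (term-suc q (suc n))) ⟩
    q * expTo q n + recip (suc n) * q * term q (suc n)
      ≤⟨ ℚₚ.+-monoʳ-≤ (q * expTo q n) (*-monoʳ _ (0≤term 0≤q (suc n))
           (ℚₚ.≤-trans (*-monoʳ q 0≤q (recip≤1 (suc n))) (ℚₚ.≤-reflexive (ℚₚ.*-identityˡ q)))) ⟩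
    q * expTo q n + q * term q (suc n)              ≡⟨ ℚₚ.*-distribˡ-+ q (expTo q n) (term q (suc n)) ⟨
    q * expTo q (suc n)                             ∎
    where
    open +-*-Solver
    lem : ∀ a b c → a + b - c ≡ (a - c) + b
    lem = solve 3 (λ a b c → a :+ b :- c := (a :- c) :+ b) refl

  ∣expTo-1∣≤ : ∀ {h H} → ∣ h ∣ ≤ H → ∀ n → ∣ expTo h n - 1ℚ ∣ ≤ H * expTo H n
  ∣expTo-1∣≤ {h} {H} ∣h∣≤H zero    = ℚₚ.≤-trans (ℚₚ.≤-reflexive (cong ∣_∣ (ℚₚ.+-inverseʳ 1ℚ)))
    (0≤* (ℚₚ.≤-trans (ℚₚ.0≤∣p∣ h) ∣h∣≤H) (ℚₚ.nonNegative⁻¹ 1ℚ))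
  ∣expTo-1∣≤ {h} {H} ∣h∣≤H (suc n) = begin
    ∣ expTo h (suc n) - 1ℚ ∣   ≤⟨ ∣expTo-expTo∣ ∣h∣≤H 0 (suc n) ⟩
    expTo H (suc n) - 1ℚ       ≤⟨ expTo-1≤ 0≤H n ⟩
    H * expTo H n              ≤⟨ *-monoˡ H 0≤H (ℚₚ.≤-trans (expTo-mono-≤ 0≤H n 1) (ℚₚ.≤-reflexive (cong (expTo H) (ℕₚ.+-comm n 1)))) ⟩
    H * expTo H (suc n)        ∎
    where
    0≤H : 0ℚ ≤ H
    0≤H = ℚₚ.≤-trans (ℚₚ.0≤∣p∣ h) ∣h∣≤H

  -- Cauchy products

  conv : (ℕ → ℚ) → (ℕ → ℚ) → ℕ → ℚ
  conv f g zero    = f 0 * g 0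
  conv f g (suc n) = f 0 * g (suc n) + conv (f ∘ suc) g n

  -- The coefficients of the derivative of the formal power series with coefficients `f`.
  deriv : (ℕ → ℚ) → ℕ → ℚ
  deriv f n = ι (suc n) * f (suc n)

  ι-1* : ∀ q → ι 1 * q ≡ q
  ι-1* q = trans (cong (_* q) ι-1) (ℚₚ.*-identityˡ q)

  ι-suc* : ∀ n q → ι (suc n) * q ≡ q + ι n * q
  ι-suc* n q = trans (cong (_* q) (ι-+ 1 n)) (trans (ℚₚ.*-distribʳ-+ q (ι 1) (ι n)) (cong (λ t → t + ι n * q) (ι-1* q)))

  conv-cong : ∀ {f f′ g g′} → (∀ n → f n ≡ f′ n) → (∀ n → g n ≡ g′ n) → ∀ n → conv f g n ≡ conv f′ g′ n
  conv-cong f≡ g≡ zero    = cong₂ _*_ (f≡ 0) (g≡ 0)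
  conv-cong f≡ g≡ (suc n) = cong₂ _+_ (cong₂ _*_ (f≡ 0) (g≡ (suc n))) (conv-cong (f≡ ∘ suc) g≡ n)

  conv-+ˡ : ∀ f f′ g n → conv (λ i → f i + f′ i) g n ≡ conv f g n + conv f′ g n
  conv-+ˡ f f′ g zero    = ℚₚ.*-distribʳ-+ (g 0) (f 0) (f′ 0)
  conv-+ˡ f f′ g (suc n) = trans (cong (λ t → (f 0 + f′ 0) * g (suc n) + t) (conv-+ˡ (f ∘ suc) (f′ ∘ suc) g n))
    (lem (f 0) (f′ 0) (g (suc n)) (conv (f ∘ suc) g n) (conv (f′ ∘ suc) g n))
    where
    open +-*-Solver
    lem : ∀ a b c x y → (a + b) * c + (x + y) ≡ (a * c + x) + (b * c + y)
    lem = solve 5 (λ a b c x y → (a :+ b) :* c :+ (x :+ y) := (a :* c :+ x) :+ (b :* c :+ y)) refl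

  conv-*ˡ : ∀ c f g n → conv (λ i → c * f i) g n ≡ c * conv f g n
  conv-*ˡ c f g zero    = ℚₚ.*-assoc c (f 0) (g 0)
  conv-*ˡ c f g (suc n) = trans (cong (λ t → c * f 0 * g (suc n) + t) (conv-*ˡ c (f ∘ suc) g n))
    (lem c (f 0) (g (suc n)) (conv (f ∘ suc) g n))
    where
    open +-*-Solver
    lem : ∀ c a b x → c * a * b + c * x ≡ c * (a * b + x)
    lem = solve 4 (λ c a b x → c :* a :* b :+ c :* x := c :* (a :* b :+ x)) refl

  conv-*ʳ : ∀ c f g n → conv f (λ i → c * g i) n ≡ c * conv f g n
  conv-*ʳ c f g zero    = lem c (f 0) (g 0)
    where
    open +-*-Solver
    lem : ∀ c a b → a * (c * b) ≡ c * (a * b)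
    lem = solve 3 (λ c a b → a :* (c :* b) := c :* (a :* b)) refl
  conv-*ʳ c f g (suc n) = trans (cong (λ t → f 0 * (c * g (suc n)) + t) (conv-*ʳ c (f ∘ suc) g n))
    (lem c (f 0) (g (suc n)) (conv (f ∘ suc) g n))
    where
    open +-*-Solver
    lem : ∀ c a b x → a * (c * b) + c * x ≡ c * (a * b + x)
    lem = solve 4 (λ c a b x → a :* (c :* b) :+ c :* x := c :* (a :* b :+ x)) refl

  -- The product rule for formal power series, in degree `n`. It replaces the binomial theorem in
  -- the proof of `conv-term`.
  leibniz : ∀ f g n → ι (suc n) * conv f g (suc n) ≡ conv (deriv f) g n + conv f (deriv g) n
  leibniz f g zero    = lem (f 0) (f 1) (g 0) (g 1)
    where
    lem : ∀ a b c d → ι 1 * (a * d + b * c) ≡ ι 1 * b * c + a * (ι 1 * d)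
    lem a b c d = trans (ι-1* _) (trans (ℚₚ.+-comm (a * d) (b * c))
      (sym (cong₂ (λ x y → x * c + a * y) (ι-1* b) (ι-1* d))))
  leibniz f g (suc n) = begin-equality
    ι (suc (suc n)) * (f 0 * g (suc (suc n)) + c)         ≡⟨ ℚₚ.*-distribˡ-+ (ι (suc (suc n))) _ c ⟩
    ι (suc (suc n)) * (f 0 * g (suc (suc n))) + ι (suc (suc n)) * c
      ≡⟨ cong (λ t → ι (suc (suc n)) * (f 0 * g (suc (suc n))) + t) (trans (ι-suc* (suc n) c) (cong (λ t → c + t) (leibniz (f ∘ suc) g n))) ⟩
    ι (suc (suc n)) * (f 0 * g (suc (suc n))) + (f 1 * g (suc n) + conv (f ∘ suc ∘ suc) g n + (conv (deriv (f ∘ suc)) g n + conv (f ∘ suc) (deriv g) n))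
      ≡⟨ lem (ι (suc (suc n))) (f 0) (g (suc (suc n))) (f 1 * g (suc n)) (conv (f ∘ suc ∘ suc) g n) (conv (deriv (f ∘ suc)) g n) (conv (f ∘ suc) (deriv g) n) ⟩
    (f 1 * g (suc n) + (conv (f ∘ suc ∘ suc) g n + conv (deriv (f ∘ suc)) g n)) + (f 0 * deriv g (suc n) + conv (f ∘ suc) (deriv g) n)
      ≡⟨ cong₂ (λ a b → (a * g (suc n) + b) + (f 0 * deriv g (suc n) + conv (f ∘ suc) (deriv g) n)) (sym (ι-1* (f 1)))
           (trans (sym (conv-+ˡ (f ∘ suc ∘ suc) (deriv (f ∘ suc)) g n))
                  (conv-cong {g = g} (λ i → sym (ι-suc* (suc i) (f (suc (suc i))))) (λ _ → refl) n)) ⟩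
    conv (deriv f) g (suc n) + conv f (deriv g) (suc n)   ∎
    where
    c = conv (f ∘ suc) g (suc n)
    open +-*-Solver
    lem : ∀ i a b x y z w → i * (a * b) + (x + y + (z + w)) ≡ (x + (y + z)) + (a * (i * b) + w)
    lem = solve 7 (λ i a b x y z w → i :* (a :* b) :+ (x :+ y :+ (z :+ w)) := (x :+ (y :+ z)) :+ (a :* (i :* b) :+ w)) refl

  -- Both sides satisfy (n + 1) a (n + 1) = (x + y) a n.
  conv-term : ∀ x y n → conv (term x) (term y) n ≡ term (x + y) n
  conv-term x y zero    = trans (cong₂ _*_ (term-zero x) (term-zero y)) (trans (ℚₚ.*-identityˡ 1ℚ) (sym (term-zero (x + y))))
  conv-term x y (suc n) = ℚₚ.≤-antisym (half (ℚₚ.≤-reflexive eq)) (half (ℚₚ.≤-reflexive (sym eq)))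
    where
    half : ∀ {p q} → ι (suc n) * p ≤ ι (suc n) * q → p ≤ q
    half = *-cancel (ι (suc n)) (0<ι n)
    eq : ι (suc n) * conv (term x) (term y) (suc n) ≡ ι (suc n) * term (x + y) (suc n)
    eq = begin-equality
      ι (suc n) * conv (term x) (term y) (suc n)       ≡⟨ leibniz (term x) (term y) n ⟩
      conv (deriv (term x)) (term y) n + conv (term x) (deriv (term y)) n
        ≡⟨ cong₂ _+_ (trans (conv-cong {g = term y} (ι*term-suc x) (λ _ → refl) n) (conv-*ˡ x (term x) (term y) n))
                     (trans (conv-cong {f = term x} (λ _ → refl) (ι*term-suc y) n) (conv-*ʳ y (term x) (term y) n)) ⟩
      x * conv (term x) (term y) n + y * conv (term x) (term y) n
        ≡⟨ ℚₚ.*-distribʳ-+ (conv (term x) (term y) n) x y ⟨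
      (x + y) * conv (term x) (term y) n               ≡⟨ cong ((x + y) *_) (conv-term x y n) ⟩
      (x + y) * term (x + y) n                         ≡⟨ ι*term-suc (x + y) n ⟨
      ι (suc n) * term (x + y) (suc n)                 ∎

  conv-expTo-suc : ∀ f y n → conv f (expTo y) (suc n) ≡ conv f (expTo y) n + conv f (term y) (suc n)
  conv-expTo-suc f y zero    = trans (cong (λ t → f 0 * (1ℚ + term y 1) + f 1 * t) (sym (term-zero y)))
    (lem (f 0) (f 1) 1ℚ (term y 1) (term y 0))
    where
    open +-*-Solver
    lem : ∀ a b u s t → a * (u + s) + b * t ≡ a * u + (a * s + b * t)
    lem = solve 5 (λ a b u s t → a :* (u :+ s) :+ b :* t := a :* u :+ (a :* s :+ b :* t)) refl
  conv-expTo-suc f y (suc n) = trans (cong (λ t → f 0 * expTo y (suc (suc n)) + t) (conv-expTo-suc (f ∘ suc) y n))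
    (lem (f 0) (expTo y (suc n)) (term y (suc (suc n))) (conv (f ∘ suc) (expTo y) n) (conv (f ∘ suc) (term y) (suc n)))
    where
    open +-*-Solver
    lem : ∀ a e t u v → a * (e + t) + (u + v) ≡ (a * e + u) + (a * t + v)
    lem = solve 5 (λ a e t u v → a :* (e :+ t) :+ (u :+ v) := (a :* e :+ u) :+ (a :* t :+ v)) refl

  -- `conv-term` summed over the degrees up to `n`: the products `term x i * term y j` over the
  -- triangle `i + j ≤ n`, with the sum over `j` carried out.
  expTo-+ : ∀ x y n → expTo (x + y) n ≡ conv (term x) (expTo y) n
  expTo-+ x y zero    = sym (trans (cong (_* 1ℚ) (term-zero x)) (ℚₚ.*-identityˡ 1ℚ))
  expTo-+ x y (suc n) = trans (cong₂ _+_ (expTo-+ x y n) (sym (conv-term x y (suc n)))) (sym (conv-expTo-suc (term x) y n))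

  sumTo : (ℕ → ℚ) → ℕ → ℚ
  sumTo f zero    = f 0
  sumTo f (suc n) = f 0 + sumTo (f ∘ suc) n

  sumTo-suc : ∀ f n → sumTo f (suc n) ≡ sumTo f n + f (suc n)
  sumTo-suc f zero    = refl
  sumTo-suc f (suc n) = trans (cong (λ t → f 0 + t) (sumTo-suc (f ∘ suc) n)) (sym (ℚₚ.+-assoc (f 0) _ _))

  expTo-sumTo : ∀ x n → expTo x n ≡ sumTo (term x) n
  expTo-sumTo x zero    = sym (term-zero x)
  expTo-sumTo x (suc n) = trans (cong (_+ term x (suc n)) (expTo-sumTo x n)) (sym (sumTo-suc (term x) n))

  -- deviation f g c n is c times the sum of f i over i ≤ n, minus conv f g n.
  deviation : (ℕ → ℚ) → (ℕ → ℚ) → ℚ → ℕ → ℚ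
  deviation f g c zero    = f 0 * (c - g 0)
  deviation f g c (suc n) = f 0 * (c - g (suc n)) + deviation (f ∘ suc) g c n

  *-distribˡ-minus : ∀ a b c → a * (b - c) ≡ a * b - a * c
  *-distribˡ-minus = solve 3 (λ a b c → a :* (b :- c) := a :* b :- a :* c) refl
    where open +-*-Solver

  deviation≡ : ∀ f g c n → deviation f g c n ≡ sumTo f n * c - conv f g n
  deviation≡ f g c zero    = *-distribˡ-minus (f 0) c (g 0)
  deviation≡ f g c (suc n) = trans (cong (λ t → f 0 * (c - g (suc n)) + t) (deviation≡ (f ∘ suc) g c n))
    (lem (f 0) c (g (suc n)) (sumTo (f ∘ suc) n) (conv (f ∘ suc) g n))
    where
    open +-*-Solver
    lem : ∀ a c g s v → a * (c - g) + (s * c - v) ≡ (a + s) * c - (a * g + v)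
    lem = solve 5 (λ a c g s v → a :* (c :- g) :+ (s :* c :- v) := (a :+ s) :* c :- (a :* g :+ v)) refl

  ∣deviation∣≤ : ∀ f F g G c C n → (∀ i → ∣ f i ∣ ≤ F i) → (∀ i → i ℕ.≤ n → ∣ c - g i ∣ ≤ C - G i) →
    ∣ deviation f g c n ∣ ≤ deviation F G C n
  ∣deviation∣≤ f F g G c C zero    f≤ g≤ = ∣*∣≤ {f 0} (f≤ 0) (g≤ 0 ℕ.z≤n)
  ∣deviation∣≤ f F g G c C (suc n) f≤ g≤ = ∣+∣≤ {f 0 * (c - g (suc n))} (∣*∣≤ {f 0} (f≤ 0) (g≤ (suc n) ℕₚ.≤-refl))
    (∣deviation∣≤ (f ∘ suc) (F ∘ suc) g G c C n (f≤ ∘ suc) (λ i i≤n → g≤ i (ℕₚ.m≤n⇒m≤1+n i≤n)))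

  -- When `g` consists of partial sums, this says that a rectangle lies in a triangle: for `i ≤ k`
  -- the factor of `f i` on the right is `g (k + m - i) ≥ g m`.
  sumTo*≤conv : ∀ f g → (∀ i → 0ℚ ≤ f i) → (∀ i → 0ℚ ≤ g i) → (∀ m k → g m ≤ g (m ℕ.+ k)) →
    ∀ k m → sumTo f k * g m ≤ conv f g (k ℕ.+ m)
  sumTo*≤conv f g 0≤f 0≤g mono zero    zero    = ℚₚ.≤-refl
  sumTo*≤conv f g 0≤f 0≤g mono zero    (suc m) = p≤p+q _ (0≤conv (f ∘ suc) (0≤f ∘ suc) m)
    where
    0≤conv : ∀ f → (∀ i → 0ℚ ≤ f i) → ∀ m → 0ℚ ≤ conv f g m
    0≤conv f 0≤f zero    = 0≤* (0≤f 0) (0≤g 0)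
    0≤conv f 0≤f (suc m) = 0≤+ (0≤* (0≤f 0) (0≤g (suc m))) (0≤conv (f ∘ suc) (0≤f ∘ suc) m)
  sumTo*≤conv f g 0≤f 0≤g mono (suc k) m = begin
    (f 0 + sumTo (f ∘ suc) k) * g m           ≡⟨ ℚₚ.*-distribʳ-+ (g m) (f 0) _ ⟩
    f 0 * g m + sumTo (f ∘ suc) k * g m
      ≤⟨ ℚₚ.+-mono-≤ (*-monoˡ (f 0) (0≤f 0) (subst (λ i → g m ≤ g i) (ℕₚ.+-comm m (suc k)) (mono m (suc k))))
                     (sumTo*≤conv (f ∘ suc) g (0≤f ∘ suc) 0≤g mono k m) ⟩
    f 0 * g (suc k ℕ.+ m) + conv (f ∘ suc) g (k ℕ.+ m)   ∎

  -- The difference is the sum of `term x i * term y j` over the square `i, j ≤ n` minus that over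
  -- the triangle `i + j ≤ n`. It is dominated by the same difference at `X` and `Y`, where the
  -- square fits into the triangle of side `n + n`, so that a piece of the series at `X + Y`
  -- remains.
  ∣expTo-homo∣ : ∀ x y X Y n → ∣ x ∣ ≤ X → ∣ y ∣ ≤ Y →
    ∣ expTo x n * expTo y n - expTo (x + y) n ∣ ≤ expTo (X + Y) (n ℕ.+ n) - expTo (X + Y) n
  ∣expTo-homo∣ x y X Y n x≤ y≤ = begin
    ∣ expTo x n * expTo y n - expTo (x + y) n ∣        ≡⟨ cong ∣_∣ (as-deviation x y) ⟩
    ∣ deviation (term x) (expTo y) (expTo y n) n ∣
      ≤⟨ ∣deviation∣≤ (term x) (term X) (expTo y) (expTo Y) (expTo y n) (expTo Y n) n
           (λ i → ℚₚ.≤-trans (ℚₚ.≤-reflexive (∣term∣ x i)) (term-mono (ℚₚ.0≤∣p∣ x) x≤ i))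
           (λ i i≤n → subst (λ m → ∣ expTo y m - expTo y i ∣ ≤ expTo Y m - expTo Y i) (ℕₚ.m+[n∸m]≡n i≤n)
                        (∣expTo-expTo∣ y≤ i (n ℕ.∸ i))) ⟩
    deviation (term X) (expTo Y) (expTo Y n) n         ≡⟨ as-deviation X Y ⟨
    expTo X n * expTo Y n - expTo (X + Y) n
      ≡⟨ cong (λ t → t * expTo Y n - expTo (X + Y) n) (expTo-sumTo X n) ⟩
    sumTo (term X) n * expTo Y n - expTo (X + Y) n
      ≤⟨ ℚₚ.+-monoˡ-≤ (- expTo (X + Y) n)
           (sumTo*≤conv (term X) (expTo Y) (0≤term 0≤X) (0≤expTo 0≤Y) (expTo-mono-≤ 0≤Y) n n) ⟩
    conv (term X) (expTo Y) (n ℕ.+ n) - expTo (X + Y) n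
      ≡⟨ cong (_- expTo (X + Y) n) (expTo-+ X Y (n ℕ.+ n)) ⟨
    expTo (X + Y) (n ℕ.+ n) - expTo (X + Y) n          ∎
    where
    0≤X = ℚₚ.≤-trans (ℚₚ.0≤∣p∣ x) x≤
    0≤Y = ℚₚ.≤-trans (ℚₚ.0≤∣p∣ y) y≤
    as-deviation : ∀ x y → expTo x n * expTo y n - expTo (x + y) n ≡ deviation (term x) (expTo y) (expTo y n) n
    as-deviation x y = trans (cong₂ (λ a b → a * expTo y n - b) (expTo-sumTo x n) (expTo-+ x y n))
      (sym (deviation≡ (term x) (expTo y) (expTo y n) n))

  expTo-homo : ∀ B {ε} → 0ℚ < ε → ∃[ N ] ∀ x y n → ∣ x ∣ ≤ ι B → ∣ y ∣ ≤ ι B → N ℕ.≤ n →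
    ∣ expTo x n * expTo y n - expTo (x + y) n ∣ ≤ ε
  expTo-homo B 0<ε = let N , tail = expTo-tail (B ℕ.+ B) 0<ε in N , λ x y n x≤ y≤ N≤n → ℚₚ.≤-trans (∣expTo-homo∣ x y (ι B) (ι B) n x≤ y≤)
    (tail (ι B + ι B) n n (0≤+ (0≤ι B) (0≤ι B)) (ℚₚ.≤-reflexive (sym (ι-+ B B))) N≤n)

  -- expTo x n is about expTo y n * expTo (x - y) n, and the last factor is close to 1.
  expTo-continuous : ∀ B {ε} → 0ℚ < ε → ∃[ δ ] 0ℚ < δ × ∃[ N ] ∀ x y n →
    ∣ x ∣ ≤ ι B → ∣ y ∣ ≤ ι B → ∣ x - y ∣ ≤ δ → N ℕ.≤ n → ∣ expTo x n - expTo y n ∣ ≤ ε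
  expTo-continuous B {ε} 0<ε = δ , 0<shrink (C ℕ.* C) (0<½* 0<ε) , N , close
    where
    N = proj₁ (expTo-homo (B ℕ.+ B) (0<½* 0<ε))
    homo = proj₂ (expTo-homo (B ℕ.+ B) (0<½* 0<ε))
    C = proj₁ (expTo-bounded (B ℕ.+ B))
    bounded = proj₂ (expTo-bounded (B ℕ.+ B))
    δ = shrink (C ℕ.* C) (½ * ε)
    close : ∀ x y n → ∣ x ∣ ≤ ι B → ∣ y ∣ ≤ ι B → ∣ x - y ∣ ≤ δ → N ℕ.≤ n → ∣ expTo x n - expTo y n ∣ ≤ ε
    close x y n x≤ y≤ x-y≤ N≤n = begin
      ∣ expTo x n - expTo y n ∣
        ≤⟨ ∣-∣-triangle (expTo x n) (expTo y n * expTo h n) (expTo y n) ⟩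
      ∣ expTo x n - expTo y n * expTo h n ∣ + ∣ expTo y n * expTo h n - expTo y n ∣
        ≤⟨ ℚₚ.+-mono-≤ first second ⟩
      ½ * ε + ½ * ε                    ≡⟨ ½*+½* ε ⟩
      ε                                ∎
      where
      h = x - y
      open +-*-Solver
      y+h≡x : ∀ x y → y + (x - y) ≡ x
      y+h≡x = solve 2 (λ x y → y :+ (x :- y) := x) refl
      factor : ∀ a b c → c ≡ 1ℚ → a * b - a ≡ a * (b - c)
      factor a b c refl = trans (cong (λ t → a * b - t) (sym (ℚₚ.*-identityʳ a))) (sym (*-distribˡ-minus a b 1ℚ))
      B≤2B : ι B ≤ ι (B ℕ.+ B)
      B≤2B = ι-mono (ℕₚ.m≤m+n B B)
      h≤ : ∣ h ∣ ≤ ι (B ℕ.+ B)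
      h≤ = begin
        ∣ x - y ∣          ≤⟨ ℚₚ.∣p-q∣≤∣p∣+∣q∣ x y ⟩
        ∣ x ∣ + ∣ y ∣      ≤⟨ ℚₚ.+-mono-≤ x≤ y≤ ⟩
        ι B + ι B          ≡⟨ ι-+ B B ⟨
        ι (B ℕ.+ B)        ∎
      first : ∣ expTo x n - expTo y n * expTo h n ∣ ≤ ½ * ε
      first = begin
        ∣ expTo x n - expTo y n * expTo h n ∣        ≡⟨ ∣p-q∣≡∣q-p∣ (expTo x n) _ ⟩
        ∣ expTo y n * expTo h n - expTo x n ∣        ≡⟨ cong (λ t → ∣ expTo y n * expTo h n - expTo t n ∣) (y+h≡x x y) ⟨
        ∣ expTo y n * expTo h n - expTo (y + h) n ∣  ≤⟨ homo y h n (ℚₚ.≤-trans y≤ B≤2B) h≤ N≤n ⟩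
        ½ * ε                                        ∎
      second : ∣ expTo y n * expTo h n - expTo y n ∣ ≤ ½ * ε
      second = begin
        ∣ expTo y n * expTo h n - expTo y n ∣        ≡⟨ cong ∣_∣ (factor (expTo y n) (expTo h n) 1ℚ refl) ⟩
        ∣ expTo y n * (expTo h n - 1ℚ) ∣
          ≤⟨ ∣*∣≤ {expTo y n} (ℚₚ.≤-trans (∣expTo∣≤ y≤ n) (bounded (ι B) n (0≤ι B) B≤2B))
               (ℚₚ.≤-trans (∣expTo-1∣≤ {h} ℚₚ.≤-refl n)
                 (*-mono (0≤expTo (ℚₚ.0≤∣p∣ h) n) (ℚₚ.≤-trans (ℚₚ.0≤∣p∣ h) x-y≤) x-y≤ (bounded (∣ h ∣) n (ℚₚ.0≤∣p∣ h) h≤))) ⟩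
        ι C * (δ * ι C)                              ≡⟨ lem (ι C) δ ⟩
        ι C * ι C * δ                                ≡⟨ cong (_* δ) (ι-* C C) ⟨
        ι (C ℕ.* C) * δ                              ≤⟨ ι*shrink≤ (C ℕ.* C) (0<½* 0<ε) ⟩
        ½ * ε                                        ∎
        where
        lem : ∀ c d → c * (d * c) ≡ c * c * d
        lem = solve 2 (λ c d → c :* (d :* c) := c :* c :* d) refl

open import Defs

-- Constructive order and arithmetic of the reals, and the exponential function.

module Reals where

  open import Data.Integer.Base using (+_)
  open import Data.Nat.Base as ℕ using (ℕ; zero; suc; _!)
  import Data.Nat.Properties as ℕₚ
  open import Data.Product.Base using (∃-syntax; _×_; _,_; proj₁; proj₂)
  open import Data.Sum.Base using (_⊎_; inj₁; inj₂)
  open import Data.Rational.Base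
    using (ℚ; 0ℚ; 1ℚ; ½; _+_; _*_; _-_; -_; _≤_; _<_; ∣_∣; _/_)
  import Data.Rational.Properties as ℚₚ
  open import Data.Rational.Solver using (module +-*-Solver)
  open import Relation.Binary.PropositionalEquality
  open import Relation.Nullary using (¬_; Dec; yes; no; contradiction)

  open ℚₚ.≤-Reasoning

  open Rationals

  -- Sequences of rationals

  Eventually : (ℕ → Set) → Set
  Eventually P = ∃[ N ] ∀ n → N ℕ.≤ n → P n

  always : {P : ℕ → Set} → (∀ n → P n) → Eventually P
  always p = 0 , λ n _ → p n

  ev-map : {P Q : ℕ → Set} → (∀ n → P n → Q n) → Eventually P → Eventually Q
  ev-map f (N , p) = N , λ n le → f n (p n le)

  ev-zip : {P Q R : ℕ → Set} → (∀ n → P n → Q n → R n) → Eventually P → Eventually Q → Eventually R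
  ev-zip f (M , p) (N , q) = M ℕ.⊔ N , λ n le →
    f n (p n (ℕₚ.m⊔n≤o⇒m≤o M N le)) (q n (ℕₚ.m⊔n≤o⇒n≤o M N le))

  ≤-+-trans : ∀ {p q r d e} → p ≤ q + d → q ≤ r + e → p ≤ r + (e + d)
  ≤-+-trans {p} {q} {r} {d} {e} le le′ = begin
    p              ≤⟨ le ⟩
    q + d          ≤⟨ ℚₚ.+-monoˡ-≤ d le′ ⟩
    r + e + d      ≡⟨ ℚₚ.+-assoc r e d ⟩
    r + (e + d)    ∎

  +-+-mono : ∀ {p q r s d e} → p ≤ q + d → r ≤ s + e → p + r ≤ q + s + (d + e)
  +-+-mono {p} {q} {r} {s} {d} {e} le le′ =
    ℚₚ.≤-trans (ℚₚ.+-mono-≤ le le′) (ℚₚ.≤-reflexive (lem q s d e))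
    where
    open +-*-Solver
    lem : ∀ q s d e → (q + d) + (s + e) ≡ q + s + (d + e)
    lem = solve 4 (λ q s d e → (q :+ d) :+ (s :+ e) := q :+ s :+ (d :+ e)) refl

  ≤-½ : ∀ {p q ε} → p ≤ q + (½ * ε + ½ * ε) → p ≤ q + ε
  ≤-½ {p} {q} {ε} = subst (λ e → p ≤ q + e) (½*+½* ε)

  +-cancelʳ : ∀ {p q} r → p + r ≤ q + r → p ≤ q
  +-cancelʳ {p} {q} r le = ℚₚ.≤-trans (ℚₚ.≤-reflexive (lem p r))
    (ℚₚ.≤-trans (ℚₚ.+-monoˡ-≤ (- r) le) (ℚₚ.≤-reflexive (sym (lem q r))))
    where
    open +-*-Solver
    lem : ∀ p r → p ≡ p + r - r
    lem = solve 2 (λ p r → p := p :+ r :- r) refl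

  bounded : ∀ x → ∃[ B ] Eventually (λ n → ∣ seq x n ∣ ≤ ι B)
  bounded x = proj₁ B , N , λ n N≤n → begin
    ∣ seq x n ∣                        ≡⟨ cong ∣_∣ (lem (seq x n) (seq x N)) ⟩
    ∣ (seq x n - seq x N) + seq x N ∣
      ≤⟨ ∣+∣≤ {seq x n - seq x N} (proj₂ (cauchy x 1ℚ (ℚₚ.positive⁻¹ 1ℚ)) n N N≤n ℕₚ.≤-refl) ℚₚ.≤-refl ⟩
    1ℚ + ∣ seq x N ∣                   ≤⟨ proj₂ B ⟩
    ι (proj₁ B)                        ∎
    where
    N = proj₁ (cauchy x 1ℚ (ℚₚ.positive⁻¹ 1ℚ))
    B = archimedean (1ℚ + ∣ seq x N ∣)
    open +-*-Solver
    lem : ∀ a b → a ≡ (a - b) + b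
    lem = solve 2 (λ a b → a := (a :- b) :+ b) refl

  bounded₂ : ∀ x y → ∃[ B ] Eventually (λ n → ∣ seq x n ∣ ≤ ι B × ∣ seq y n ∣ ≤ ι B)
  bounded₂ x y = B₁ ℕ.⊔ B₂ , ev-zip
    (λ n p q → ℚₚ.≤-trans p (ι-mono (ℕₚ.m≤m⊔n B₁ B₂)) , ℚₚ.≤-trans q (ι-mono (ℕₚ.m≤n⊔m B₁ B₂)))
    (proj₂ (bounded x)) (proj₂ (bounded y))
    where
    B₁ = proj₁ (bounded x)
    B₂ = proj₁ (bounded y)

  -- The operations and relations are sealed, so that they can be inferred by
  -- unification.

  infix  4 _⩽_ _≺_ _≈_
  infixl 6 _⊕_
  infixl 7 _⊗_
  infix  8 ⊖_

  abstract
    _⩽_ _≺_ : ℝ → ℝ → Set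
    _⩽_ = _≤ℝ_
    _≺_ = _<ℝ_

    _⊕_ _⊗_ : ℝ → ℝ → ℝ
    _⊕_ = _+ℝ_
    _⊗_ = _*ℝ_

    κ : ℚ → ℝ
    κ = fromℚ

    ⊖_ : ℝ → ℝ
    ⊖ x = mkℝ (λ n → - seq x n) λ ε 0<ε → proj₁ (cauchy x ε 0<ε) , λ m n le le′ →
      ℚₚ.≤-trans (ℚₚ.≤-reflexive (trans (cong ∣_∣ (lem (seq x m) (seq x n))) (∣p-q∣≡∣q-p∣ (seq x n) (seq x m))))
        (proj₂ (cauchy x ε 0<ε) m n le le′)
      where
      open +-*-Solver
      lem : ∀ a b → - a - (- b) ≡ b - a
      lem = solve 2 (λ a b → :- a :- (:- b) := b :- a) refl

  _≈_ : ℝ → ℝ → Set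
  x ≈ y = (x ⩽ y) × (y ⩽ x)

  ν : ℕ → ℝ
  ν n = κ (ι n)

  abstract
    ⩽-to : ∀ {x y} → x ≤ℝ y → x ⩽ y
    ⩽-to p = p

    ⩽-from : ∀ {x y} → x ⩽ y → x ≤ℝ y
    ⩽-from p = p

    ≺-to : ∀ {x y} → x <ℝ y → x ≺ y
    ≺-to p = p

    ≺-from : ∀ {x y} → x ≺ y → x <ℝ y
    ≺-from p = p

    ⊗≡ : ∀ x y → x ⊗ y ≡ x *ℝ y
    ⊗≡ x y = refl

    κ≡ : ∀ q → κ q ≡ fromℚ q
    κ≡ q = refl

    ≡⇒⩽ : ∀ x y → (∀ n → seq x n ≡ seq y n) → x ⩽ y
    ≡⇒⩽ x y eq ε 0<ε = always λ n → ℚₚ.≤-trans (ℚₚ.≤-reflexive (eq n)) (p≤p+q (seq y n) (ℚₚ.<⇒≤ 0<ε))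

    ≡⇒≈ : ∀ x y → (∀ n → seq x n ≡ seq y n) → x ≈ y
    ≡⇒≈ x y eq = ≡⇒⩽ x y eq , ≡⇒⩽ y x (λ n → sym (eq n))

    ⩽-refl : ∀ {x} → x ⩽ x
    ⩽-refl {x} = ≡⇒⩽ x x λ _ → refl

    ⩽-trans : ∀ {x y z} → x ⩽ y → y ⩽ z → x ⩽ z
    ⩽-trans {x} {y} {z} p q ε 0<ε = ev-zip
      (λ n a b → ≤-½ {seq x n} {seq z n} (≤-+-trans {seq x n} {seq y n} {seq z n} a b))
      (p (½ * ε) (0<½* 0<ε)) (q (½ * ε) (0<½* 0<ε))

    ⊕-mono : ∀ {x y z w} → x ⩽ y → z ⩽ w → x ⊕ z ⩽ y ⊕ w
    ⊕-mono {x} {y} {z} {w} p q ε 0<ε = ev-zip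
      (λ n a b → ≤-½ {seq x n + seq z n} {seq y n + seq w n} (+-+-mono {q = seq y n} {s = seq w n} a b))
      (p (½ * ε) (0<½* 0<ε)) (q (½ * ε) (0<½* 0<ε))

    ⊕-assoc : ∀ x y z → (x ⊕ y) ⊕ z ≈ x ⊕ (y ⊕ z)
    ⊕-assoc x y z = ≡⇒≈ ((x ⊕ y) ⊕ z) (x ⊕ (y ⊕ z)) λ n → ℚₚ.+-assoc (seq x n) (seq y n) (seq z n)

    ⊕-comm : ∀ x y → x ⊕ y ≈ y ⊕ x
    ⊕-comm x y = ≡⇒≈ (x ⊕ y) (y ⊕ x) λ n → ℚₚ.+-comm (seq x n) (seq y n)

    ⊕-identityˡ : ∀ x → κ 0ℚ ⊕ x ≈ x
    ⊕-identityˡ x = ≡⇒≈ (κ 0ℚ ⊕ x) x λ n → ℚₚ.+-identityˡ (seq x n)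

    ⊖-inverseʳ : ∀ x → x ⊕ ⊖ x ≈ κ 0ℚ
    ⊖-inverseʳ x = ≡⇒≈ (x ⊕ ⊖ x) (κ 0ℚ) λ n → ℚₚ.+-inverseʳ (seq x n)

    ⊗-assoc : ∀ x y z → (x ⊗ y) ⊗ z ≈ x ⊗ (y ⊗ z)
    ⊗-assoc x y z = ≡⇒≈ ((x ⊗ y) ⊗ z) (x ⊗ (y ⊗ z)) λ n → ℚₚ.*-assoc (seq x n) (seq y n) (seq z n)

    ⊗-comm : ∀ x y → x ⊗ y ≈ y ⊗ x
    ⊗-comm x y = ≡⇒≈ (x ⊗ y) (y ⊗ x) λ n → ℚₚ.*-comm (seq x n) (seq y n)

    ⊗-identityˡ : ∀ x → κ 1ℚ ⊗ x ≈ x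
    ⊗-identityˡ x = ≡⇒≈ (κ 1ℚ ⊗ x) x λ n → ℚₚ.*-identityˡ (seq x n)

    ⊗-zeroˡ : ∀ x → κ 0ℚ ⊗ x ≈ κ 0ℚ
    ⊗-zeroˡ x = ≡⇒≈ (κ 0ℚ ⊗ x) (κ 0ℚ) λ n → ℚₚ.*-zeroˡ (seq x n)

    ⊗-distribˡ-⊕ : ∀ x y z → x ⊗ (y ⊕ z) ≈ x ⊗ y ⊕ x ⊗ z
    ⊗-distribˡ-⊕ x y z = ≡⇒≈ (x ⊗ (y ⊕ z)) (x ⊗ y ⊕ x ⊗ z) λ n → ℚₚ.*-distribˡ-+ (seq x n) (seq y n) (seq z n)

    ⊗-congʳ-⩽ : ∀ {x x′} y → x ≈ x′ → x ⊗ y ⩽ x′ ⊗ y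
    ⊗-congʳ-⩽ {x} {x′} y (x⩽x′ , x′⩽x) ε 0<ε =
      ev-zip (λ n y≤ (a , b) → ∣-∣≤⇒≤ {seq x n * seq y n} (begin
        ∣ seq x n * seq y n - seq x′ n * seq y n ∣   ≡⟨ cong ∣_∣ (lem (seq x n) (seq x′ n) (seq y n)) ⟩
        ∣ (seq x n - seq x′ n) * seq y n ∣           ≤⟨ ∣*∣≤ {seq x n - seq x′ n} (≤⇒∣-∣≤ {seq x n} {seq x′ n} a b) y≤ ⟩
        δ * ι B                                      ≡⟨ ℚₚ.*-comm δ (ι B) ⟩
        ι B * δ                                      ≤⟨ ι*shrink≤ B 0<ε ⟩
        ε                                            ∎))
        (proj₂ (bounded y)) (ev-zip (λ n a b → a , b) (x⩽x′ δ (0<shrink B 0<ε)) (x′⩽x δ (0<shrink B 0<ε)))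
      where
      B : ℕ
      B = proj₁ (bounded y)
      δ : ℚ
      δ = shrink B ε
      open +-*-Solver
      lem : ∀ a b c → a * c - b * c ≡ (a - b) * c
      lem = solve 3 (λ a b c → a :* c :- b :* c := (a :- b) :* c) refl

    -- Approximations of a nonnegative real may be negative, but eventually not below `- δ`. A
    -- factor of the wrong sign then has size at most `δ`, the other at most `B`, and their product
    -- at most `ε`.
    ⊗-nonneg : ∀ {x y} → κ 0ℚ ⩽ x → κ 0ℚ ⩽ y → κ 0ℚ ⩽ x ⊗ y
    ⊗-nonneg {x} {y} 0⩽x 0⩽y ε 0<ε =
      ev-zip (λ n (x≤ , y≤) (a , b) → pointwise (seq x n) (seq y n) x≤ y≤ a b)
        (proj₂ (bounded₂ x y)) (ev-zip (λ n a b → a , b) (0⩽x δ (0<shrink B 0<ε)) (0⩽y δ (0<shrink B 0<ε)))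
      where
      B : ℕ
      B = proj₁ (bounded₂ x y)
      δ : ℚ
      δ = shrink B ε
      negligible : ∀ p q → ∣ p ∣ ≤ δ → ∣ q ∣ ≤ ι B → ∣ p * q ∣ ≤ ε
      negligible p q p≤ q≤ = ℚₚ.≤-trans (∣*∣≤ {p} p≤ q≤) (ℚₚ.≤-trans (ℚₚ.≤-reflexive (ℚₚ.*-comm δ (ι B))) (ι*shrink≤ B 0<ε))
      from-∣∣ : ∀ p → ∣ p ∣ ≤ ε → 0ℚ ≤ p + ε
      from-∣∣ p ∣p∣≤ε = ∣-∣≤⇒≤ {0ℚ} {p} {ε} (subst (_≤ ε) (trans (sym (ℚₚ.∣-p∣≡∣p∣ p)) (cong ∣_∣ (sym (ℚₚ.+-identityˡ (- p))))) ∣p∣≤ε)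
      small : ∀ p → p ≤ 0ℚ → 0ℚ ≤ p + δ → ∣ p ∣ ≤ δ
      small p p≤0 0≤p+δ = ∣-∣≤ (ℚₚ.≤-trans p≤0 (ℚₚ.<⇒≤ (0<shrink B 0<ε)))
        (subst (_≤ δ) (ℚₚ.+-identityˡ (- p)) (p-q≤r {0ℚ} {p} {δ} 0≤p+δ))
      pointwise : ∀ p q → ∣ p ∣ ≤ ι B → ∣ q ∣ ≤ ι B → 0ℚ ≤ p + δ → 0ℚ ≤ q + δ → 0ℚ ≤ p * q + ε
      pointwise p q p≤ q≤ a b with ℚₚ.≤-total 0ℚ p | ℚₚ.≤-total 0ℚ q
      ... | inj₁ 0≤p | inj₁ 0≤q = 0≤+ (0≤* 0≤p 0≤q) (ℚₚ.<⇒≤ 0<ε)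
      ... | inj₂ p≤0 | _        = from-∣∣ (p * q) (negligible p q (small p p≤0 a) q≤)
      ... | inj₁ _   | inj₂ q≤0 = from-∣∣ (p * q)
        (subst (λ t → ∣ t ∣ ≤ ε) (ℚₚ.*-comm q p) (negligible q p (small q q≤0 b) p≤))

    ⊗-monoˡ : ∀ {x y} z → κ 0ℚ ⩽ z → x ⩽ y → z ⊗ x ⩽ z ⊗ y
    ⊗-monoˡ {x} {y} z 0⩽z x⩽y ε 0<ε = ev-map
      (λ n h → p≤q+r {seq z n * seq x n} {seq z n * seq y n} {ε} (subst₂ _≤_ (ℚₚ.+-identityʳ _) (lem (seq z n) (seq x n) (seq y n) ε)
        (ℚₚ.+-monoʳ-≤ (seq z n * seq x n - seq z n * seq y n) h)))
      (⊗-nonneg {z} {y ⊕ ⊖ x} 0⩽z (λ ε 0<ε → ev-map (λ n h → begin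
        0ℚ                           ≡⟨ ℚₚ.+-inverseʳ (seq x n) ⟨
        seq x n - seq x n            ≤⟨ ℚₚ.+-monoˡ-≤ (- seq x n) h ⟩
        seq y n + ε - seq x n        ≡⟨ lem′ (seq y n) ε (seq x n) ⟩
        seq y n - seq x n + ε        ∎) (x⩽y ε 0<ε)) ε 0<ε)
      where
      open +-*-Solver
      lem : ∀ z x y ε → (z * x - z * y) + (z * (y - x) + ε) ≡ ε
      lem = solve 4 (λ z x y ε → (z :* x :- z :* y) :+ (z :* (y :- x) :+ ε) := ε) refl
      lem′ : ∀ y ε x → y + ε - x ≡ y - x + ε
      lem′ = solve 3 (λ y ε x → y :+ ε :- x := y :- x :+ ε) refl

    ≺⇒⩽ : ∀ {x y} → x ≺ y → x ⩽ y
    ≺⇒⩽ {x} {y} (δ , 0<δ , N , gap) ε 0<ε = N , λ n N≤n →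
      ℚₚ.≤-trans (p≤p+q (seq x n) (ℚₚ.<⇒≤ 0<δ)) (ℚₚ.≤-trans (gap n N≤n) (p≤p+q (seq y n) (ℚₚ.<⇒≤ 0<ε)))

    ≺-⩽-trans : ∀ {x y z} → x ≺ y → y ⩽ z → x ≺ z
    ≺-⩽-trans {x} {y} {z} (δ , 0<δ , gap) y⩽z = ½ * δ , 0<½* 0<δ , ev-zip (λ n a b → +-cancelʳ {seq x n + ½ * δ} {seq z n} (½ * δ) (begin
      seq x n + ½ * δ + ½ * δ      ≡⟨ trans (ℚₚ.+-assoc (seq x n) (½ * δ) (½ * δ)) (cong (λ t → seq x n + t) (½*+½* δ)) ⟩
      seq x n + δ                  ≤⟨ a ⟩
      seq y n                      ≤⟨ b ⟩
      seq z n + ½ * δ              ∎)) gap (y⩽z (½ * δ) (0<½* 0<δ))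

    ⩽-≺-trans : ∀ {x y z} → x ⩽ y → y ≺ z → x ≺ z
    ⩽-≺-trans {x} {y} {z} x⩽y (δ , 0<δ , gap) = ½ * δ , 0<½* 0<δ , ev-zip (λ n a b → begin
      seq x n + ½ * δ              ≤⟨ ℚₚ.+-monoˡ-≤ (½ * δ) a ⟩
      seq y n + ½ * δ + ½ * δ      ≡⟨ trans (ℚₚ.+-assoc (seq y n) (½ * δ) (½ * δ)) (cong (λ t → seq y n + t) (½*+½* δ)) ⟩
      seq y n + δ                  ≤⟨ b ⟩
      seq z n                      ∎) (x⩽y (½ * δ) (0<½* 0<δ)) gap

    ≺-irrefl : ∀ {x} → ¬ x ≺ x
    ≺-irrefl {x} (δ , 0<δ , N , gap) = ℚₚ.<-irrefl refl (ℚₚ.<-≤-trans (ℚₚ.<-respˡ-≡ (ℚₚ.+-identityʳ (seq x N))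
      (ℚₚ.+-monoʳ-< (seq x N) 0<δ)) (gap N ℕₚ.≤-refl))

    -- Comparison with a tolerance is decidable: from `N` on both sequences vary by at most
    -- `d = h / 4`, so a single rational comparison at `N` settles all later indices up to
    -- `2 * d = h / 2`.
    locate : ∀ x z {h} → 0ℚ < h → x ≺ z ⊎ Eventually (λ n → seq z n ≤ seq x n + (h + ½ * h))
    locate x z {h} 0<h = decide (seq z N ℚₚ.≤? seq x N + h)
      where
      k d : ℚ
      k = ½ * h
      d = ½ * k
      0<d : 0ℚ < d
      0<d = 0<½* (0<½* 0<h)
      Nx Nz N : ℕ
      Nx = proj₁ (cauchy x d 0<d)
      Nz = proj₁ (cauchy z d 0<d)
      N = Nx ℕ.⊔ Nz
      close-x : ∀ m n → N ℕ.≤ m → N ℕ.≤ n → seq x m ≤ seq x n + d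
      close-x m n le le′ = ∣-∣≤⇒≤ {seq x m} {seq x n} {d} (proj₂ (cauchy x d 0<d) m n (ℕₚ.m⊔n≤o⇒m≤o Nx Nz le) (ℕₚ.m⊔n≤o⇒m≤o Nx Nz le′))
      close-z : ∀ m n → N ℕ.≤ m → N ℕ.≤ n → seq z m ≤ seq z n + d
      close-z m n le le′ = ∣-∣≤⇒≤ {seq z m} {seq z n} {d} (proj₂ (cauchy z d 0<d) m n (ℕₚ.m⊔n≤o⇒n≤o Nx Nz le) (ℕₚ.m⊔n≤o⇒n≤o Nx Nz le′))
      decide : Dec (seq z N ≤ seq x N + h) → x ≺ z ⊎ Eventually (λ n → seq z n ≤ seq x n + (h + k))
      decide (yes le) = inj₂ (N , λ n N≤n → subst (λ t → seq z n ≤ seq x n + t)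
        (trans (lem d h) (cong (λ t → h + t) (½*+½* k)))
        (≤-+-trans {seq z n} {seq x N} {seq x n} (≤-+-trans {seq z n} {seq z N} {seq x N} (close-z n N N≤n ℕₚ.≤-refl) le) (close-x N n ℕₚ.≤-refl N≤n)))
        where
        open +-*-Solver
        lem : ∀ d h → d + (h + d) ≡ h + (d + d)
        lem = solve 2 (λ d h → d :+ (h :+ d) := h :+ (d :+ d)) refl
      decide (no ≰) = inj₁ (k , 0<½* 0<h , N , λ n N≤n → +-cancelʳ {seq x n + k} {seq z n} d (begin
        seq x n + k + d              ≤⟨ ℚₚ.+-monoˡ-≤ d (ℚₚ.+-monoˡ-≤ k (close-x n N N≤n ℕₚ.≤-refl)) ⟩
        seq x N + d + k + d          ≡⟨ lem (seq x N) d k ⟩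
        seq x N + (k + (d + d))      ≡⟨ cong (λ t → seq x N + t) (trans (cong (λ t → k + t) (½*+½* k)) (½*+½* h)) ⟩
        seq x N + h                  ≤⟨ ℚₚ.<⇒≤ (ℚₚ.≰⇒> ≰) ⟩
        seq z N                      ≤⟨ close-z N n ℕₚ.≤-refl N≤n ⟩
        seq z n + d                  ∎))
        where
        open +-*-Solver
        lem : ∀ x d k → x + d + k + d ≡ x + (k + (d + d))
        lem = solve 3 (λ x d k → x :+ d :+ k :+ d := x :+ (k :+ (d :+ d))) refl

    -- At tolerance `ε / 2` the first alternative of `locate` is excluded, and the second leaves an
    -- error of `3 * ε / 4`.
    ⊀⇒⩾ : ∀ {x y} → ¬ x ≺ y → y ⩽ x
    ⊀⇒⩾ {x} {y} x⊀y ε 0<ε = decide (locate x y (0<½* 0<ε))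
      where
      decide : x ≺ y ⊎ Eventually (λ n → seq y n ≤ seq x n + (½ * ε + ½ * (½ * ε))) →
        Eventually (λ n → seq y n ≤ seq x n + ε)
      decide (inj₁ x≺y) = contradiction x≺y x⊀y
      decide (inj₂ ev)  = ev-map (λ n le → ≤-½ {seq y n} {seq x n} {ε} (ℚₚ.≤-trans le (ℚₚ.+-monoʳ-≤ (seq x n) (ℚₚ.+-monoʳ-≤ (½ * ε)
        (subst (½ * (½ * ε) ≤_) (½*+½* (½ * ε)) (p≤p+q _ (ℚₚ.<⇒≤ (0<½* (0<½* 0<ε))))))))) ev

    -- The constructive substitute for trichotomy. With `h = δ / 2`, the second alternative of
    -- `locate` puts `z` at most `3 * δ / 4` above `x`, hence `δ / 4` below `y`.
    cotransitive : ∀ {x y} → x ≺ y → ∀ z → x ≺ z ⊎ z ≺ y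
    cotransitive {x} {y} (δ , 0<δ , gap) z = decide (locate x z (0<½* 0<δ))
      where
      h k : ℚ
      h = ½ * δ
      k = ½ * h
      decide : x ≺ z ⊎ Eventually (λ n → seq z n ≤ seq x n + (h + k)) → x ≺ z ⊎ z ≺ y
      decide (inj₁ x≺z) = inj₁ x≺z
      decide (inj₂ ev)  = inj₂ (k , 0<½* (0<½* 0<δ) , ev-zip (λ n le gap → begin
        seq z n + k                   ≤⟨ ℚₚ.+-monoˡ-≤ k le ⟩
        seq x n + (h + k) + k         ≡⟨ lem (seq x n) h k ⟩
        seq x n + (h + (k + k))       ≡⟨ cong (λ t → seq x n + t) (trans (cong (λ t → h + t) (½*+½* h)) (½*+½* δ)) ⟩
        seq x n + δ                   ≤⟨ gap ⟩
        seq y n                       ∎) ev gap)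
        where
        open +-*-Solver
        lem : ∀ x h k → x + (h + k) + k ≡ x + (h + (k + k))
        lem = solve 3 (λ x h k → x :+ (h :+ k) :+ k := x :+ (h :+ (k :+ k))) refl

    ≺-sub : ∀ {x y} → x ≺ y → κ 0ℚ ≺ y ⊕ ⊖ x
    ≺-sub {x} {y} (δ , 0<δ , gap) = δ , 0<δ , ev-map (λ n le → begin
      0ℚ + δ                        ≡⟨ lem δ (seq x n) ⟩
      seq x n + δ - seq x n         ≤⟨ ℚₚ.+-monoˡ-≤ (- seq x n) le ⟩
      seq y n - seq x n             ∎) gap
      where
      open +-*-Solver
      lem : ∀ δ x → 0ℚ + δ ≡ x + δ - x
      lem = solve 2 (λ δ x → con 0ℚ :+ δ := x :+ δ :- x) refl

    0≺⇒≺⊕ : ∀ x {y} → κ 0ℚ ≺ y → x ≺ x ⊕ y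
    0≺⇒≺⊕ x {y} (δ , 0<δ , gap) = δ , 0<δ , ev-map (λ n le →
      ℚₚ.+-monoʳ-≤ (seq x n) (subst (_≤ seq y n) (ℚₚ.+-identityˡ δ) le)) gap

    gap : ∀ {x} → κ 0ℚ ≺ x → ∃[ ε ] 0ℚ < ε × κ ε ⩽ x
    gap {x} (δ , 0<δ , ev) = δ , 0<δ , λ ε 0<ε → ev-map (λ n le →
      ℚₚ.≤-trans (subst (_≤ seq x n) (ℚₚ.+-identityˡ δ) le) (p≤p+q (seq x n) (ℚₚ.<⇒≤ 0<ε))) ev

    ⊗-pos : ∀ {x y} → κ 0ℚ ≺ x → κ 0ℚ ≺ y → κ 0ℚ ≺ x ⊗ y
    ⊗-pos {x} {y} (δ , 0<δ , gap) (ε , 0<ε , gap′) = δ * ε , 0<* 0<δ 0<ε , ev-zip (λ n a b → begin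
      0ℚ + δ * ε            ≡⟨ ℚₚ.+-identityˡ (δ * ε) ⟩
      δ * ε                 ≤⟨ *-mono (ℚₚ.<⇒≤ 0<ε) (ℚₚ.≤-trans (ℚₚ.<⇒≤ 0<δ) (subst (_≤ seq x n) (ℚₚ.+-identityˡ δ) a))
                                 (subst (_≤ seq x n) (ℚₚ.+-identityˡ δ) a) (subst (_≤ seq y n) (ℚₚ.+-identityˡ ε) b) ⟩
      seq x n * seq y n     ∎) gap gap′

    κ-mono : ∀ {p q} → p ≤ q → κ p ⩽ κ q
    κ-mono {p} {q} p≤q ε 0<ε = always λ _ → ℚₚ.≤-trans p≤q (p≤p+q q (ℚₚ.<⇒≤ 0<ε))

    κ-mono-< : ∀ {p q} → p < q → κ p ≺ κ q
    κ-mono-< {p} {q} p<q = q - p , subst (_< q - p) (ℚₚ.+-inverseʳ p) (ℚₚ.+-monoˡ-< (- p) p<q)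
      , always (λ _ → ℚₚ.≤-reflexive (lem p q))
      where
      open +-*-Solver
      lem : ∀ p q → p + (q - p) ≡ q
      lem = solve 2 (λ p q → p :+ (q :- p) := q) refl

    κ-cancel : ∀ {p q} → κ p ⩽ κ q → p ≤ q
    κ-cancel {p} {q} le = ℚₚ.≮⇒≥ λ q<p → ≺-irrefl {κ q} (≺-⩽-trans {κ q} {κ p} {κ q} (κ-mono-< q<p) le)

    κ-+ : ∀ p q → κ (p + q) ≈ κ p ⊕ κ q
    κ-+ p q = ≡⇒≈ (κ (p + q)) (κ p ⊕ κ q) λ _ → refl

    κ-* : ∀ p q → κ (p * q) ≈ κ p ⊗ κ q
    κ-* p q = ≡⇒≈ (κ (p * q)) (κ p ⊗ κ q) λ _ → refl

    archimedeanℝ : ∀ x → ∃[ n ] x ⩽ ν n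
    archimedeanℝ x = proj₁ (bounded x) , λ ε 0<ε → ev-map
      (λ n le → ℚₚ.≤-trans (p≤∣p∣ (seq x n)) (ℚₚ.≤-trans le (p≤p+q _ (ℚₚ.<⇒≤ 0<ε)))) (proj₂ (bounded x))

    ⩽-closed : ∀ {x y} → (∀ {ε} → 0ℚ < ε → x ⩽ y ⊕ κ ε) → x ⩽ y
    ⩽-closed {x} {y} h ε 0<ε = ev-map (λ n le → ≤-½ {seq x n} {seq y n} {ε} (subst (seq x n ≤_) (ℚₚ.+-assoc (seq y n) (½ * ε) (½ * ε)) le))
      (h (0<½* 0<ε) (½ * ε) (0<½* 0<ε))

    -- The intervals `[a n, a n + w n]` overlap pairwise, as the hypothesis concerns all `m` and
    -- `n`; so the left ends form a Cauchy sequence whose limit lies in every interval.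
    limit : (a w : ℕ → ℚ) → (∀ m n → a m ≤ a n + w n) → (∀ {ε} → 0ℚ < ε → Eventually (λ n → w n ≤ ε)) →
      ∃[ l ] ∀ n → (κ (a n) ⩽ l) × (l ⩽ κ (a n + w n))
    limit a w close small = mkℝ a
      (λ ε 0<ε → proj₁ (small 0<ε) , λ m n le le′ →
        ≤⇒∣-∣≤ {a m} {a n} (widen m n (proj₂ (small 0<ε) n le′)) (widen n m (proj₂ (small 0<ε) m le)))
      , λ n → (λ ε 0<ε → ev-map (λ m → widen n m) (small 0<ε))
            , (λ ε 0<ε → always λ m → ℚₚ.≤-trans (close m n) (p≤p+q _ (ℚₚ.<⇒≤ 0<ε)))
      where
      widen : ∀ m n {ε} → w n ≤ ε → a m ≤ a n + ε
      widen m n w≤ε = ℚₚ.≤-trans (close m n) (ℚₚ.+-monoʳ-≤ (a n) w≤ε)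

  -- The exponential function

    exp : ℝ → ℝ
    -- A diagonal sequence. It is Cauchy because the tails of the series are uniformly small on
    -- bounded sets and the partial sums are equicontinuous there.
    exp x = mkℝ (λ n → expTo (seq x n) n) λ ε 0<ε →
      let B , x≤ = bounded x
          δ , 0<δ , N₁ , near = expTo-continuous B (0<½* 0<ε)
          N₂ , tail = expTo-tail-∣∣ B (0<½* 0<ε)
          N₃ , close = cauchy x δ 0<δ
          N , all = ev-zip (λ n a b → a , b) x≤ (ev-zip {R = λ n → (N₁ ℕ.≤ n × N₂ ℕ.≤ n) × N₃ ℕ.≤ n} (λ n a b → a , b)
                      (ev-zip (λ n a b → a , b) (N₁ , λ _ le → le) (N₂ , λ _ le → le)) (N₃ , λ _ le → le))
      in N , λ m n le le′ →
        let xm≤ , (N₁≤m , N₂≤m) , N₃≤m = all m le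
            xn≤ , (N₁≤n , N₂≤n) , N₃≤n = all n le′
        in ℚₚ.≤-trans (∣-∣-triangle (expTo (seq x m) m) (expTo (seq x m) n) (expTo (seq x n) n))
          (ℚₚ.≤-trans (ℚₚ.+-mono-≤ (tail (seq x m) m n xm≤ N₂≤m N₂≤n)
                                   (near (seq x m) (seq x n) n xm≤ xn≤ (close m n N₃≤m N₃≤n) N₁≤n))
            (ℚₚ.≤-reflexive (½*+½* ε)))

    exp-⊕ : ∀ x y → exp (x ⊕ y) ≈ exp x ⊗ exp y
    exp-⊕ x y = (λ ε 0<ε → ev-map (λ n le → ∣-∣≤⇒≤ {expTo (seq x n + seq y n) n}
                  (subst (_≤ ε) (∣p-q∣≡∣q-p∣ (expTo (seq x n) n * expTo (seq y n) n) (expTo (seq x n + seq y n) n)) le)) (near 0<ε))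
              , (λ ε 0<ε → ev-map (λ n le → ∣-∣≤⇒≤ {expTo (seq x n) n * expTo (seq y n) n} le) (near 0<ε))
      where
      B : ℕ
      B = proj₁ (bounded₂ x y)
      near : ∀ {ε} → 0ℚ < ε → Eventually (λ n →
        ∣ expTo (seq x n) n * expTo (seq y n) n - expTo (seq x n + seq y n) n ∣ ≤ ε)
      near 0<ε = ev-zip (λ n (x≤ , y≤) N≤n → proj₂ (expTo-homo B 0<ε) (seq x n) (seq y n) n x≤ y≤ N≤n)
        (proj₂ (bounded₂ x y)) (proj₁ (expTo-homo B 0<ε) , λ _ le → le)

    exp-cong-⩽ : ∀ {x y} → x ≈ y → exp x ⩽ exp y
    exp-cong-⩽ {x} {y} (x⩽y , y⩽x) ε 0<ε =
      let B , xy≤ = bounded₂ x y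
          δ , 0<δ , N , near = expTo-continuous B 0<ε
      in ev-zip (λ n (x≤ , y≤) ((a , b) , N≤n) → ∣-∣≤⇒≤ {expTo (seq x n) n} (near (seq x n) (seq y n) n x≤ y≤ (≤⇒∣-∣≤ {seq x n} {seq y n} a b) N≤n))
        xy≤ (ev-zip (λ n a b → a , b) (ev-zip (λ n a b → a , b) (x⩽y δ 0<δ) (y⩽x δ 0<δ)) (N , λ _ le → le))

    -- For a nonnegative approximation the first two terms of the series suffice. A slightly
    -- negative one has its partial sum within `ε` of 1.
    1⊕⩽exp : ∀ {x} → κ 0ℚ ⩽ x → κ 1ℚ ⊕ x ⩽ exp x
    1⊕⩽exp {x} 0⩽x ε 0<ε =
      ev-zip (λ n x≤ (a , 1≤n) → pointwise (seq x n) n x≤ a 1≤n)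
        (proj₂ (bounded x)) (ev-zip (λ n a b → a , b) (0⩽x δ (0<shrink C 0<ε)) (1 , λ _ le → le))
      where
      B C : ℕ
      B = proj₁ (bounded x)
      C = proj₁ (expTo-bounded B)
      δ : ℚ
      δ = shrink C ε
      pointwise : ∀ q n → ∣ q ∣ ≤ ι B → 0ℚ ≤ q + δ → 1 ℕ.≤ n → 1ℚ + q ≤ expTo q n + ε
      pointwise q (suc n) q≤ a _ with ℚₚ.≤-total 0ℚ q
      ... | inj₁ 0≤q = begin
        1ℚ + q               ≡⟨ cong (λ t → 1ℚ + t) (trans (sym (ℚₚ.*-identityʳ q)) (cong₂ _*_ (trans (sym (ℚₚ.*-identityˡ q)) (cong (_* q) (sym recip-0))) (sym (term-zero q)))) ⟩
        1ℚ + recip 0 * q * term q 0  ≡⟨ cong (λ t → 1ℚ + t) (term-suc q 0) ⟨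
        expTo q 1            ≤⟨ expTo-mono-≤ 0≤q 1 n ⟩
        expTo q (suc n)      ≤⟨ p≤p+q _ (ℚₚ.<⇒≤ 0<ε) ⟩
        expTo q (suc n) + ε  ∎
      ... | inj₂ q≤0 = begin
        1ℚ + q               ≤⟨ ℚₚ.+-monoʳ-≤ 1ℚ q≤0 ⟩
        1ℚ + 0ℚ              ≡⟨ ℚₚ.+-identityʳ 1ℚ ⟩
        1ℚ                   ≤⟨ ∣-∣≤⇒≤ {1ℚ} {expTo q (suc n)} (begin
          ∣ 1ℚ - expTo q (suc n) ∣       ≡⟨ ∣p-q∣≡∣q-p∣ 1ℚ (expTo q (suc n)) ⟩
          ∣ expTo q (suc n) - 1ℚ ∣       ≤⟨ ∣expTo-1∣≤ {q} ℚₚ.≤-refl (suc n) ⟩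
          ∣ q ∣ * expTo (∣ q ∣) (suc n)  ≤⟨ *-mono (0≤expTo (ℚₚ.0≤∣p∣ q) (suc n)) (ℚₚ.<⇒≤ (0<shrink C 0<ε)) ∣q∣≤δ
                                              (proj₂ (expTo-bounded B) (∣ q ∣) (suc n) (ℚₚ.0≤∣p∣ q) q≤) ⟩
          δ * ι C                        ≡⟨ ℚₚ.*-comm δ (ι C) ⟩
          ι C * δ                        ≤⟨ ι*shrink≤ C 0<ε ⟩
          ε                              ∎) ⟩
        expTo q (suc n) + ε  ∎
        where
        ∣q∣≤δ : ∣ q ∣ ≤ δ
        ∣q∣≤δ = ∣-∣≤ (ℚₚ.≤-trans q≤0 (ℚₚ.<⇒≤ (0<shrink C 0<ε))) (subst (_≤ δ) (ℚₚ.+-identityˡ (- q)) (p-q≤r {0ℚ} {q} {δ} a))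

    -- Continuity of `exp` at 0 with a linear rate; `C` bounds the partial sums on `[0, 1]`. It is
    -- what makes small errors in a logarithm small in the number.
    exp⩽1⊕ : ∃[ C ] ∀ {h} → 0ℚ ≤ h → h ≤ 1ℚ → exp (κ h) ⩽ κ (1ℚ + h * ι C)
    exp⩽1⊕ = C , λ {h} 0≤h h≤1 ε 0<ε → always λ n → ℚₚ.≤-trans (pointwise h n 0≤h h≤1) (p≤p+q _ (ℚₚ.<⇒≤ 0<ε))
      where
      C : ℕ
      C = proj₁ (expTo-bounded 1)
      pointwise : ∀ h n → 0ℚ ≤ h → h ≤ 1ℚ → expTo h n ≤ 1ℚ + h * ι C
      pointwise h n 0≤h h≤1 = ∣-∣≤⇒≤ {expTo h n} {1ℚ} (ℚₚ.≤-trans (∣expTo-1∣≤ (ℚₚ.≤-reflexive (ℚₚ.0≤p⇒∣p∣≡p 0≤h)) n)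
        (*-monoˡ h 0≤h (proj₂ (expTo-bounded 1) h n 0≤h (ℚₚ.≤-trans h≤1 (ℚₚ.≤-reflexive (sym ι-1))))))

    seq-^ : ∀ x m n → seq (x ^ℝ m) n ≡ pow (seq x n) m
    seq-^ x zero    n = refl
    seq-^ x (suc m) n = cong (_* seq x n) (seq-^ x m n)

    seq-expSum : ∀ x m n → seq (expSum x m) n ≡ expTo (seq x n) m
    seq-expSum x zero    n = refl
    seq-expSum x (suc m) n = cong₂ _+_ (seq-expSum x m n)
      (trans (cong ((+ 1 / (suc m !)) {{suc m ℕₚ.!≢0}} *_) (seq-^ x (suc m) n)) (sym (term≡ (seq x n) (suc m))))

    -- `expSum x m` evaluates the fixed partial sum `m` along all approximations of `x`, `exp` the
    -- diagonal. Uniform tails bring the two within `ε` once both indices are large; this links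
    -- `exp` to the relation `Exp`.
    expSum-near : ∀ x {ε} → 0ℚ < ε → ∃[ N ] ∀ m → N ℕ.≤ m →
      Eventually (λ n → ∣ seq (expSum x m) n - expTo (seq x n) n ∣ ≤ ε)
    expSum-near x {ε} 0<ε = N , λ m N≤m → ev-zip (λ n x≤ N≤n →
        subst (λ t → ∣ t - expTo (seq x n) n ∣ ≤ ε) (sym (seq-expSum x m n))
          (proj₂ (expTo-tail-∣∣ B 0<ε) (seq x n) m n x≤ N≤m N≤n))
        (proj₂ (bounded x)) (N , λ _ le → le)
      where
      B N : ℕ
      B = proj₁ (bounded x)
      N = proj₁ (expTo-tail-∣∣ B 0<ε)

    exp⇒Exp : ∀ {x y} → exp x ≈ y → Exp x y
    exp⇒Exp {x} {y} (e⩽y , y⩽e) ε 0<ε = proj₁ (expSum-near x 0<ε) , λ m N≤m →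
        (λ ε′ 0<ε′ → ev-zip (λ n near le → subst (seq (expSum x m) n ≤_) (lem (seq y n) ε′ ε) (≤-+-trans {seq (expSum x m) n} {expTo (seq x n) n} {seq y n} (∣-∣≤⇒≤ {seq (expSum x m) n} near) le))
          (proj₂ (expSum-near x 0<ε) m N≤m) (e⩽y ε′ 0<ε′))
      , (λ ε′ 0<ε′ → ev-zip (λ n near le → subst (seq y n ≤_) (sym (ℚₚ.+-assoc (seq (expSum x m) n) ε ε′))
          (≤-+-trans {seq y n} {expTo (seq x n) n} {seq (expSum x m) n} le (∣-∣≤⇒≤ {expTo (seq x n) n} (subst (_≤ ε) (∣p-q∣≡∣q-p∣ (seq (expSum x m) n) (expTo (seq x n) n)) near))))
          (proj₂ (expSum-near x 0<ε) m N≤m) (y⩽e ε′ 0<ε′))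
      where
      open +-*-Solver
      lem : ∀ y a b → y + (a + b) ≡ y + b + a
      lem = solve 3 (λ y a b → y :+ (a :+ b) := y :+ b :+ a) refl

    Exp⇒exp : ∀ {x y} → Exp x y → exp x ≈ y
    Exp⇒exp {x} {y} c = (λ ε 0<ε →
        let h = ½ * ε
            0<h = 0<½* 0<ε
            k = ½ * h
            0<k = 0<½* 0<h
            N₁ , near = expSum-near x 0<h
            N₂ , conv = c k 0<k
            m = N₁ ℕ.⊔ N₂
        in ev-zip (λ n a b → ≤-½ {expTo (seq x n) n} {seq y n} {ε} (≤-+-trans {expTo (seq x n) n} {seq (expSum x m) n} {seq y n} (∣-∣≤⇒≤ {expTo (seq x n) n} (subst (_≤ h) (∣p-q∣≡∣q-p∣ (seq (expSum x m) n) (expTo (seq x n) n)) a))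
                                   (≤-½ {seq (expSum x m) n} {seq y n} {h} (subst (seq (expSum x m) n ≤_) (ℚₚ.+-assoc (seq y n) k k) b))))
          (near m (ℕₚ.m≤m⊔n N₁ N₂)) (proj₁ (conv m (ℕₚ.m≤n⊔m N₁ N₂)) k 0<k))
      , (λ ε 0<ε →
        let h = ½ * ε
            0<h = 0<½* 0<ε
            k = ½ * h
            0<k = 0<½* 0<h
            N₁ , near = expSum-near x 0<h
            N₂ , conv = c k 0<k
            m = N₁ ℕ.⊔ N₂
        in ev-zip (λ n a b → ≤-½ {seq y n} {expTo (seq x n) n} {ε} (≤-+-trans {seq y n} {seq (expSum x m) n} {expTo (seq x n) n} (≤-½ {seq y n} {seq (expSum x m) n} {h} (subst (seq y n ≤_) (ℚₚ.+-assoc (seq (expSum x m) n) k k) b)) (∣-∣≤⇒≤ {seq (expSum x m) n} a)))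
          (near m (ℕₚ.m≤m⊔n N₁ N₂)) (proj₂ (conv m (ℕₚ.m≤n⊔m N₁ N₂)) k 0<k))

-- The ordered semiring of reals, monotonicity of exp, and logarithms.

module ExpLog where

  open import Algebra.Bundles using (CommutativeSemiring)
  open import Algebra.Structures.Biased using (isCommutativeSemiringˡ; isCommutativeMonoidˡ)
  import Algebra.Solver.Ring.NaturalCoefficients.Default
  open import Data.Nat.Base as ℕ using (ℕ; zero; suc)
  import Data.Nat.Properties as ℕₚ
  open import Data.Product.Base using (∃-syntax; _×_; _,_; proj₁; proj₂)
  open import Data.Sum.Base using (_⊎_; inj₁; inj₂)
  open import Data.Rational.Base using (ℚ; 0ℚ; 1ℚ; _+_; _*_; _≤_; _<_; positive)
  import Data.Rational.Properties as ℚₚ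
  open import Data.Rational.Solver using (module +-*-Solver)
  open import Relation.Binary.Bundles using (Poset)
  open import Relation.Binary.Structures using (IsEquivalence)
  open import Relation.Binary.PropositionalEquality using (_≡_; refl; sym; trans; cong; subst)
  open import Relation.Nullary using (contradiction)

  open Sieve using (n<2^n)
  open Rationals
  open Reals

  ≈-refl : ∀ {x} → x ≈ x
  ≈-refl = ⩽-refl , ⩽-refl

  ≈-sym : ∀ {x y} → x ≈ y → y ≈ x
  ≈-sym (p , q) = q , p

  ≈-trans : ∀ {x y z} → x ≈ y → y ≈ z → x ≈ z
  ≈-trans (p , q) (p′ , q′) = ⩽-trans p p′ , ⩽-trans q′ q

  ≡⇒≈ℝ : ∀ {x y} → x ≡ y → x ≈ y
  ≡⇒≈ℝ refl = ≈-refl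

  ≈-isEquivalence : IsEquivalence _≈_
  ≈-isEquivalence = record { refl = ≈-refl ; sym = ≈-sym ; trans = ≈-trans }

  ⊕-cong : ∀ {x y z w} → x ≈ y → z ≈ w → x ⊕ z ≈ y ⊕ w
  ⊕-cong (p , q) (p′ , q′) = ⊕-mono p p′ , ⊕-mono q q′

  ⊗-congʳ : ∀ {x x′} y → x ≈ x′ → x ⊗ y ≈ x′ ⊗ y
  ⊗-congʳ y eq = ⊗-congʳ-⩽ y eq , ⊗-congʳ-⩽ y (≈-sym eq)

  ⊗-cong : ∀ {x y z w} → x ≈ y → z ≈ w → x ⊗ z ≈ y ⊗ w
  ⊗-cong {x} {y} {z} {w} p q = ≈-trans (⊗-congʳ z p)
    (≈-trans (⊗-comm y z) (≈-trans (⊗-congʳ y q) (⊗-comm w y)))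

  ℝ-poset : Poset _ _ _
  ℝ-poset = record
    { Carrier = ℝ ; _≈_ = _≈_ ; _≤_ = _⩽_
    ; isPartialOrder = record
      { isPreorder = record { isEquivalence = ≈-isEquivalence ; reflexive = proj₁ ; trans = ⩽-trans }
      ; antisym = _,_ }
    }

  open import Relation.Binary.Reasoning.PartialOrder ℝ-poset

  commutativeSemiring : CommutativeSemiring _ _
  commutativeSemiring = record
    { Carrier = ℝ ; _≈_ = _≈_ ; _+_ = _⊕_ ; _*_ = _⊗_ ; 0# = κ 0ℚ ; 1# = κ 1ℚ
    ; isCommutativeSemiring = isCommutativeSemiringˡ (record
      { +-isCommutativeMonoid = isCommutativeMonoidˡ (record
        { isSemigroup = record
          { isMagma = record { isEquivalence = ≈-isEquivalence ; ∙-cong = ⊕-cong } ; assoc = ⊕-assoc }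
        ; identityˡ = ⊕-identityˡ ; comm = ⊕-comm })
      ; *-isCommutativeMonoid = isCommutativeMonoidˡ (record
        { isSemigroup = record
          { isMagma = record { isEquivalence = ≈-isEquivalence ; ∙-cong = ⊗-cong } ; assoc = ⊗-assoc }
        ; identityˡ = ⊗-identityˡ ; comm = ⊗-comm })
      ; distribʳ = λ x y z → ≈-trans (⊗-comm (y ⊕ z) x) (≈-trans (⊗-distribˡ-⊕ x y z) (⊕-cong (⊗-comm x y) (⊗-comm x z)))
      ; zeroˡ = ⊗-zeroˡ })
    }

  module ℝ-Solver = Algebra.Solver.Ring.NaturalCoefficients.Default commutativeSemiring

  ⊕-identityʳ : ∀ x → x ⊕ κ 0ℚ ≈ x
  ⊕-identityʳ x = ≈-trans (⊕-comm x (κ 0ℚ)) (⊕-identityˡ x)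

  ⊗-identityʳ : ∀ x → x ⊗ κ 1ℚ ≈ x
  ⊗-identityʳ x = ≈-trans (⊗-comm x (κ 1ℚ)) (⊗-identityˡ x)

  ⊗-monoʳ : ∀ {x y} z → κ 0ℚ ⩽ z → x ⩽ y → x ⊗ z ⩽ y ⊗ z
  ⊗-monoʳ {x} {y} z 0⩽z x⩽y = begin
    x ⊗ z    ≈⟨ ⊗-comm x z ⟩
    z ⊗ x    ≤⟨ ⊗-monoˡ z 0⩽z x⩽y ⟩
    z ⊗ y    ≈⟨ ⊗-comm z y ⟩
    y ⊗ z    ∎

  ⊗-mono : ∀ {x y z w} → κ 0ℚ ⩽ z → κ 0ℚ ⩽ y → x ⩽ y → z ⩽ w → x ⊗ z ⩽ y ⊗ w
  ⊗-mono {x} {y} {z} 0⩽z 0⩽y p q = ⩽-trans (⊗-monoʳ z 0⩽z p) (⊗-monoˡ y 0⩽y q)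

  0≺1 : κ 0ℚ ≺ κ 1ℚ
  0≺1 = κ-mono-< (ℚₚ.positive⁻¹ 1ℚ)

  0⩽1 : κ 0ℚ ⩽ κ 1ℚ
  0⩽1 = ≺⇒⩽ 0≺1

  x⩽x⊕y : ∀ x {y} → κ 0ℚ ⩽ y → x ⩽ x ⊕ y
  x⩽x⊕y x {y} 0⩽y = begin
    x             ≈⟨ ⊕-identityʳ x ⟨
    x ⊕ κ 0ℚ      ≤⟨ ⊕-mono ⩽-refl 0⩽y ⟩
    x ⊕ y         ∎

  x⊕[y⊖x]≈y : ∀ x y → x ⊕ (y ⊕ ⊖ x) ≈ y
  x⊕[y⊖x]≈y x y = begin-equality
    x ⊕ (y ⊕ ⊖ x)     ≈⟨ lem x y (⊖ x) ⟩
    y ⊕ (x ⊕ ⊖ x)     ≈⟨ ⊕-cong ≈-refl (⊖-inverseʳ x) ⟩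
    y ⊕ κ 0ℚ          ≈⟨ ⊕-identityʳ y ⟩
    y                 ∎
    where
    open ℝ-Solver
    lem : ∀ x y z → x ⊕ (y ⊕ z) ≈ y ⊕ (x ⊕ z)
    lem = solve 3 (λ x y z → x :+ (y :+ z) := y :+ (x :+ z)) ≈-refl

  0⩽y⊖x : ∀ {x y} → x ⩽ y → κ 0ℚ ⩽ y ⊕ ⊖ x
  0⩽y⊖x {x} {y} x⩽y = begin
    κ 0ℚ        ≈⟨ ⊖-inverseʳ x ⟨
    x ⊕ ⊖ x     ≤⟨ ⊕-mono x⩽y ⩽-refl ⟩
    y ⊕ ⊖ x     ∎

  ⊕-cancelʳ : ∀ {x y} z → x ⊕ z ⩽ y ⊕ z → x ⩽ y
  ⊕-cancelʳ {x} {y} z le = begin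
    x                    ≈⟨ undo x ⟨
    (x ⊕ z) ⊕ ⊖ z        ≤⟨ ⊕-mono le ⩽-refl ⟩
    (y ⊕ z) ⊕ ⊖ z        ≈⟨ undo y ⟩
    y                    ∎
    where
    undo : ∀ x → (x ⊕ z) ⊕ ⊖ z ≈ x
    undo x = ≈-trans (⊕-assoc x z (⊖ z)) (≈-trans (⊕-cong ≈-refl (⊖-inverseʳ z)) (⊕-identityʳ x))

  ⊗-monoˡ-≺ : ∀ {x y} z → κ 0ℚ ≺ z → x ≺ y → z ⊗ x ≺ z ⊗ y
  ⊗-monoˡ-≺ {x} {y} z 0≺z x≺y = ≺-⩽-trans (0≺⇒≺⊕ (z ⊗ x) (⊗-pos 0≺z (≺-sub x≺y))) (begin
    z ⊗ x ⊕ z ⊗ (y ⊕ ⊖ x)     ≈⟨ ⊗-distribˡ-⊕ z x (y ⊕ ⊖ x) ⟨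
    z ⊗ (x ⊕ (y ⊕ ⊖ x))       ≈⟨ ⊗-cong ≈-refl (x⊕[y⊖x]≈y x y) ⟩
    z ⊗ y                     ∎)

  ⊗-cancelˡ : ∀ {x y} z → κ 0ℚ ≺ z → z ⊗ x ⩽ z ⊗ y → x ⩽ y
  ⊗-cancelˡ z 0≺z le = ⊀⇒⩾ λ y≺x → ≺-irrefl (≺-⩽-trans (⊗-monoˡ-≺ z 0≺z y≺x) le)

  ν-+ : ∀ m n → ν (m ℕ.+ n) ≈ ν m ⊕ ν n
  ν-+ m n = ≈-trans (≡⇒≈ℝ (cong κ (ι-+ m n))) (κ-+ (ι m) (ι n))

  ν-* : ∀ m n → ν (m ℕ.* n) ≈ ν m ⊗ ν n
  ν-* m n = ≈-trans (≡⇒≈ℝ (cong κ (ι-* m n))) (κ-* (ι m) (ι n))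

  ν-1 : ν 1 ≈ κ 1ℚ
  ν-1 = ≡⇒≈ℝ (cong κ ι-1)

  ν-mono : ∀ {m n} → m ℕ.≤ n → ν m ⩽ ν n
  ν-mono m≤n = κ-mono (ι-mono m≤n)

  ν-cancel : ∀ {m n} → ν m ⩽ ν n → m ℕ.≤ n
  ν-cancel le = ι-cancel (κ-cancel le)

  0⩽ν : ∀ n → κ 0ℚ ⩽ ν n
  0⩽ν n = κ-mono (0≤ι n)

  1⩽ν : ∀ {n} → 1 ℕ.≤ n → κ 1ℚ ⩽ ν n
  1⩽ν 1≤n = ⩽-trans (proj₂ ν-1) (ν-mono 1≤n)

  0≺ν : ∀ {n} → 1 ℕ.≤ n → κ 0ℚ ≺ ν n
  0≺ν 1≤n = ≺-⩽-trans 0≺1 (1⩽ν 1≤n)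

  ι*-mono-< : ∀ ε → 0ℚ < ε → ∀ j → ι j * ε < ι (suc j) * ε
  ι*-mono-< ε 0<ε j = ℚₚ.*-monoˡ-<-pos ε {{positive 0<ε}}
    (subst (ι j <_) (sym (ι-+ 1 j)) (subst (_< ι 1 + ι j) (ℚₚ.+-identityˡ (ι j)) (ℚₚ.+-monoˡ-< (ι j) (0<ι 0))))

  exp-cong : ∀ {x y} → x ≈ y → exp x ≈ exp y
  exp-cong eq = exp-cong-⩽ eq , exp-cong-⩽ (≈-sym eq)

  exp-0 : exp (κ 0ℚ) ≈ κ 1ℚ
  exp-0 = subst (exp (κ 0ℚ) ⩽_) (cong κ (trans (cong (λ t → 1ℚ + t) (ℚₚ.*-zeroˡ (ι C))) (ℚₚ.+-identityʳ 1ℚ)))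
            (proj₂ exp⩽1⊕ ℚₚ.≤-refl (ℚₚ.nonNegative⁻¹ 1ℚ))
        , ⩽-trans (x⩽x⊕y (κ 1ℚ) ⩽-refl) (1⊕⩽exp ⩽-refl)
    where C = proj₁ exp⩽1⊕

  1⩽exp : ∀ {x} → κ 0ℚ ⩽ x → κ 1ℚ ⩽ exp x
  1⩽exp 0⩽x = ⩽-trans (x⩽x⊕y (κ 1ℚ) 0⩽x) (1⊕⩽exp 0⩽x)

  x⩽exp : ∀ {x} → κ 0ℚ ⩽ x → x ⩽ exp x
  x⩽exp {x} 0⩽x = begin
    x              ≈⟨ ⊕-identityˡ x ⟨
    κ 0ℚ ⊕ x       ≤⟨ ⊕-mono 0⩽1 ⩽-refl ⟩
    κ 1ℚ ⊕ x       ≤⟨ 1⊕⩽exp 0⩽x ⟩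
    exp x          ∎

  -- With `z ≤ M`, the inequality `x < 1 / (M + 1)` would give `z * x < 1`. So `cotransitive`,
  -- applied to `0 < 1 / (M + 1)`, has to answer `0 ≺ x`, with the explicit gap that `≺` demands.
  positive-factor : ∀ {x} z → κ 0ℚ ⩽ z → κ 1ℚ ⩽ z ⊗ x → κ 0ℚ ≺ x
  positive-factor {x} z 0⩽z 1⩽zx = decide (cotransitive (κ-mono-< (0<recip M)) x)
    where
    M : ℕ
    M = proj₁ (archimedeanℝ z)
    decide : κ 0ℚ ≺ x ⊎ x ≺ κ (recip M) → κ 0ℚ ≺ x
    decide (inj₁ 0≺x) = 0≺x
    decide (inj₂ small) = contradiction (⩽-≺-trans (begin
        κ 1ℚ                      ≤⟨ 1⩽zx ⟩
        z ⊗ x                     ≤⟨ ⊗-monoˡ z 0⩽z (≺⇒⩽ small) ⟩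
        z ⊗ κ (recip M)           ≤⟨ ⊗-monoʳ _ (≺⇒⩽ (κ-mono-< (0<recip M))) (proj₂ (archimedeanℝ z)) ⟩
        ν M ⊗ κ (recip M)         ≈⟨ κ-* (ι M) (recip M) ⟨
        κ (ι M * recip M)         ∎)
      (≺-⩽-trans (κ-mono-< (ι*-mono-< (recip M) (0<recip M) M)) (proj₁ (≡⇒≈ℝ (cong κ (ι*recip M)))))) ≺-irrefl

  -- For n ≥ - x we have exp n * exp x ≥ 1.
  0≺exp : ∀ x → κ 0ℚ ≺ exp x
  0≺exp x = positive-factor (exp (ν n)) (⩽-trans 0⩽1 (1⩽exp (0⩽ν n))) (begin
    κ 1ℚ                    ≤⟨ 1⩽exp (begin
      κ 0ℚ                    ≈⟨ ⊖-inverseʳ x ⟨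
      x ⊕ ⊖ x                 ≤⟨ ⊕-mono ⩽-refl (proj₂ (archimedeanℝ (⊖ x))) ⟩
      x ⊕ ν n                 ≈⟨ ⊕-comm x (ν n) ⟩
      ν n ⊕ x                 ∎) ⟩
    exp (ν n ⊕ x)           ≈⟨ exp-⊕ (ν n) x ⟩
    exp (ν n) ⊗ exp x       ∎)
    where n = proj₁ (archimedeanℝ (⊖ x))

  0⩽exp : ∀ x → κ 0ℚ ⩽ exp x
  0⩽exp x = ≺⇒⩽ (0≺exp x)

  exp-difference : ∀ x y → exp x ⊗ exp (y ⊕ ⊖ x) ≈ exp y
  exp-difference x y = ≈-trans (≈-sym (exp-⊕ x (y ⊕ ⊖ x))) (exp-cong (x⊕[y⊖x]≈y x y))

  exp-mono : ∀ {x y} → x ⩽ y → exp x ⩽ exp y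
  exp-mono {x} {y} x⩽y = begin
    exp x                       ≈⟨ ⊗-identityʳ (exp x) ⟨
    exp x ⊗ κ 1ℚ                ≤⟨ ⊗-monoˡ (exp x) (0⩽exp x) (1⩽exp (0⩽y⊖x x⩽y)) ⟩
    exp x ⊗ exp (y ⊕ ⊖ x)       ≈⟨ exp-difference x y ⟩
    exp y                       ∎

  exp-mono-≺ : ∀ {x y} → x ≺ y → exp x ≺ exp y
  exp-mono-≺ {x} {y} x≺y = ⩽-≺-trans (proj₂ (⊗-identityʳ (exp x)))
    (≺-⩽-trans (⊗-monoˡ-≺ (exp x) (0≺exp x) (≺-⩽-trans (0≺⇒≺⊕ (κ 1ℚ) (≺-sub x≺y)) (1⊕⩽exp (≺⇒⩽ (≺-sub x≺y)))))
      (proj₁ (exp-difference x y)))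

  exp-cancel : ∀ {x y} → exp x ⩽ exp y → x ⩽ y
  exp-cancel le = ⊀⇒⩾ λ y≺x → ≺-irrefl (≺-⩽-trans (exp-mono-≺ y≺x) le)

  -- Comparison with one point is undecidable, but `cotransitive` chooses between `u (j + 1) < x`
  -- and `x < u (j + 2)`. These alternatives overlap, hence an interval of two steps.
  bracket : (u : ℕ → ℝ) → (∀ j → u j ≺ u (suc j)) → ∀ {x} n → u 0 ⩽ x → x ⩽ u n →
    ∃[ j ] (u j ⩽ x) × (x ⩽ u (2 ℕ.+ j))
  bracket u increasing {x} n u0⩽x x⩽un = search n 0 u0⩽x (subst (λ m → x ⩽ u m) (sym (ℕₚ.+-identityʳ n)) x⩽un)
    where
    search : ∀ n j → u j ⩽ x → x ⩽ u (n ℕ.+ j) → ∃[ j ] (u j ⩽ x) × (x ⩽ u (2 ℕ.+ j))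
    search zero    j uj⩽x x⩽ = j , uj⩽x , ⩽-trans x⩽ (≺⇒⩽ (≺-⩽-trans (increasing j) (≺⇒⩽ (increasing (suc j)))))
    search (suc n) j uj⩽x x⩽ with cotransitive (increasing (suc j)) x
    ... | inj₁ u≺x = search n (suc j) (≺⇒⩽ u≺x) (subst (λ m → x ⩽ u m) (sym (ℕₚ.+-suc n j)) x⩽)
    ... | inj₂ x≺u = j , uj⩽x , ≺⇒⩽ x≺u

  -- With `exp h ≤ 1 + h * C` and `y ≤ Y`, the excess over `y` is at most `Y * C * h`, which falls
  -- below every `ε`.
  ⩽-from-exp-factor : ∀ {x y} → κ 0ℚ ⩽ y →
    (∀ {δ} → 0ℚ < δ → ∃[ h ] 0ℚ ≤ h × h ≤ 1ℚ × h ≤ δ × (x ⩽ y ⊗ exp (κ h))) → x ⩽ y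
  ⩽-from-exp-factor {x} {y} 0⩽y factor = ⩽-closed λ {ε} 0<ε → approx ε (factor (0<shrink (Y ℕ.* C) 0<ε)) 0<ε
    where
    C Y : ℕ
    C = proj₁ exp⩽1⊕
    Y = proj₁ (archimedeanℝ y)
    approx : ∀ ε → (∃[ h ] 0ℚ ≤ h × h ≤ 1ℚ × h ≤ shrink (Y ℕ.* C) ε × (x ⩽ y ⊗ exp (κ h))) → 0ℚ < ε → x ⩽ y ⊕ κ ε
    approx ε (h , 0≤h , h≤1 , h≤ , x⩽) 0<ε = begin
      x                                  ≤⟨ x⩽ ⟩
      y ⊗ exp (κ h)                      ≤⟨ ⊗-monoˡ y 0⩽y (proj₂ exp⩽1⊕ 0≤h h≤1) ⟩
      y ⊗ κ (1ℚ + h * ι C)               ≈⟨ ⊗-cong ≈-refl (κ-+ 1ℚ (h * ι C)) ⟩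
      y ⊗ (κ 1ℚ ⊕ κ (h * ι C))           ≈⟨ ⊗-distribˡ-⊕ y (κ 1ℚ) (κ (h * ι C)) ⟩
      y ⊗ κ 1ℚ ⊕ y ⊗ κ (h * ι C)         ≤⟨ ⊕-mono (proj₁ (⊗-identityʳ y))
                                              (⊗-monoʳ _ (κ-mono (0≤* 0≤h (0≤ι C))) (proj₂ (archimedeanℝ y))) ⟩
      y ⊕ ν Y ⊗ κ (h * ι C)              ≈⟨ ⊕-cong ≈-refl (≈-sym (κ-* (ι Y) (h * ι C))) ⟩
      y ⊕ κ (ι Y * (h * ι C))            ≤⟨ ⊕-mono ⩽-refl (κ-mono (ℚₚ.≤-trans (ℚₚ.≤-reflexive eq)
                                              (ℚₚ.≤-trans (*-monoˡ (ι (Y ℕ.* C)) (0≤ι (Y ℕ.* C)) h≤) (ι*shrink≤ (Y ℕ.* C) 0<ε)))) ⟩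
      y ⊕ κ ε                            ∎
      where
      eq : ι Y * (h * ι C) ≡ ι (Y ℕ.* C) * h
      eq = trans (lem (ι Y) h (ι C)) (cong (_* h) (sym (ι-* Y C)))
        where
        open +-*-Solver
        lem : ∀ a h c → a * (h * c) ≡ a * c * h
        lem = solve 3 (λ a h c → a :* (h :* c) := a :* c :* h) refl

  2*recip-small : ∀ {ε} → 0ℚ < ε → ∃[ N ] ∀ n → N ℕ.≤ n → ι 2 * recip n ≤ ε
  2*recip-small {ε} 0<ε = N , λ n N≤n → *-cancel (ι (suc n)) (0<ι n) (ℚₚ.≤-trans (ℚₚ.≤-reflexive (eq n))
    (ℚₚ.≤-trans (proj₂ (archimedean′ 2 0<ε)) (*-monoʳ ε (ℚₚ.<⇒≤ 0<ε) (ι-mono (ℕ.s≤s N≤n)))))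
    where
    N = proj₁ (archimedean′ 2 0<ε)
    eq : ∀ n → ι (suc n) * (ι 2 * recip n) ≡ ι 2
    eq n = trans (lem (ι (suc n)) (ι 2) (recip n)) (trans (cong (ι 2 *_) (ι*recip n)) (ℚₚ.*-identityʳ (ι 2)))
      where
      open +-*-Solver
      lem : ∀ a b r → a * (b * r) ≡ b * (a * r)
      lem = solve 3 (λ a b r → a :* (b :* r) := b :* (a :* r)) refl

  module Logarithm (x : ℝ) (1⩽x : κ 1ℚ ⩽ x) where

    -- The multiples of `1 / (n + 1)` are the candidates for the logarithm at stage `n`; their
    -- exponentials are compared with `x`.
    grid : ℕ → ℕ → ℝ
    grid n j = exp (κ (ι j * recip n))

    grid-increasing : ∀ n j → grid n j ≺ grid n (suc j)
    grid-increasing n j = exp-mono-≺ (κ-mono-< (ι*-mono-< (recip n) (0<recip n) j))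

    located : ∀ n → ∃[ j ] (grid n j ⩽ x) × (x ⩽ grid n (2 ℕ.+ j))
    located n = bracket (grid n) (grid-increasing n) (suc top) (begin
        grid n 0                          ≈⟨ exp-cong (≡⇒≈ℝ (cong κ (trans (cong (_* recip n) ι-0) (ℚₚ.*-zeroˡ (recip n))))) ⟩
        exp (κ 0ℚ)                        ≈⟨ exp-0 ⟩
        κ 1ℚ                              ≤⟨ 1⩽x ⟩
        x                                 ∎)
      (begin
        x                                 ≤⟨ proj₂ (archimedeanℝ x) ⟩
        ν (proj₁ (archimedeanℝ x))        ≤⟨ κ-mono (proj₂ (archimedean′ (proj₁ (archimedeanℝ x)) (0<recip n))) ⟩
        κ (ι (suc top) * recip n)         ≤⟨ x⩽exp (κ-mono (0≤* (0≤ι (suc top)) (ℚₚ.<⇒≤ (0<recip n)))) ⟩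
        grid n (suc top)                  ∎)
      -- By `exp t ≥ t`, the grid reaches beyond `x` once `(top + 1) / (n + 1)` is at least a
      -- natural upper bound of `x`.
      where top = proj₁ (archimedean′ (proj₁ (archimedeanℝ x)) (0<recip n))

    lower width : ℕ → ℚ
    lower n = ι (proj₁ (located n)) * recip n
    width n = ι 2 * recip n

    lower⩽ : ∀ n → exp (κ (lower n)) ⩽ x
    lower⩽ n = proj₁ (proj₂ (located n))

    ⩽upper : ∀ n → x ⩽ exp (κ (lower n + width n))
    ⩽upper n = subst (λ q → x ⩽ exp (κ q)) eq (proj₂ (proj₂ (located n)))
      where
      j = proj₁ (located n)
      eq : ι (2 ℕ.+ j) * recip n ≡ lower n + width n
      eq = trans (cong (_* recip n) (ι-+ 2 j)) (trans (ℚₚ.*-distribʳ-+ (recip n) (ι 2) (ι j)) (ℚₚ.+-comm _ (lower n)))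

    0≤width : ∀ n → 0ℚ ≤ width n
    0≤width n = 0≤* (0≤ι 2) (ℚₚ.<⇒≤ (0<recip n))

    width-small : ∀ {ε} → 0ℚ < ε → Eventually (λ n → width n ≤ ε)
    width-small = 2*recip-small

    -- No lower end exceeds any upper end: `x` lies between their exponentials, and `exp` reflects
    -- the order.
    lim = limit lower width (λ m n → κ-cancel (exp-cancel (⩽-trans (lower⩽ m) (⩽upper n)))) width-small

    log : ℝ
    log = proj₁ lim

    fine : ∀ {p q} → (∀ n → p ⩽ q ⊗ exp (κ (width n))) →
      ∀ {δ} → 0ℚ < δ → ∃[ h ] 0ℚ ≤ h × h ≤ 1ℚ × h ≤ δ × (p ⩽ q ⊗ exp (κ h))
    fine h 0<δ = let N , small = ev-zip (λ n a b → a , b) (width-small (ℚₚ.positive⁻¹ 1ℚ)) (width-small 0<δ)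
                     ≤1 , ≤δ = small N ℕₚ.≤-refl
                 in width N , 0≤width N , ≤1 , ≤δ , h N

    -- At every stage `n` each side is at most the other times `exp (width n)`, a factor that tends
    -- to 1.
    exp-log : exp log ≈ x
    exp-log = ⩽-from-exp-factor (⩽-trans 0⩽1 1⩽x) (fine λ n → begin
        exp log                                    ≤⟨ exp-mono (proj₂ (proj₂ lim n)) ⟩
        exp (κ (lower n + width n))                ≈⟨ exp-cong (κ-+ (lower n) (width n)) ⟩
        exp (κ (lower n) ⊕ κ (width n))            ≈⟨ exp-⊕ _ _ ⟩
        exp (κ (lower n)) ⊗ exp (κ (width n))      ≤⟨ ⊗-monoʳ _ (0⩽exp _) (lower⩽ n) ⟩
        x ⊗ exp (κ (width n))                      ∎)
      , ⩽-from-exp-factor (0⩽exp log) (fine λ n → begin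
        x                                          ≤⟨ ⩽upper n ⟩
        exp (κ (lower n + width n))                ≈⟨ exp-cong (κ-+ (lower n) (width n)) ⟩
        exp (κ (lower n) ⊕ κ (width n))            ≈⟨ exp-⊕ _ _ ⟩
        exp (κ (lower n)) ⊗ exp (κ (width n))      ≤⟨ ⊗-monoʳ _ (0⩽exp _) (exp-mono (proj₁ (proj₂ lim n))) ⟩
        exp log ⊗ exp (κ (width n))                ∎)

  abstract
    log-exists : ∀ {x} → κ 1ℚ ⩽ x → ∃[ l ] exp l ≈ x
    log-exists {x} 1⩽x = Logarithm.log x 1⩽x , Logarithm.exp-log x 1⩽x

  0⩽log : ∀ {x l} → κ 1ℚ ⩽ x → exp l ≈ x → κ 0ℚ ⩽ l
  0⩽log 1⩽x eq = exp-cancel (⩽-trans (proj₁ exp-0) (⩽-trans 1⩽x (proj₂ eq)))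

  -- The reciprocal is `exp (- log x)`. It is taken of `α` and of the denominator of the bound, both
  -- at least 1.
  inverse-exists : ∀ {x} → κ 1ℚ ⩽ x → ∃[ i ] κ 0ℚ ⩽ i × i ⊗ x ≈ κ 1ℚ
  inverse-exists {x} 1⩽x = exp (⊖ l) , 0⩽exp (⊖ l) , (begin-equality
    exp (⊖ l) ⊗ x             ≈⟨ ⊗-cong ≈-refl (proj₂ (log-exists 1⩽x)) ⟨
    exp (⊖ l) ⊗ exp l         ≈⟨ exp-⊕ (⊖ l) l ⟨
    exp (⊖ l ⊕ l)             ≈⟨ exp-cong (≈-trans (⊕-comm (⊖ l) l) (⊖-inverseʳ l)) ⟩
    exp (κ 0ℚ)                ≈⟨ exp-0 ⟩
    κ 1ℚ                      ∎)
    where l = proj₁ (log-exists 1⩽x)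

  abstract
    ln2 : ℝ
    ln2 = proj₁ (log-exists (1⩽ν {2} (ℕ.s≤s ℕ.z≤n)))

    exp-ln2 : exp ln2 ≈ ν 2
    exp-ln2 = proj₂ (log-exists (1⩽ν {2} (ℕ.s≤s ℕ.z≤n)))

  0⩽ln2 : κ 0ℚ ⩽ ln2
  0⩽ln2 = 0⩽log (1⩽ν (ℕ.s≤s ℕ.z≤n)) exp-ln2

  exp-ν⊗ln2 : ∀ n → exp (ν n ⊗ ln2) ≈ ν (2 ℕ.^ n)
  exp-ν⊗ln2 zero    = begin-equality
    exp (ν 0 ⊗ ln2)             ≈⟨ exp-cong (≈-trans (⊗-cong (≡⇒≈ℝ (cong κ ι-0)) ≈-refl) (⊗-zeroˡ ln2)) ⟩
    exp (κ 0ℚ)                  ≈⟨ exp-0 ⟩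
    κ 1ℚ                        ≈⟨ ν-1 ⟨
    ν 1                         ∎
  exp-ν⊗ln2 (suc n) = begin-equality
    exp (ν (suc n) ⊗ ln2)       ≈⟨ exp-cong (≈-trans (⊗-cong (≈-trans (ν-+ 1 n) (⊕-cong ν-1 ≈-refl)) ≈-refl) (lem (ν n) ln2)) ⟩
    exp (ln2 ⊕ ν n ⊗ ln2)       ≈⟨ exp-⊕ ln2 (ν n ⊗ ln2) ⟩
    exp ln2 ⊗ exp (ν n ⊗ ln2)   ≈⟨ ⊗-cong exp-ln2 (exp-ν⊗ln2 n) ⟩
    ν 2 ⊗ ν (2 ℕ.^ n)           ≈⟨ ν-* 2 (2 ℕ.^ n) ⟨
    ν (2 ℕ.^ suc n)             ∎
    where
    open ℝ-Solver
    lem : ∀ n l → (κ 1ℚ ⊕ n) ⊗ l ≈ l ⊕ n ⊗ l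
    lem = solve 2 (λ n l → (con 1 :+ n) :* l := l :+ n :* l) ≈-refl

  -- From `2 ^ a ≥ a ≥ e` follows `a * ln 2 ≥ 1`.
  1/ln2-bound : ∃[ a ] κ 1ℚ ⩽ ν a ⊗ ln2
  1/ln2-bound = a , exp-cancel (begin
    exp (κ 1ℚ)                  ≤⟨ proj₂ (archimedeanℝ (exp (κ 1ℚ))) ⟩
    ν a                         ≤⟨ ν-mono (ℕₚ.<⇒≤ (n<2^n a)) ⟩
    ν (2 ℕ.^ a)                 ≈⟨ exp-ν⊗ln2 a ⟨
    exp (ν a ⊗ ln2)             ∎)
    where a = proj₁ (archimedeanℝ (exp (κ 1ℚ)))

-- Rational approximation of 1 / α, and comparison of `bertrand` with iterated logarithms.

module Growth where

  open import Data.Nat.Base as ℕ using (ℕ; zero; suc)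
  import Data.Nat.Properties as ℕₚ
  open import Data.Nat.DivMod using (m*n/n≡m; /-monoˡ-≤; m/n*n≤m; m≡m%n+[m/n]*n; m%n<n)
  open import Data.Nat.Solver using () renaming (module +-*-Solver to ℕ-Solver)
  open import Data.Product.Base using (∃-syntax; _×_; _,_; proj₁; proj₂)
  open import Data.Rational.Base using (0ℚ; 1ℚ; _+_; _*_; _≤_; _<_)
  import Data.Rational.Properties as ℚₚ
  open import Relation.Binary.PropositionalEquality using (_≡_; refl; sym; trans; cong; cong₂; subst; subst₂)
  open import Relation.Nullary using (contradiction)

  open Sieve using (n<2^n; lg; 2^lg≤; 2^≤⇒≤lg; bertrand; module PrimeBlocks)
  open Rationals
  open Reals
  open ExpLog
  open import Relation.Binary.Reasoning.PartialOrder ℝ-poset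

  ν≡ : ∀ n → ν n ≡ fromℕ n
  ν≡ n = trans (κ≡ (ι n)) (cong fromℚ (ι≡ n))

  *ℝ≈⊗ : ∀ x y → (x *ℝ y) ≈ x ⊗ y
  *ℝ≈⊗ x y = ≡⇒≈ℝ (sym (⊗≡ x y))

  ≈⇒≃ : ∀ {x y} → x ≈ y → x ≃ℝ y
  ≈⇒≃ (p , q) = ⩽-from p , ⩽-from q

  ≃⇒≈ : ∀ {x y} → x ≃ℝ y → x ≈ y
  ≃⇒≈ (p , q) = ⩽-to p , ⩽-to q

  1ℝ≈1 : 1ℝ ≈ κ 1ℚ
  1ℝ≈1 = ≡⇒≈ℝ (sym (κ≡ 1ℚ))

  0<⇒0≺ : ∀ {x} → 0ℝ <ℝ x → κ 0ℚ ≺ x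
  0<⇒0≺ {x} p = subst (_≺ x) (sym (κ≡ 0ℚ)) (≺-to p)

  0≺⇒0< : ∀ {x} → κ 0ℚ ≺ x → 0ℝ <ℝ x
  0≺⇒0< {x} p = ≺-from (subst (_≺ x) (κ≡ 0ℚ) p)

  0≺ln2 : κ 0ℚ ≺ ln2
  0≺ln2 = positive-factor (ν (proj₁ 1/ln2-bound)) (0⩽ν _) (proj₂ 1/ln2-bound)

  exp-cancel-ln2 : ∀ {m y} → ν (2 ℕ.^ m) ⩽ exp y → ν m ⊗ ln2 ⩽ y
  exp-cancel-ln2 {m} le = exp-cancel (⩽-trans (proj₁ (exp-ν⊗ln2 m)) le)

  -- Approximation of e / α by natural numbers φ e

  module Exponents (α : ℝ) (1⩽α : κ 1ℚ ⩽ α) where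

    0⩽α : κ 0ℚ ⩽ α
    0⩽α = ⩽-trans 0⩽1 1⩽α

    0≺α : κ 0ℚ ≺ α
    0≺α = ≺-⩽-trans 0≺1 1⩽α

    x⩽α⊗x : ∀ {x} → κ 0ℚ ⩽ x → x ⩽ α ⊗ x
    x⩽α⊗x {x} 0⩽x = begin
      x            ≈⟨ ⊗-identityˡ x ⟨
      κ 1ℚ ⊗ x     ≤⟨ ⊗-monoʳ x 0⩽x 1⩽α ⟩
      α ⊗ x        ∎

    Approximates : ℕ → (ℕ → ℕ) → Set
    Approximates I φ = (∀ e → α ⊗ ν (φ e) ⩽ ν e) × (∀ e → e ℕ.≤ I → ν e ⩽ α ⊗ ν (φ e ℕ.+ 3))

    module _ (I : ℕ) where

      private
        c = suc I

      -- Approximation of `1 / α` with denominator `c = I + 1`: `a / c ≤ 1 / α ≤ (a + 2) / c`,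
      -- within the two steps of `bracket`.
      slope : ∃[ a ] (α ⊗ ν a ⩽ ν c) × (ν c ⩽ α ⊗ ν (2 ℕ.+ a))
      slope = bracket (λ a → α ⊗ ν a) (λ a → ⊗-monoˡ-≺ α 0≺α (κ-mono-< (ι-mono-< a))) c
        (begin
          α ⊗ ν 0         ≈⟨ ⊗-cong ≈-refl (≡⇒≈ℝ (cong κ ι-0)) ⟩
          α ⊗ κ 0ℚ        ≈⟨ ≈-trans (⊗-comm α (κ 0ℚ)) (⊗-zeroˡ α) ⟩
          κ 0ℚ            ≤⟨ 0⩽ν c ⟩
          ν c             ∎)
        (x⩽α⊗x (0⩽ν c))
        where
        ι-mono-< : ∀ a → ι a < ι (suc a)
        ι-mono-< a = subst₂ _<_ (ℚₚ.*-identityʳ (ι a)) (ℚₚ.*-identityʳ (ι (suc a))) (ι*-mono-< 1ℚ (ℚₚ.positive⁻¹ 1ℚ) a)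

      private
        a = proj₁ slope

      -- The rational slope makes the integer part computable, and the integer part of a linear
      -- function is superadditive.
      φ : ℕ → ℕ
      φ e = (e ℕ.* a) ℕ./ c

      φ-superadditive : ∀ x y → φ x ℕ.+ φ y ℕ.≤ φ (x ℕ.+ y)
      φ-superadditive x y = ℕₚ.≤-trans (ℕₚ.≤-reflexive (sym (m*n/n≡m (φ x ℕ.+ φ y) c))) (/-monoˡ-≤ c
        (ℕₚ.≤-trans (ℕₚ.≤-reflexive (ℕₚ.*-distribʳ-+ c (φ x) (φ y)))
        (ℕₚ.≤-trans (ℕₚ.+-mono-≤ (m/n*n≤m (x ℕ.* a) c) (m/n*n≤m (y ℕ.* a) c))
          (ℕₚ.≤-reflexive (sym (ℕₚ.*-distribʳ-+ a x y))))))

      φ-approximates : Approximates I φ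
      φ-approximates = below , above
        where
        0≺c : κ 0ℚ ≺ ν c
        0≺c = 0≺ν {c} (ℕ.s≤s ℕ.z≤n)
        below : ∀ e → α ⊗ ν (φ e) ⩽ ν e
        below e = ⊗-cancelˡ (ν c) 0≺c (begin
          ν c ⊗ (α ⊗ ν (φ e))           ≈⟨ rearrange (ν c) α (ν (φ e)) ⟩
          α ⊗ (ν (φ e) ⊗ ν c)           ≈⟨ ⊗-cong ≈-refl (≈-sym (ν-* (φ e) c)) ⟩
          α ⊗ ν (φ e ℕ.* c)             ≤⟨ ⊗-monoˡ α 0⩽α (ν-mono (m/n*n≤m (e ℕ.* a) c)) ⟩
          α ⊗ ν (e ℕ.* a)               ≈⟨ ⊗-cong ≈-refl (ν-* e a) ⟩
          α ⊗ (ν e ⊗ ν a)               ≈⟨ rearrange α (ν e) (ν a) ⟩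
          ν e ⊗ (ν a ⊗ α)               ≤⟨ ⊗-monoˡ (ν e) (0⩽ν e) (⩽-trans (proj₁ (⊗-comm (ν a) α)) (proj₁ (proj₂ slope))) ⟩
          ν e ⊗ ν c                     ≈⟨ ⊗-comm (ν e) (ν c) ⟩
          ν c ⊗ ν e                     ∎)
          where
          open ℝ-Solver
          rearrange : ∀ x y z → x ⊗ (y ⊗ z) ≈ y ⊗ (z ⊗ x)
          rearrange = solve 3 (λ x y z → x :* (y :* z) := y :* (z :* x)) ≈-refl
        -- Replacing `a` by `a + 2` raises `e * a / c` by `2 * e / c ≤ 2`, as `e ≤ I < c`; rounding
        -- down loses less than 1. Together this is the 3.
        natural : ∀ e → e ℕ.≤ I → e ℕ.* (2 ℕ.+ a) ℕ.≤ (φ e ℕ.+ 3) ℕ.* c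
        natural e e≤I = ℕₚ.≤-trans (ℕₚ.≤-reflexive (lem₁ e a)) (ℕₚ.≤-trans (ℕₚ.+-mono-≤
          (ℕₚ.≤-trans (ℕₚ.≤-reflexive (m≡m%n+[m/n]*n (e ℕ.* a) c)) (ℕₚ.+-monoˡ-≤ _ (ℕₚ.<⇒≤ (m%n<n (e ℕ.* a) c))))
          (ℕₚ.*-monoʳ-≤ 2 (ℕₚ.m≤n⇒m≤1+n e≤I))) (ℕₚ.≤-reflexive (lem₂ (φ e) c)))
          where
          open ℕ-Solver
          lem₁ : ∀ e a → e ℕ.* (2 ℕ.+ a) ≡ e ℕ.* a ℕ.+ 2 ℕ.* e
          lem₁ = solve 2 (λ e a → e :* (con 2 :+ a) := e :* a :+ con 2 :* e) refl
          lem₂ : ∀ f c → c ℕ.+ f ℕ.* c ℕ.+ 2 ℕ.* c ≡ (f ℕ.+ 3) ℕ.* c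
          lem₂ = solve 2 (λ f c → c :+ f :* c :+ con 2 :* c := (f :+ con 3) :* c) refl
        above : ∀ e → e ℕ.≤ I → ν e ⩽ α ⊗ ν (φ e ℕ.+ 3)
        above e e≤I = ⊗-cancelˡ (ν c) 0≺c (begin
          ν c ⊗ ν e                          ≈⟨ ⊗-comm (ν c) (ν e) ⟩
          ν e ⊗ ν c                          ≤⟨ ⊗-monoˡ (ν e) (0⩽ν e) (proj₂ (proj₂ slope)) ⟩
          ν e ⊗ (α ⊗ ν (2 ℕ.+ a))            ≈⟨ rearrange (ν e) α (ν (2 ℕ.+ a)) ⟩
          α ⊗ (ν e ⊗ ν (2 ℕ.+ a))            ≈⟨ ⊗-cong ≈-refl (≈-sym (ν-* e (2 ℕ.+ a))) ⟩
          α ⊗ ν (e ℕ.* (2 ℕ.+ a))            ≤⟨ ⊗-monoˡ α 0⩽α (ν-mono (natural e e≤I)) ⟩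
          α ⊗ ν ((φ e ℕ.+ 3) ℕ.* c)          ≈⟨ ⊗-cong ≈-refl (ν-* (φ e ℕ.+ 3) c) ⟩
          α ⊗ (ν (φ e ℕ.+ 3) ⊗ ν c)          ≈⟨ rearrange′ α (ν (φ e ℕ.+ 3)) (ν c) ⟩
          ν c ⊗ (α ⊗ ν (φ e ℕ.+ 3))          ∎)
          where
          open ℝ-Solver
          rearrange : ∀ x y z → x ⊗ (y ⊗ z) ≈ y ⊗ (x ⊗ z)
          rearrange = solve 3 (λ x y z → x :* (y :* z) := y :* (x :* z)) ≈-refl
          rearrange′ : ∀ x y z → x ⊗ (y ⊗ z) ≈ z ⊗ (x ⊗ y)
          rearrange′ = solve 3 (λ x y z → x :* (y :* z) := z :* (x :* y)) ≈-refl

    α-natural : ∃[ A ] 1 ℕ.≤ A × α ⩽ ν A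
    α-natural = suc (proj₁ (archimedeanℝ α)) , ℕ.s≤s ℕ.z≤n , ⩽-trans (proj₂ (archimedeanℝ α)) (ν-mono (ℕₚ.n≤1+n _))

    module _ {s : ℕ → ℕ} (s≥1 : ∀ i → 1 ℕ.≤ s i) (bigO : BigOPower α s) where

      private
        C = proj₁ bigO
        c₀ = proj₁ (archimedeanℝ C)

      -- Binary logarithms of `s i ≤ C * (i + 1) ^ α`, with `i + 1 ≤ 2 ^ (t + 1)` and `C ≤ 2 ^ c₀`,
      -- give the bound `α * (t + 1) + c₀`. As `α ≥ 1`, the constant may be multiplied by `α` as
      -- well, so that `α` cancels in `admissible`.
      lg-growth : ∀ t i → i ℕ.< 2 ℕ.^ suc t → ν (lg (s i)) ⩽ α ⊗ ν (suc t ℕ.+ c₀)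
      lg-growth t i i< = ⊗-cancelˡ ln2 0≺ln2 (begin
        ln2 ⊗ ν e                         ≈⟨ ⊗-comm ln2 (ν e) ⟩
        ν e ⊗ ln2                         ≤⟨ exp-cancel-ln2 {e} s≤ ⟩
        ν c₀ ⊗ ln2 ⊕ w                    ≤⟨ ⊕-mono (x⩽α⊗x (⊗-nonneg (0⩽ν c₀) 0⩽ln2)) ⩽-refl ⟩
        α ⊗ (ν c₀ ⊗ ln2) ⊕ w              ≈⟨ lem α (ν c₀) (ν (suc t)) ln2 ⟩
        ln2 ⊗ (α ⊗ (ν (suc t) ⊕ ν c₀))    ≈⟨ ⊗-cong ≈-refl (⊗-cong ≈-refl (≈-sym (ν-+ (suc t) c₀))) ⟩
        ln2 ⊗ (α ⊗ ν (suc t ℕ.+ c₀))      ∎)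
        where
        e = lg (s i)
        w = α ⊗ (ν (suc t) ⊗ ln2)
        y = proj₁ (proj₂ (proj₂ bigO) i)
        power = proj₁ (proj₂ (proj₂ (proj₂ bigO) i))
        bound = proj₂ (proj₂ (proj₂ (proj₂ bigO) i))
        l = proj₁ power
        l⩽ : l ⩽ ν (suc t) ⊗ ln2
        l⩽ = exp-cancel (begin
          exp l                           ≈⟨ Exp⇒exp (proj₁ (proj₂ power)) ⟩
          fromℕ (suc i)                   ≈⟨ ≡⇒≈ℝ (sym (ν≡ (suc i))) ⟩
          ν (suc i)                       ≤⟨ ν-mono i< ⟩
          ν (2 ℕ.^ suc t)                 ≈⟨ exp-ν⊗ln2 (suc t) ⟨
          exp (ν (suc t) ⊗ ln2)           ∎)
        y⩽ : y ⩽ exp w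
        y⩽ = begin
          y                               ≈⟨ Exp⇒exp (proj₂ (proj₂ power)) ⟨
          exp (α *ℝ l)                    ≈⟨ exp-cong (*ℝ≈⊗ α l) ⟩
          exp (α ⊗ l)                     ≤⟨ exp-mono (⊗-monoˡ α 0⩽α l⩽) ⟩
          exp w                           ∎
        0⩽y : κ 0ℚ ⩽ y
        0⩽y = ⩽-trans (0⩽exp (α *ℝ l)) (proj₁ (Exp⇒exp (proj₂ (proj₂ power))))
        s≤ : ν (2 ℕ.^ e) ⩽ exp (ν c₀ ⊗ ln2 ⊕ w)
        s≤ = begin
          ν (2 ℕ.^ e)                     ≤⟨ ν-mono (2^lg≤ (s i) (s≥1 i)) ⟩
          ν (s i)                         ≈⟨ ≡⇒≈ℝ (ν≡ (s i)) ⟩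
          fromℕ (s i)                     ≤⟨ ⩽-to bound ⟩
          C *ℝ y                          ≈⟨ *ℝ≈⊗ C y ⟩
          C ⊗ y                           ≤⟨ ⊗-mono 0⩽y (0⩽ν (2 ℕ.^ c₀)) (⩽-trans (proj₂ (archimedeanℝ C)) (ν-mono (ℕₚ.<⇒≤ (n<2^n c₀)))) y⩽ ⟩
          ν (2 ℕ.^ c₀) ⊗ exp w            ≈⟨ ⊗-cong (≈-sym (exp-ν⊗ln2 c₀)) ≈-refl ⟩
          exp (ν c₀ ⊗ ln2) ⊗ exp w        ≈⟨ exp-⊕ (ν c₀ ⊗ ln2) w ⟨
          exp (ν c₀ ⊗ ln2 ⊕ w)            ∎
        open ℝ-Solver
        lem : ∀ a c t l → a ⊗ (c ⊗ l) ⊕ a ⊗ (t ⊗ l) ≈ l ⊗ (a ⊗ (t ⊕ c))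
        lem = solve 4 (λ a c t l → a :* (c :* l) :+ a :* (t :* l) := l :* (a :* (t :+ c))) ≈-refl

      open PrimeBlocks s using (Admissible)

      admissible : ∀ I → ∃[ φ ] Approximates I φ × Admissible (proj₁ α-natural) (suc c₀) I φ
      admissible I = φ I , φ-approximates I , record
        { superadditive = φ-superadditive I
        ; lower = λ e e≤I → ν-cancel (begin
            ν e                             ≤⟨ proj₂ (φ-approximates I) e e≤I ⟩
            α ⊗ ν (φ I e ℕ.+ 3)             ≤⟨ ⊗-monoʳ _ (0⩽ν (φ I e ℕ.+ 3)) (proj₂ (proj₂ α-natural)) ⟩
            ν (proj₁ α-natural) ⊗ ν (φ I e ℕ.+ 3)  ≈⟨ ν-* (proj₁ α-natural) (φ I e ℕ.+ 3) ⟨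
            ν (proj₁ α-natural ℕ.* (φ I e ℕ.+ 3))  ∎)
        ; upper = λ t i i< → ℕₚ.≤-trans
            (ν-cancel (⊗-cancelˡ α 0≺α (⩽-trans (proj₁ (φ-approximates I) (lg (s i))) (lg-growth t i i<))))
            (ℕₚ.≤-reflexive (sym (ℕₚ.+-suc t c₀)))
        }

  -- Lower bounds for iterated logarithms by iterates of lg, up to the factor 2 ^ γ

  private
    a = proj₁ 1/ln2-bound

  -- Here `a ≥ 1 / ln 2`, and the 2 in `γ` pays for `h ≤ 2 * (h - γ)` in `log-step`. That inequality
  -- holds for `h ≥ Γ`, and `Γ ≥ 2 ^ γ` keeps the logarithms at least 1.
  γ Γ : ℕ
  γ = 2 ℕ.* a
  Γ = suc (2 ℕ.^ γ ℕ.+ 2 ℕ.* γ)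

  1⩽-from-multiple : ∀ {x g} → Γ ℕ.≤ g → ν g ⩽ ν (2 ℕ.^ γ) ⊗ x → κ 1ℚ ⩽ x
  1⩽-from-multiple {x} {g} Γ≤g le = ⊗-cancelˡ (ν (2 ℕ.^ γ)) (0≺ν (ℕₚ.m^n>0 2 γ)) (begin
    ν (2 ℕ.^ γ) ⊗ κ 1ℚ     ≈⟨ ⊗-identityʳ _ ⟩
    ν (2 ℕ.^ γ)            ≤⟨ ν-mono (ℕₚ.≤-trans (ℕₚ.m≤n⇒m≤1+n (ℕₚ.m≤m+n (2 ℕ.^ γ) (2 ℕ.* γ))) Γ≤g) ⟩
    ν g                    ≤⟨ le ⟩
    ν (2 ℕ.^ γ) ⊗ x        ∎)

  -- The factor `2 ^ γ` becomes a summand under the logarithm: with `h = lg g`,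
  -- `l ≥ (h - γ) * ln 2 ≥ h / γ`. Since `γ ≤ 2 ^ γ`, the same factor is restored, so the step can
  -- be iterated.
  log-step : ∀ {x l g} → exp l ≈ x → 1 ℕ.≤ g → ν g ⩽ ν (2 ℕ.^ γ) ⊗ x → Γ ℕ.≤ lg g →
    ν (lg g) ⩽ ν (2 ℕ.^ γ) ⊗ l
  log-step {x} {l} {g} exp-l 1≤g le Γ≤h = begin
    ν h                              ≤⟨ ν-mono h≤2h′ ⟩
    ν (2 ℕ.* h′)                     ≈⟨ ν-* 2 h′ ⟩
    ν 2 ⊗ ν h′                       ≤⟨ ⊗-monoˡ (ν 2) (0⩽ν 2) h′⩽ ⟩
    ν 2 ⊗ (ν a ⊗ l)                  ≈⟨ ⊗-assoc (ν 2) (ν a) l ⟨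
    ν 2 ⊗ ν a ⊗ l                    ≈⟨ ⊗-cong (≈-sym (ν-* 2 a)) ≈-refl ⟩
    ν γ ⊗ l                          ≤⟨ ⊗-monoʳ l 0⩽l (ν-mono (ℕₚ.<⇒≤ (n<2^n γ))) ⟩
    ν (2 ℕ.^ γ) ⊗ l                  ∎
    where
    h h′ : ℕ
    h = lg g
    h′ = h ℕ.∸ γ
    2γ≤h : γ ℕ.+ γ ℕ.≤ h
    2γ≤h = ℕₚ.≤-trans (ℕₚ.≤-reflexive (cong (γ ℕ.+_) (sym (ℕₚ.+-identityʳ γ))))
      (ℕₚ.≤-trans (ℕₚ.m≤n⇒m≤1+n (ℕₚ.m≤n+m (2 ℕ.* γ) (2 ℕ.^ γ))) Γ≤h)
    γ+h′≡h : γ ℕ.+ h′ ≡ h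
    γ+h′≡h = ℕₚ.m+[n∸m]≡n (ℕₚ.≤-trans (ℕₚ.m≤m+n γ γ) 2γ≤h)
    h≤2h′ : h ℕ.≤ 2 ℕ.* h′
    h≤2h′ = ℕₚ.≤-trans (ℕₚ.≤-reflexive (sym γ+h′≡h)) (ℕₚ.≤-trans
      (ℕₚ.+-monoˡ-≤ h′ (ℕₚ.+-cancelˡ-≤ γ _ _ (ℕₚ.≤-trans 2γ≤h (ℕₚ.≤-reflexive (sym γ+h′≡h)))))
      (ℕₚ.≤-reflexive (cong (h′ ℕ.+_) (sym (ℕₚ.+-identityʳ h′)))))
    h′ln2⩽l : ν h′ ⊗ ln2 ⩽ l
    h′ln2⩽l = ⊕-cancelʳ (ν γ ⊗ ln2) (begin
      ν h′ ⊗ ln2 ⊕ ν γ ⊗ ln2         ≈⟨ lem (ν h′) (ν γ) ln2 ⟩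
      (ν γ ⊕ ν h′) ⊗ ln2             ≈⟨ ⊗-cong (≈-sym (ν-+ γ h′)) ≈-refl ⟩
      ν (γ ℕ.+ h′) ⊗ ln2             ≤⟨ exp-cancel-ln2 {γ ℕ.+ h′} (begin
        ν (2 ℕ.^ (γ ℕ.+ h′))           ≈⟨ ≡⇒≈ℝ (cong (λ e → ν (2 ℕ.^ e)) γ+h′≡h) ⟩
        ν (2 ℕ.^ h)                    ≤⟨ ν-mono (2^lg≤ g 1≤g) ⟩
        ν g                            ≤⟨ le ⟩
        ν (2 ℕ.^ γ) ⊗ x                ≈⟨ ⊗-cong (exp-ν⊗ln2 γ) exp-l ⟨
        exp (ν γ ⊗ ln2) ⊗ exp l        ≈⟨ exp-⊕ (ν γ ⊗ ln2) l ⟨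
        exp (ν γ ⊗ ln2 ⊕ l)            ∎) ⟩
      ν γ ⊗ ln2 ⊕ l                  ≈⟨ ⊕-comm (ν γ ⊗ ln2) l ⟩
      l ⊕ ν γ ⊗ ln2                  ∎)
      where
      open ℝ-Solver
      lem : ∀ x y z → x ⊗ z ⊕ y ⊗ z ≈ (y ⊕ x) ⊗ z
      lem = solve 3 (λ x y z → x :* z :+ y :* z := (y :+ x) :* z) ≈-refl
    0⩽l : κ 0ℚ ⩽ l
    0⩽l = ⩽-trans (⊗-nonneg (0⩽ν h′) 0⩽ln2) h′ln2⩽l
    h′⩽ : ν h′ ⩽ ν a ⊗ l
    h′⩽ = begin
      ν h′                      ≈⟨ ⊗-identityʳ (ν h′) ⟨
      ν h′ ⊗ κ 1ℚ               ≤⟨ ⊗-monoˡ (ν h′) (0⩽ν h′) (proj₂ 1/ln2-bound) ⟩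
      ν h′ ⊗ (ν a ⊗ ln2)        ≈⟨ lem (ν h′) (ν a) ln2 ⟩
      ν a ⊗ (ν h′ ⊗ ln2)        ≤⟨ ⊗-monoˡ (ν a) (0⩽ν a) h′ln2⩽l ⟩
      ν a ⊗ l                   ∎
      where
      open ℝ-Solver
      lem : ∀ x y z → x ⊗ (y ⊗ z) ≈ y ⊗ (x ⊗ z)
      lem = solve 3 (λ x y z → x :* (y :* z) := y :* (x :* z)) ≈-refl

  -- This reaches down to the iterate `k + 1` of `lg`, because `power-lower` takes one more
  -- logarithm, that of the last one in the bound.
  Deep : ℕ → ℕ → Set
  Deep zero    g = Γ ℕ.≤ g × Γ ℕ.≤ lg g
  Deep (suc k) g = Γ ℕ.≤ g × Deep k (lg g)

  deep⇒Γ≤ : ∀ k {g} → Deep k g → Γ ℕ.≤ g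
  deep⇒Γ≤ zero    = proj₁
  deep⇒Γ≤ (suc k) = proj₁

  eventually-deep : ∀ k → ∃[ N ] ∀ g → N ℕ.≤ g → Deep k g
  eventually-deep zero    = 2 ℕ.^ Γ , λ g le → ℕₚ.≤-trans (ℕₚ.<⇒≤ (n<2^n Γ)) le , 2^≤⇒≤lg le
  eventually-deep (suc k) = 2 ℕ.^ N ℕ.+ Γ , λ g le →
    ℕₚ.m+n≤o⇒n≤o (2 ℕ.^ N) le , proj₂ (eventually-deep k) (lg g) (2^≤⇒≤lg (ℕₚ.m+n≤o⇒m≤o (2 ℕ.^ N) le))
    where N = proj₁ (eventually-deep k)

  -- `next` adds an outer logarithm, whereas the recursion in `logarithms` passes from `x` to its
  -- logarithm and so adds an inner one.
  iterated-from-log : ∀ {X x j y} → Log X x → 0ℝ <ℝ x → IteratedLog x j y → IteratedLog X (suc j) y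
  iterated-from-log X→x 0<x (first x→y)         = next (first X→x) 0<x x→y
  iterated-from-log X→x 0<x (next it 0<z z→y) = next (iterated-from-log X→x 0<x it) 0<z z→y

  -- For r ≥ 1 + 2 / Q and u = log x / Q we have x ^ r ≥ x (exp u) ^ 2 ≥ x u ^ 2.
  module Denominator (r : ℝ) (1≺r : κ 1ℚ ≺ r) where

    excess : ∃[ q ] κ 1ℚ ⊕ (κ (recip q) ⊕ κ (recip q)) ⩽ r
    excess = q , (begin
      κ 1ℚ ⊕ (κ (recip q) ⊕ κ (recip q))        ≈⟨ ⊕-cong ≈-refl (≈-sym (κ-+ (recip q) (recip q))) ⟩
      κ 1ℚ ⊕ κ (recip q + recip q)              ≤⟨ ⊕-mono ⩽-refl (⩽-trans (κ-mono 2recip≤) (proj₂ (proj₂ g))) ⟩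
      κ 1ℚ ⊕ (r ⊕ ⊖ κ 1ℚ)                       ≈⟨ x⊕[y⊖x]≈y (κ 1ℚ) r ⟩
      r                                         ∎)
      where
      g : ∃[ ε ] 0ℚ < ε × κ ε ⩽ r ⊕ ⊖ κ 1ℚ
      g = gap (≺-sub 1≺r)
      q : ℕ
      q = proj₁ (2*recip-small (proj₁ (proj₂ g)))
      2recip≤ : recip q + recip q ≤ proj₁ g
      2recip≤ = ℚₚ.≤-trans (ℚₚ.≤-reflexive (sym (ι2* (recip q))))
        (proj₂ (2*recip-small (proj₁ (proj₂ g))) q ℕₚ.≤-refl)

    private
      q = proj₁ excess
      Q = suc q

    power-lower : ∀ {x l} → exp l ≈ x → κ 0ℚ ⩽ l → x ⊗ (l ⊗ l) ⩽ ν (Q ℕ.* Q) ⊗ exp (r ⊗ l)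
    power-lower {x} {l} exp-l 0⩽l = begin
      x ⊗ (l ⊗ l)                              ≈⟨ ⊗-cong ≈-refl (⊗-cong Qu≈l Qu≈l) ⟨
      x ⊗ ((ν Q ⊗ u) ⊗ (ν Q ⊗ u))              ≈⟨ lem x (ν Q) u ⟩
      (ν Q ⊗ ν Q) ⊗ (x ⊗ (u ⊗ u))              ≈⟨ ⊗-cong (≈-sym (ν-* Q Q)) ≈-refl ⟩
      ν (Q ℕ.* Q) ⊗ (x ⊗ (u ⊗ u))              ≤⟨ ⊗-monoˡ _ (0⩽ν (Q ℕ.* Q)) (begin
        x ⊗ (u ⊗ u)                              ≤⟨ ⊗-monoˡ x 0⩽x (⊗-mono 0⩽u (0⩽exp u) (x⩽exp 0⩽u) (x⩽exp 0⩽u)) ⟩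
        x ⊗ (exp u ⊗ exp u)                      ≈⟨ ⊗-cong exp-l (exp-⊕ u u) ⟨
        exp l ⊗ exp (u ⊕ u)                      ≈⟨ exp-⊕ l (u ⊕ u) ⟨
        exp (l ⊕ (u ⊕ u))                        ≈⟨ exp-cong (lem′ (κ (recip q)) l) ⟨
        exp ((κ 1ℚ ⊕ (κ (recip q) ⊕ κ (recip q))) ⊗ l)   ≤⟨ exp-mono (⊗-monoʳ l 0⩽l (proj₂ excess)) ⟩
        exp (r ⊗ l)                              ∎) ⟩
      ν (Q ℕ.* Q) ⊗ exp (r ⊗ l)                ∎
      where
      u = κ (recip q) ⊗ l
      0⩽u : κ 0ℚ ⩽ u
      0⩽u = ⊗-nonneg (≺⇒⩽ (κ-mono-< (0<recip q))) 0⩽l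
      0⩽x : κ 0ℚ ⩽ x
      0⩽x = ⩽-trans (0⩽exp l) (proj₁ exp-l)
      Qu≈l : ν Q ⊗ u ≈ l
      Qu≈l = begin-equality
        ν Q ⊗ (κ (recip q) ⊗ l)     ≈⟨ ⊗-assoc (ν Q) (κ (recip q)) l ⟨
        ν Q ⊗ κ (recip q) ⊗ l       ≈⟨ ⊗-cong (≈-trans (≈-sym (κ-* (ι Q) (recip q))) (≡⇒≈ℝ (cong κ (ι*recip q)))) ≈-refl ⟩
        κ 1ℚ ⊗ l                    ≈⟨ ⊗-identityˡ l ⟩
        l                           ∎
      open ℝ-Solver
      lem : ∀ x q u → x ⊗ ((q ⊗ u) ⊗ (q ⊗ u)) ≈ (q ⊗ q) ⊗ (x ⊗ (u ⊗ u))
      lem = solve 3 (λ x q u → x :* ((q :* u) :* (q :* u)) := (q :* q) :* (x :* (u :* u))) ≈-refl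
      lem′ : ∀ c l → (κ 1ℚ ⊕ (c ⊕ c)) ⊗ l ≈ l ⊕ (c ⊗ l ⊕ c ⊗ l)
      lem′ = solve 2 (λ c l → (con 1 :+ (c :+ c)) :* l := l :+ (c :* l :+ c :* l)) ≈-refl

    -- The constants collected in `lower`: a factor `2 ^ γ` whenever an iterate of `lg` is compared
    -- with a logarithm, three times in the base case since the last iterate is squared, and `Q * Q`
    -- from `power-lower`.
    scale : ℕ → ℕ
    scale zero    = 2 ℕ.^ γ ℕ.* (2 ℕ.^ γ ℕ.* 2 ℕ.^ γ) ℕ.* (Q ℕ.* Q)
    scale (suc k) = 2 ℕ.^ γ ℕ.* scale k

    -- With `log n` for `x`, `L j` is `log_j n`, and the denominator of the bound is `∏ L k * b`. Up
    -- to constants, the first `k` factors of `bertrand (2 + k) g` correspond to `∏ L k` and the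
    -- next to `L (k + 1)`. The last two are at most a constant times the square of the logarithm of
    -- `L (k + 1)`; by `power-lower`, this square times `L (k + 1)` is absorbed by `b`.
    record Logarithms (k : ℕ) (x : ℝ) (g : ℕ) : Set where
      field
        L        : ℕ → ℝ
        L1≡x     : L 1 ≡ x
        iterates : ∀ j → 1 ℕ.≤ j → j ℕ.≤ k → IteratedLog x j (L (suc j))
        1⩽last   : κ 1ℚ ⩽ L (suc k)
        b        : ℝ
        b-power  : Power (L (suc k)) r b
        1⩽∏      : κ 1ℚ ⩽ ∏ L k ⊗ b
        lower    : ν (bertrand (2 ℕ.+ k) g) ⩽ ν (scale k) ⊗ (∏ L k ⊗ b)

    logarithms : ∀ k {x g} → ν g ⩽ ν (2 ℕ.^ γ) ⊗ x → Deep k g → Logarithms k x g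
    logarithms zero {x} {g} g⩽x (Γ≤g , Γ≤h) = record
      -- For `k = 0` the product is empty and only `L 1` matters.
      { L = λ _ → x
      ; L1≡x = refl
      ; iterates = λ j 1≤j j≤0 → contradiction (ℕₚ.≤-trans 1≤j j≤0) λ ()
      ; 1⩽last = 1⩽x
      ; b = b
      ; b-power = l , exp⇒Exp exp-l , exp⇒Exp (exp-cong (*ℝ≈⊗ r l))
      ; 1⩽∏ = ⩽-trans (1⩽exp (⊗-nonneg 0⩽r 0⩽l)) (proj₂ ∏≈b)
      ; lower = begin
          ν (g ℕ.* (h ℕ.* 2 ℕ.^ lg h))             ≤⟨ ν-mono (ℕₚ.*-monoʳ-≤ g (ℕₚ.*-monoʳ-≤ h (2^lg≤ h (ℕₚ.≤-trans (ℕ.s≤s ℕ.z≤n) Γ≤h)))) ⟩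
          ν (g ℕ.* (h ℕ.* h))                      ≈⟨ ≈-trans (ν-* g (h ℕ.* h)) (⊗-cong ≈-refl (ν-* h h)) ⟩
          ν g ⊗ (ν h ⊗ ν h)                        ≤⟨ ⊗-mono (⊗-nonneg (0⩽ν h) (0⩽ν h)) (⊗-nonneg (0⩽ν G) 0⩽x) g⩽x
                                                        (⊗-mono (0⩽ν h) (⊗-nonneg (0⩽ν G) 0⩽l) h⩽l h⩽l) ⟩
          (ν G ⊗ x) ⊗ ((ν G ⊗ l) ⊗ (ν G ⊗ l))      ≈⟨ lem (ν G) x l ⟩
          (ν G ⊗ (ν G ⊗ ν G)) ⊗ (x ⊗ (l ⊗ l))      ≤⟨ ⊗-monoˡ _ (⊗-nonneg (0⩽ν G) (⊗-nonneg (0⩽ν G) (0⩽ν G))) (power-lower exp-l 0⩽l) ⟩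
          (ν G ⊗ (ν G ⊗ ν G)) ⊗ (ν (Q ℕ.* Q) ⊗ b)  ≈⟨ ⊗-assoc _ (ν (Q ℕ.* Q)) b ⟨
          (ν G ⊗ (ν G ⊗ ν G)) ⊗ ν (Q ℕ.* Q) ⊗ b    ≈⟨ ⊗-cong (≈-sym (≈-trans (ν-* (G ℕ.* (G ℕ.* G)) (Q ℕ.* Q)) (⊗-cong
                                                        (≈-trans (ν-* G (G ℕ.* G)) (⊗-cong ≈-refl (ν-* G G))) ≈-refl))) (≈-sym ∏≈b) ⟩
          ν (scale zero) ⊗ (1ℝ ⊗ b)                ∎
      }
      where
      h = lg g
      G = 2 ℕ.^ γ
      1⩽x : κ 1ℚ ⩽ x
      1⩽x = 1⩽-from-multiple Γ≤g g⩽x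
      0⩽x = ⩽-trans 0⩽1 1⩽x
      l = proj₁ (log-exists 1⩽x)
      exp-l = proj₂ (log-exists 1⩽x)
      0⩽l : κ 0ℚ ⩽ l
      0⩽l = 0⩽log 1⩽x exp-l
      h⩽l : ν h ⩽ ν G ⊗ l
      h⩽l = log-step exp-l (ℕₚ.≤-trans (ℕ.s≤s ℕ.z≤n) Γ≤g) g⩽x Γ≤h
      0⩽r : κ 0ℚ ⩽ r
      0⩽r = ⩽-trans 0⩽1 (≺⇒⩽ 1≺r)
      b = exp (r ⊗ l)
      ∏≈b : 1ℝ ⊗ b ≈ b
      ∏≈b = ≈-trans (⊗-cong 1ℝ≈1 ≈-refl) (⊗-identityˡ b)
      open ℝ-Solver
      lem : ∀ g x l → (g ⊗ x) ⊗ ((g ⊗ l) ⊗ (g ⊗ l)) ≈ (g ⊗ (g ⊗ g)) ⊗ (x ⊗ (l ⊗ l))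
      lem = solve 3 (λ g x l → (g :* x) :* ((g :* l) :* (g :* l)) := (g :* (g :* g)) :* (x :* (l :* l))) ≈-refl
    logarithms (suc k) {x} {g} g⩽x (Γ≤g , deep) = record
      { L = L
      ; L1≡x = refl
      ; iterates = iterates
      ; 1⩽last = Logarithms.1⩽last tail
      ; b = b
      ; b-power = Logarithms.b-power tail
      ; 1⩽∏ = begin
          κ 1ℚ                           ≤⟨ 1⩽x ⟩
          x                              ≈⟨ ⊗-identityʳ x ⟨
          x ⊗ κ 1ℚ                       ≤⟨ ⊗-monoˡ x 0⩽x (Logarithms.1⩽∏ tail) ⟩
          x ⊗ (∏ L′ k ⊗ b)               ≈⟨ ∏-front ⟨
          ∏ L (suc k) ⊗ b                ∎
      ; lower = begin
          ν (g ℕ.* bertrand (2 ℕ.+ k) h)              ≈⟨ ν-* g (bertrand (2 ℕ.+ k) h) ⟩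
          ν g ⊗ ν (bertrand (2 ℕ.+ k) h)              ≤⟨ ⊗-mono (0⩽ν (bertrand (2 ℕ.+ k) h)) (⊗-nonneg (0⩽ν G) 0⩽x) g⩽x (Logarithms.lower tail) ⟩
          (ν G ⊗ x) ⊗ (ν (scale k) ⊗ (∏ L′ k ⊗ b))    ≈⟨ lem (ν G) x (ν (scale k)) (∏ L′ k ⊗ b) ⟩
          (ν G ⊗ ν (scale k)) ⊗ (x ⊗ (∏ L′ k ⊗ b))    ≈⟨ ⊗-cong (ν-* G (scale k)) ∏-front ⟨
          ν (scale (suc k)) ⊗ (∏ L (suc k) ⊗ b)       ∎
      }
      where
      h = lg g
      G = 2 ℕ.^ γ
      1⩽x : κ 1ℚ ⩽ x
      1⩽x = 1⩽-from-multiple Γ≤g g⩽x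
      0⩽x = ⩽-trans 0⩽1 1⩽x
      l = proj₁ (log-exists 1⩽x)
      exp-l = proj₂ (log-exists 1⩽x)
      h⩽l : ν h ⩽ ν G ⊗ l
      h⩽l = log-step exp-l (ℕₚ.≤-trans (ℕ.s≤s ℕ.z≤n) Γ≤g) g⩽x (deep⇒Γ≤ k deep)
      0<l : 0ℝ <ℝ l
      0<l = 0≺⇒0< (≺-⩽-trans 0≺1 (1⩽-from-multiple (deep⇒Γ≤ k deep) h⩽l))
      tail : Logarithms k l h
      tail = logarithms k h⩽l deep
      L′ = Logarithms.L tail
      b = Logarithms.b tail
      L : ℕ → ℝ
      -- A default: products and iterated logarithms start at index 1.
      L zero          = x
      L (suc zero)    = x
      L (suc (suc j)) = L′ (suc j)
      iterates : ∀ j → 1 ℕ.≤ j → j ℕ.≤ suc k → IteratedLog x j (L (suc j))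
      iterates (suc zero)    _ _ = first (subst (Log x) (sym (Logarithms.L1≡x tail)) (exp⇒Exp exp-l))
      iterates (suc (suc j)) _ (ℕ.s≤s j<k) =
        iterated-from-log (exp⇒Exp exp-l) 0<l (Logarithms.iterates tail (suc j) (ℕ.s≤s ℕ.z≤n) j<k)
      -- `∏` grows by a last factor, whereas the recursion supplies a new first one.
      ∏-suc : ∀ m → ∏ L (suc m) ≈ x ⊗ ∏ L′ m
      ∏-suc zero    = ≈-trans (*ℝ≈⊗ 1ℝ x) (⊗-comm 1ℝ x)
      ∏-suc (suc m) = begin-equality
        ∏ L (suc m) *ℝ L′ (suc m)     ≈⟨ *ℝ≈⊗ _ _ ⟩
        ∏ L (suc m) ⊗ L′ (suc m)      ≈⟨ ⊗-cong (∏-suc m) ≈-refl ⟩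
        x ⊗ ∏ L′ m ⊗ L′ (suc m)       ≈⟨ ⊗-assoc x (∏ L′ m) (L′ (suc m)) ⟩
        x ⊗ (∏ L′ m ⊗ L′ (suc m))     ≈⟨ ⊗-cong ≈-refl (*ℝ≈⊗ _ _) ⟨
        x ⊗ ∏ L′ (suc m)              ∎
      ∏-front : ∏ L (suc k) ⊗ b ≈ x ⊗ (∏ L′ k ⊗ b)
      ∏-front = ≈-trans (⊗-cong (∏-suc k) ≈-refl) (⊗-assoc x (∏ L′ k) b)
      open ℝ-Solver
      lem : ∀ g x s d → (g ⊗ x) ⊗ (s ⊗ d) ≈ (g ⊗ s) ⊗ (x ⊗ d)
      lem = solve 4 (λ g x s d → (g :* x) :* (s :* d) := (g :* s) :* (x :* d)) ≈-refl

  module Comparison (α : ℝ) (1⩽α : κ 1ℚ ⩽ α) (r : ℝ) (1≺r : κ 1ℚ ≺ r) where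

    open Exponents α 1⩽α
    open Denominator r 1≺r

    -- For `n = 2 ^ (i + 1)`, `log n = (i + 1) * ln 2` is at least `i` up to the factor `2 ^ γ`, and
    -- `n ^ (1 / α) ≤ 2 ^ (φ i + 4)`: 3 comes from `Approximates` and 1 from `i + 1`. This is the 16
    -- in the hypothesis.
    bound-at-power : ∀ k {I φ} → Approximates I φ → ∀ i → i ℕ.≤ I → Deep k i →
      ∀ m → scale k ℕ.* 16 ℕ.* 2 ℕ.^ φ i ℕ.< m ℕ.* bertrand (2 ℕ.+ k) i →
      ∃[ v ] Bound α r (suc k) (2 ℕ.^ suc i) v × (v ⩽ ν m)
    bound-at-power k {φ = φ} (_ , above) i i≤I deep m many = v ,
      ( L , iterated , 0≺⇒0< (≺-⩽-trans 0≺1 1⩽last)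
      , a′ , (β , (0≺⇒0< 0≺α , ≈⇒≃ (≈-trans (*ℝ≈⊗ β α) (≈-trans β⊗α≈1 (≈-sym 1ℝ≈1)))) , x , log-n , exp⇒Exp (exp-cong (*ℝ≈⊗ β x)))
      , b , b-power
      , (0≺⇒0< (≺-⩽-trans (≺-⩽-trans 0≺1 1⩽∏) (proj₂ (*ℝ≈⊗ (∏ L k) b))) , ≈⇒≃ v⊗D≈a) )
      , v⩽m
      where
      x = ν (suc i) ⊗ ln2
      i⩽x : ν i ⩽ ν (2 ℕ.^ γ) ⊗ x
      i⩽x = begin
        ν i                              ≤⟨ ν-mono (ℕₚ.n≤1+n i) ⟩
        ν (suc i)                        ≈⟨ ⊗-identityʳ _ ⟨
        ν (suc i) ⊗ κ 1ℚ                 ≤⟨ ⊗-monoˡ _ (0⩽ν (suc i)) (proj₂ 1/ln2-bound) ⟩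
        ν (suc i) ⊗ (ν a ⊗ ln2)          ≈⟨ lem (ν (suc i)) (ν a) ln2 ⟩
        ν a ⊗ x                          ≤⟨ ⊗-monoʳ x (⊗-nonneg (0⩽ν (suc i)) 0⩽ln2)
                                              (ν-mono (ℕₚ.≤-trans (ℕₚ.m≤m+n a (a ℕ.+ 0)) (ℕₚ.<⇒≤ (n<2^n γ)))) ⟩
        ν (2 ℕ.^ γ) ⊗ x                  ∎
        where
        open ℝ-Solver
        lem : ∀ x y z → x ⊗ (y ⊗ z) ≈ y ⊗ (x ⊗ z)
        lem = solve 3 (λ x y z → x :* (y :* z) := y :* (x :* z)) ≈-refl
      open Logarithms (logarithms k i⩽x deep)
      X = fromℕ (2 ℕ.^ suc i)
      log-n : Log X x
      log-n = exp⇒Exp (≈-trans (exp-ν⊗ln2 (suc i)) (≡⇒≈ℝ (ν≡ (2 ℕ.^ suc i))))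
      0<x : 0ℝ <ℝ x
      0<x = 0≺⇒0< (⊗-pos (0≺ν (ℕ.s≤s ℕ.z≤n)) 0≺ln2)
      iterated : ∀ j → 1 ℕ.≤ j → j ℕ.≤ suc k → IteratedLog X j (L j)
      iterated (suc zero)    _ _           = first (subst (Log X) (sym L1≡x) log-n)
      iterated (suc (suc j)) _ (ℕ.s≤s j<k) = iterated-from-log log-n 0<x (iterates (suc j) (ℕ.s≤s ℕ.z≤n) j<k)
      β = proj₁ (inverse-exists 1⩽α)
      0⩽β = proj₁ (proj₂ (inverse-exists 1⩽α))
      β⊗α≈1 = proj₂ (proj₂ (inverse-exists 1⩽α))
      a′ = exp (β ⊗ x)
      a⩽ : a′ ⩽ ν (2 ℕ.^ (φ i ℕ.+ 4))
      a⩽ = begin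
        exp (β ⊗ (ν (suc i) ⊗ ln2))             ≈⟨ exp-cong (⊗-assoc β (ν (suc i)) ln2) ⟨
        exp (β ⊗ ν (suc i) ⊗ ln2)               ≤⟨ exp-mono (⊗-monoʳ ln2 0⩽ln2 β⊗) ⟩
        exp (ν (φ i ℕ.+ 4) ⊗ ln2)               ≈⟨ exp-ν⊗ln2 (φ i ℕ.+ 4) ⟩
        ν (2 ℕ.^ (φ i ℕ.+ 4))                   ∎
        where
        β⊗ : β ⊗ ν (suc i) ⩽ ν (φ i ℕ.+ 4)
        β⊗ = begin
          β ⊗ ν (suc i)                             ≤⟨ ⊗-monoˡ β 0⩽β (begin
            ν (suc i)                                 ≈⟨ ≈-trans (ν-+ 1 i) (⊕-comm (ν 1) (ν i)) ⟩
            ν i ⊕ ν 1                                 ≤⟨ ⊕-mono (above i i≤I) (x⩽α⊗x (0⩽ν 1)) ⟩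
            α ⊗ ν (φ i ℕ.+ 3) ⊕ α ⊗ ν 1               ≈⟨ ⊗-distribˡ-⊕ α (ν (φ i ℕ.+ 3)) (ν 1) ⟨
            α ⊗ (ν (φ i ℕ.+ 3) ⊕ ν 1)                 ≈⟨ ⊗-cong ≈-refl (≈-sym (ν-+ (φ i ℕ.+ 3) 1)) ⟩
            α ⊗ ν (φ i ℕ.+ 3 ℕ.+ 1)                   ≈⟨ ≡⇒≈ℝ (cong (λ e → α ⊗ ν e) (ℕₚ.+-assoc (φ i) 3 1)) ⟩
            α ⊗ ν (φ i ℕ.+ 4)                         ∎) ⟩
          β ⊗ (α ⊗ ν (φ i ℕ.+ 4))                   ≈⟨ ⊗-assoc β α _ ⟨
          β ⊗ α ⊗ ν (φ i ℕ.+ 4)                     ≈⟨ ≈-trans (⊗-cong β⊗α≈1 ≈-refl) (⊗-identityˡ _) ⟩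
          ν (φ i ℕ.+ 4)                             ∎
      D = ∏ L k ⊗ b
      d = proj₁ (inverse-exists 1⩽∏)
      0⩽d = proj₁ (proj₂ (inverse-exists 1⩽∏))
      d⊗D≈1 = proj₂ (proj₂ (inverse-exists 1⩽∏))
      v = a′ ⊗ d
      v⊗D≈a′ : v ⊗ D ≈ a′
      v⊗D≈a′ = ≈-trans (⊗-assoc a′ d D) (≈-trans (⊗-cong ≈-refl d⊗D≈1) (⊗-identityʳ a′))
      v⊗D≈a : v *ℝ (∏ L k *ℝ b) ≈ a′
      v⊗D≈a = ≈-trans (*ℝ≈⊗ v _) (≈-trans (⊗-cong ≈-refl (*ℝ≈⊗ (∏ L k) b)) v⊗D≈a′)
      G = bertrand (2 ℕ.+ k) i
      1≤G : 1 ℕ.≤ G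
      1≤G = ℕₚ.n≢0⇒n>0 λ G≡0 → contradiction
        (subst (λ t → scale k ℕ.* 16 ℕ.* 2 ℕ.^ φ i ℕ.< t) (trans (cong (m ℕ.*_) G≡0) (ℕₚ.*-zeroʳ m)) many) λ ()
      v⩽m : v ⩽ ν m
      v⩽m = ⊗-cancelˡ (ν G) (0≺ν 1≤G) (begin
        ν G ⊗ v                                     ≤⟨ ⊗-monoʳ v (⊗-nonneg (0⩽exp _) 0⩽d) lower ⟩
        ν (scale k) ⊗ D ⊗ v                         ≈⟨ ⊗-assoc (ν (scale k)) D v ⟩
        ν (scale k) ⊗ (D ⊗ v)                       ≈⟨ ⊗-cong ≈-refl (≈-trans (⊗-comm D v) v⊗D≈a′) ⟩
        ν (scale k) ⊗ a′                            ≤⟨ ⊗-monoˡ _ (0⩽ν (scale k)) a⩽ ⟩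
        ν (scale k) ⊗ ν (2 ℕ.^ (φ i ℕ.+ 4))         ≈⟨ ν-* (scale k) (2 ℕ.^ (φ i ℕ.+ 4)) ⟨
        ν (scale k ℕ.* 2 ℕ.^ (φ i ℕ.+ 4))           ≤⟨ ν-mono (ℕₚ.≤-trans (ℕₚ.≤-reflexive natural) (ℕₚ.<⇒≤ many)) ⟩
        ν (m ℕ.* G)                                 ≈⟨ ≈-trans (ν-* m G) (⊗-comm (ν m) (ν G)) ⟩
        ν G ⊗ ν m                                   ∎)
        where
        natural : scale k ℕ.* 2 ℕ.^ (φ i ℕ.+ 4) ≡ scale k ℕ.* 16 ℕ.* 2 ℕ.^ φ i
        natural = trans (cong (scale k ℕ.*_) (trans (ℕₚ.^-distribˡ-+-* 2 (φ i) 4) (ℕₚ.*-comm (2 ℕ.^ φ i) 16)))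
          (sym (ℕₚ.*-assoc (scale k) 16 (2 ℕ.^ φ i)))

    1≤scale : ∀ k → 1 ℕ.≤ scale k
    1≤scale zero    = ℕₚ.*-mono-≤ (ℕₚ.*-mono-≤ (ℕₚ.m^n>0 2 γ) (ℕₚ.*-mono-≤ (ℕₚ.m^n>0 2 γ) (ℕₚ.m^n>0 2 γ))) (ℕ.s≤s ℕ.z≤n)
    1≤scale (suc k) = ℕₚ.*-mono-≤ (ℕₚ.m^n>0 2 γ) (1≤scale k)

open import Data.Nat.Base using (ℕ; _≤_)
open import Data.Product using (_×_; ∃-syntax)
open import Relation.Unary using (Pred)

-- Infinitude of P(S) and lower bounds for its counting function.

module Theorem where

  open import Data.List.Base using ([]; _∷_; length; lookup)
  open import Data.List.Membership.Propositional using () renaming (_∈_ to _∈ₗ_)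
  open import Data.List.Membership.Propositional.Properties using (∈-lookup)
  open import Data.List.Relation.Unary.Any using (here)
  open import Data.Nat.Base using (suc; _+_; _*_; _^_; _<_; z≤n; s≤s)
  open import Data.Nat.Properties
    using (≤-refl; ≤-trans; <⇒≤; n≤1+n; *-mono-≤; m+n≤o⇒m≤o; m+n≤o⇒n≤o)
  open import Data.Product.Base using (_,_; proj₁; proj₂)
  open import Data.Rational.Base using (1ℚ)
  open import Function.Bundles using (Equivalence)
  open import Relation.Binary.PropositionalEquality using (_≡_; refl; sym; subst)
  open import Relation.Nullary using (contradiction)
  open Sieve
    using (n<2^n; bertrand; bertrand-summable; lookup-injective; module PrimeBlocks)
  open Reals
  open ExpLog
  open Growth

  module Conclusion {ℓ} (α : ℝ) (1≤α : 1ℝ ≤ℝ α) (S : Pred ℕ ℓ) (dense : PolynomialDensity α S) where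

    private
      s = proj₁ dense
      s≥1 = proj₁ (proj₂ dense)
      s-increasing = proj₁ (proj₂ (proj₂ dense))
      range = proj₁ (proj₂ (proj₂ (proj₂ dense)))
      bigO = proj₂ (proj₂ (proj₂ (proj₂ dense)))
      1⩽α : κ 1ℚ ⩽ α
      1⩽α = ⩽-trans (proj₂ 1ℝ≈1) (⩽-to 1≤α)

    open PrimeBlocks s
    open Exponents α 1⩽α

    block⊆P : ∀ M i {p} → p ∈ₗ block M i → P S p
    block⊆P M i p∈ with ∈-block⁻ M i p∈
    ... | _ , _ , p-prime , j , _ , p∣sj = p-prime , s j , Equivalence.from (range (s j)) (j , refl) , p∣sj

    abstract
      dense-blocks : ∀ K k N → 1 ≤ K → ∃[ I ] ∃[ φ ] Approximates I φ × ∃[ i ] N ≤ i × i ≤ I ×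
        ∃[ M ] K * 2 ^ φ i < length (block M i) * bertrand k i
      dense-blocks K k N 1≤K = manyPrimes s≥1 s-increasing (proj₁ (proj₂ α-natural)) 1≤K
        (bertrand-summable k) (admissible s≥1 bigO) N

    -- The coarsest series `bertrand 0` is enough: the strict inequality shows that the block is not
    -- empty, and its elements are at least `2 ^ i > i > N`.
    infinitelyManyPrimes : InfinitelyMany (P S)
    infinitelyManyPrimes N with dense-blocks 1 0 (suc N) ≤-refl
    ... | _ , φ , _ , i , N<i , _ , M , many = largest (block M i) refl
      where
      largest : ∀ ps → block M i ≡ ps → ∃[ p ] N < p × P S p
      largest []       eq = contradiction (subst (λ ps → 1 * 2 ^ φ i < length ps * 2 ^ i) eq many) λ ()
      largest (p ∷ ps) eq = p
        , ≤-trans N<i (≤-trans (<⇒≤ (n<2^n i)) (proj₁ (∈-block⁻ M i p∈)))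
        , block⊆P M i p∈
        where
        p∈ : p ∈ₗ block M i
        p∈ = subst (p ∈ₗ_) (sym eq) (here refl)

    module _ (r : ℝ) (1<r : 1ℝ <ℝ r) where

      private
        1≺r : κ 1ℚ ≺ r
        1≺r = ⩽-≺-trans (proj₂ 1ℝ≈1) (≺-to 1<r)

      open Denominator r 1≺r using (scale)
      open Comparison α 1⩽α r 1≺r

      Often : ℕ → ℕ → Set ℓ
      Often k N = ∃[ n ] N < n × ∃[ v ] Bound α r (suc k) n v × π S ⟨ n ⟩≥ v

      -- The primes of the block are below `n = 2 ^ (i + 1)` and the list has no repetitions, so
      -- indexing it is the injection that `AtLeast` asks for.
      block-bound : ∀ k N i M → N ≤ i →
        (∃[ v ] Bound α r (suc k) (2 ^ suc i) v × (v ⩽ ν (length (block M i)))) → Often k N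
      block-bound k N i M N≤i (v , bound , v⩽m) =
        2 ^ suc i
        , ≤-trans (s≤s (≤-trans N≤i (n≤1+n i))) (n<2^n (suc i))
        , v , bound
        , length (block M i)
        , ( lookup (block M i) , lookup-injective (block-unique M i)
          , λ j → block⊆P M i (∈-lookup j) , <⇒≤ (proj₁ (proj₂ (∈-block⁻ M i (∈-lookup {xs = block M i} j)))) )
        , ⩽-from (subst (v ⩽_) (ν≡ (length (block M i))) v⩽m)

      infinitelyOften : ∀ k → InfinitelyMany (λ n → ∃[ v ] Bound α r (suc k) n v × π S ⟨ n ⟩≥ v)
      -- `scale k * 16` is what `bound-at-power` loses, and `bertrand (2 + k)` is the sequence that
      -- it compares with the bound for `suc k` logarithms.
      infinitelyOften k N = often (dense-blocks (scale k * 16) (2 + k) (N + proj₁ (eventually-deep k))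
          (*-mono-≤ (1≤scale k) (s≤s z≤n)))
        where
        often : (∃[ I ] ∃[ φ ] Approximates I φ × ∃[ i ] N + proj₁ (eventually-deep k) ≤ i × i ≤ I ×
          ∃[ M ] scale k * 16 * 2 ^ φ i < length (block M i) * bertrand (2 + k) i) → Often k N
        often (I , φ , approx , i , N+N′≤i , i≤I , M , many) = block-bound k N i M (m+n≤o⇒m≤o N N+N′≤i)
          (bound-at-power k approx i i≤I (proj₂ (eventually-deep k) i (m+n≤o⇒n≤o N N+N′≤i)) (length (block M i)) many)

      quotient-cong : ∀ x {y y′} q → y ≈ y′ → Quotient x y q → Quotient x y′ q
      quotient-cong x {y} {y′} q y≈y′ (0<y , qy≃x) =
        0≺⇒0< (≺-⩽-trans (0<⇒0≺ 0<y) (proj₁ y≈y′))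
        , ≈⇒≃ (≈-trans (*ℝ≈⊗ q y′) (≈-trans (⊗-cong ≈-refl (≈-sym y≈y′))
            (≈-trans (≈-sym (*ℝ≈⊗ q y)) (≃⇒≈ {q *ℝ y} {x} qy≃x))))

      1*≈ : ∀ x → (1ℝ *ℝ x) ≈ x
      1*≈ x = ≈-trans (*ℝ≈⊗ 1ℝ x) (≈-trans (⊗-cong 1ℝ≈1 ≈-refl) (⊗-identityˡ x))

      iterated-log₁ : ∀ {x y} → IteratedLog x 1 y → Log x y
      iterated-log₁ (first log-x) = log-x

      iterated-log₂ : ∀ {x y} → IteratedLog x 2 y → ∃[ l ] Log x l × 0ℝ <ℝ l × Log l y
      iterated-log₂ (next (first log-x) 0<l log-l) = _ , log-x , 0<l , log-l

      bound⇒bound₁ : ∀ {n v} → Bound α r 1 n v → Bound₁ α r n v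
      bound⇒bound₁ {v = v} (L , logs , 0<L , a , root , b , power , quotient) =
        L 1 , iterated-log₁ (logs 1 ≤-refl ≤-refl) , 0<L , a , root , b , power , quotient-cong a v (1*≈ b) quotient

      bound⇒bound₂ : ∀ {n v} → Bound α r 2 n v → Bound₂ α r n v
      bound⇒bound₂ {n} {v} (L , logs , 0<L , a , root , b , power , quotient) =
        l , log-n , 0<l , L 2 , log-l , 0<L , a , root , b , power , quotient-cong a v ∏≈ quotient
        where
        log-n′ : Log (fromℕ n) (L 1)
        log-n′ = iterated-log₁ (logs 1 ≤-refl (s≤s z≤n))
        logs₂ : ∃[ l ] Log (fromℕ n) l × 0ℝ <ℝ l × Log l (L 2)
        logs₂ = iterated-log₂ (logs 2 (s≤s z≤n) ≤-refl)
        l : ℝ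
        l = proj₁ logs₂
        log-n : Log (fromℕ n) l
        log-n = proj₁ (proj₂ logs₂)
        0<l : 0ℝ <ℝ l
        0<l = proj₁ (proj₂ (proj₂ logs₂))
        log-l : Log l (L 2)
        log-l = proj₂ (proj₂ (proj₂ logs₂))
        -- The second iterated logarithm brings its own witness `l` of `log n`, which equals `L 1`
        -- only as a real number, by injectivity of `exp`.
        L1≈l : L 1 ≈ l
        L1≈l = exp-cancel (⩽-trans (proj₁ (Exp⇒exp {L 1} {fromℕ n} log-n′)) (proj₂ (Exp⇒exp {l} {fromℕ n} log-n)))
             , exp-cancel (⩽-trans (proj₁ (Exp⇒exp {l} {fromℕ n} log-n)) (proj₂ (Exp⇒exp {L 1} {fromℕ n} log-n′)))
        ∏≈ : (∏ L 1 *ℝ b) ≈ (l *ℝ b)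
        ∏≈ = ≈-trans (*ℝ≈⊗ (∏ L 1) b) (≈-trans (⊗-cong (≈-trans (1*≈ (L 1)) L1≈l) ≈-refl) (≈-sym (*ℝ≈⊗ l b)))

      map-bound : ∀ k {B : ℕ → ℝ → Set} → (∀ {n v} → Bound α r k n v → B n v) →
        InfinitelyMany (λ n → ∃[ v ] Bound α r k n v × π S ⟨ n ⟩≥ v) →
        InfinitelyMany (λ n → ∃[ v ] B n v × π S ⟨ n ⟩≥ v)
      map-bound k {B} f often N = apply (often N)
        where
        apply : (∃[ n ] N < n × ∃[ v ] Bound α r k n v × π S ⟨ n ⟩≥ v) → ∃[ n ] N < n × ∃[ v ] B n v × π S ⟨ n ⟩≥ v
        apply (n , N<n , v , bound , π≥) = n , N<n , v , f {n} {v} bound , π≥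

      allBounds : (∀ k → 1 ≤ k → InfinitelyMany (λ n → ∃[ v ] Bound α r k n v × π S ⟨ n ⟩≥ v))
        × InfinitelyMany (λ n → ∃[ v ] Bound₁ α r n v × π S ⟨ n ⟩≥ v)
        × InfinitelyMany (λ n → ∃[ v ] Bound₂ α r n v × π S ⟨ n ⟩≥ v)
      allBounds = (λ { (suc k) _ → infinitelyOften k })
        , map-bound 1 {B = Bound₁ α r} (λ {n} {v} → bound⇒bound₁ {n} {v}) (infinitelyOften 0)
        , map-bound 2 {B = Bound₂ α r} (λ {n} {v} → bound⇒bound₂ {n} {v}) (infinitelyOften 1)

open import Data.Product.Base using (_,_)
open Theorem.Conclusion using (infinitelyManyPrimes; allBounds)

corollary1 : ∀ {ℓ} (α : ℝ) → 1ℝ ≤ℝ α →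
    (S : Pred ℕ ℓ) → PolynomialDensity α S →
    InfinitelyMany (P S)
    × (∀ (r : ℝ) → 1ℝ <ℝ r →
    (∀ (k : ℕ) → 1 ≤ k →
    InfinitelyMany (λ n → ∃[ v ] Bound α r k n v × π S ⟨ n ⟩≥ v))
    × InfinitelyMany (λ n → ∃[ v ] Bound₁ α r n v × π S ⟨ n ⟩≥ v)
    × InfinitelyMany (λ n → ∃[ v ] Bound₂ α r n v × π S ⟨ n ⟩≥ v))
corollary1 α 1≤α S dense = infinitelyManyPrimes α 1≤α S dense , allBounds α 1≤α S dense
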